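{- Let $f(t_1,t_2)=At_1^2+Bt_1t_2+Ct_2^2$ be a primitive binary quadratic form with $A,B,C\in\mathbb{Z}$ whose Discriminant $\Delta\coloneqq B^2-4AC$ is nonzero, and suppose $f$ is isotropic, i.e. $\Delta=b^2$ for some $b\in\mathbb{Z}^+$. Then $\delta(f)>0$. More precisely, for each prime $p$ let $a_p=v_p(\Delta)$ (so each $a_p$ is even), put \[ \delta_2 \coloneqq \begin{cases} 1 & \text{if } a_2=0,\\ \frac{3}{4} & \text{if } a_2=2,\\ \frac{2+2^{4-a_2}+2^{5-a_2}+2^{2-a_2}}{12} & \text{if } a_2\geq 4,\end{cases} \] and for $p>2$ put \[ \delta_p \coloneqq \frac{p+p^{1-a_p}+2p^{ -a_p}}{2p+2}. \] Then $\delta(f)=\prod_p \delta_p$, the product over all primes; moreover $\delta_p=1$ if and only if $a_p=0$, so the product may equivalently be taken over the primes dividing $\Delta$.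
   Context: A binary form is primitive if $\gcd(A,B,C)=1$. For a quadratic form $f\in\mathbb{Z}[t_1,\dots,t_n]$ let $D_f\coloneqq f(\mathbb{Z}^n)\setminus\{0\}$. For $S\subset\mathbb{Z}$: $S$ is positive if it contains no negative integers, negative if it contains no positive integers, indefinite otherwise. The density of $S$ is $\lim_{N\to\infty}\#(S\cap[1,N])/N$ if $S$ is positive, $\lim_{N\to\infty}\#(S\cap[-N,-1])/N$ if $S$ is negative, and $\lim_{N\to\infty}\#(S\cap[-N,N])/(2N)$ if $S$ is indefinite (the limit being required to exist). $\delta(f)$ denotes the density of $D_f$. $v_p$ is the $p$-adic valuation. -}

module Defs where

open import Data.Nat as ℕ using (ℕ; zero; suc)
open import Data.Nat.Properties using (m^n≢0)
open import Data.Nat.Divisibility using (_∣?_; quotient)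
open import Data.Nat.Primality using (Prime; prime?)
open import Data.Nat.GCD using (gcd)
open import Data.Integer as ℤ using (ℤ; +_; -_; ∣_∣)
open import Data.Rational as ℚ using (ℚ; 0ℚ; 1ℚ; _/_)
open import Data.List using (List; length)
open import Data.List.Relation.Unary.Unique.Propositional using (Unique)
open import Data.List.Membership.Propositional using (_∈_)
open import Data.Product using (Σ; ∃-syntax; _×_)
open import Data.Sum using (_⊎_)
open import Function.Bundles using (_⇔_)
open import Relation.Nullary using (¬_; yes; no)
open import Relation.Binary.PropositionalEquality using (_≡_)

form : ℤ → ℤ → ℤ → ℤ → ℤ → ℤ
form A B C t₁ t₂ = A ℤ.* t₁ ℤ.* t₁ ℤ.+ B ℤ.* t₁ ℤ.* t₂ ℤ.+ C ℤ.* t₂ ℤ.* t₂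

Primitive : ℤ → ℤ → ℤ → Set
Primitive A B C = gcd (gcd ∣ A ∣ ∣ B ∣) ∣ C ∣ ≡ 1

disc : ℤ → ℤ → ℤ → ℤ
disc A B C = B ℤ.* B ℤ.- + 4 ℤ.* A ℤ.* C

D : ℤ → ℤ → ℤ → ℤ → Set
D A B C n = ¬ (n ≡ + 0) × ∃[ t₁ ] ∃[ t₂ ] form A B C t₁ t₂ ≡ n

CountIs : (ℤ → Set) → ℤ → ℤ → ℕ → Set
CountIs S lo hi c =
  Σ (List ℤ) λ L → Unique L × (∀ x → (x ∈ L) ⇔ (lo ℤ.≤ x × x ℤ.≤ hi × S x)) × length L ≡ c

PositiveSet : (ℤ → Set) → Set
PositiveSet S = ∀ x → S x → + 0 ℤ.≤ x

NegativeSet : (ℤ → Set) → Set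
NegativeSet S = ∀ x → S x → x ℤ.≤ + 0

LimPos : (ℤ → Set) → ℚ → Set
LimPos S q = ∀ ε → 0ℚ ℚ.< ε → ∃[ n₀ ] ∀ n → n₀ ℕ.≤ n →
  ∃[ c ] CountIs S (+ 1) (+ suc n) c × ℚ.∣ (+ c / suc n) ℚ.- q ∣ ℚ.< ε

LimNeg : (ℤ → Set) → ℚ → Set
LimNeg S q = ∀ ε → 0ℚ ℚ.< ε → ∃[ n₀ ] ∀ n → n₀ ℕ.≤ n →
  ∃[ c ] CountIs S (- (+ suc n)) (- (+ 1)) c × ℚ.∣ (+ c / suc n) ℚ.- q ∣ ℚ.< ε

LimIndef : (ℤ → Set) → ℚ → Set
LimIndef S q = ∀ ε → 0ℚ ℚ.< ε → ∃[ n₀ ] ∀ n → n₀ ℕ.≤ n →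
  ∃[ c ] CountIs S (- (+ suc n)) (+ suc n) c × ℚ.∣ (+ c / (suc n ℕ.+ suc n)) ℚ.- q ∣ ℚ.< ε

HasDensity : (ℤ → Set) → ℚ → Set
HasDensity S q =
  (PositiveSet S × LimPos S q) ⊎
  (NegativeSet S × LimNeg S q) ⊎
  (¬ PositiveSet S × ¬ NegativeSet S × LimIndef S q)

-- p-adic valuation v_p(n) of a natural number n (with v_p(0) = 0 as junk;
-- correct for p ≥ 2, n ≠ 0 since the fuel n suffices)

vGo : ℕ → ℕ → ℕ → ℕ
vGo zero    p n       = 0
vGo (suc f) p zero    = 0
vGo (suc f) p (suc m) with p ∣? suc m
... | yes d = suc (vGo f p (quotient d))
... | no  _ = 0

v : ℕ → ℕ → ℕ
v p n = vGo n p n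

-- p^{-a} as a rational (junk 0 for p = 0)
invPow : ℕ → ℕ → ℚ
invPow zero    a = 0ℚ
invPow (suc k) a = _/_ (+ 1) (suc k ℕ.^ a) {{m^n≢0 (suc k) a}}

nat : ℕ → ℚ
nat n = + n / 1

-- δ₂ (the cases a = 1, 3 never occur since a₂ is even)
δ₂ : ℕ → ℚ
δ₂ 0 = 1ℚ
δ₂ 2 = + 3 / 4
δ₂ a = (nat 2 ℚ.+ nat 16 ℚ.* invPow 2 a ℚ.+ nat 32 ℚ.* invPow 2 a ℚ.+ nat 4 ℚ.* invPow 2 a)
       ℚ.* (+ 1 / 12)

δodd : ℕ → ℕ → ℚ
δodd p a = (nat p ℚ.+ nat p ℚ.* invPow p a ℚ.+ nat 2 ℚ.* invPow p a)
           ℚ.* (+ 1 / suc (suc (p ℕ.+ p)))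

δloc : ℕ → ℕ → ℚ
δloc 2 a = δ₂ a
δloc p a = δodd p a

factor : ℤ → ℕ → ℚ
factor Δ p with prime? p
... | yes _ = δloc p (v p ∣ Δ ∣)
... | no  _ = 1ℚ

prodUpTo : ℕ → (ℕ → ℚ) → ℚ
prodUpTo zero    g = 1ℚ
prodUpTo (suc n) g = prodUpTo n g ℚ.* g (suc n)

-- ∏_p δ_p : the factors at primes p > |Δ| are 1 (a_p = 0), so the
-- product over all primes is the product over primes p ≤ |Δ|
densityFormula : ℤ → ℚ
densityFormula Δ = prodUpTo ∣ Δ ∣ (factor Δ)

{-# OPTIONS --safe #-}
-- A primitive form of discriminant b² is equivalent to x (a x + b y) with a prime to b, so n is
-- represented iff n = x z with z ≡ a x (mod b). Its values modulo b² form a set whose proportion is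
-- ∏ δ_p: by CRT this is a count modulo p^2e, and there units contribute the unit squares modulo p^e
-- and multiples of p reduce to p^(2e-2). Every n in such a class is represented as soon as the divisors
-- of n meet every residue class prime to b, so it remains to see that almost all n have this property.
--
-- Let S be a set of residues containing 1 but missing a unit g. A number n ≡ g (mod b) sends 1 out of S,
-- hence so does one of its prime factors p for some s in S; so every number g + j b has a prime factor in
-- the set P of primes with p S ⊄ S. Comparing this with the sieve density ∏ (1 - 1/p) over P forces that
-- density to 0. So almost all n have a factor p in P, which may be taken bounded, and one passes to n / p
-- and S ∪ p S. No information on primes in individual residue classes is needed.
module Submission where

open import Defs
open import Data.Empty using (⊥; ⊥-elim)
open import Data.Integer as ℤ using (ℤ; +_; -[1+_])
import Data.Integer.Divisibility.Signed as ℤ∣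
import Data.Integer.DivMod as ℤDM
import Data.Integer.Properties as ℤP
import Data.Integer.Tactic.RingSolver as ℤS
open import Data.List using ([]; _∷_; map; filter; downFrom; length; _++_)
open import Data.List.Membership.Propositional using (_∈_)
open import Data.List.Membership.Propositional.Properties using (∈-++⁺ˡ; ∈-++⁺ʳ; ∈-++⁻; ∈-map⁺; ∈-map⁻; ∈-filter⁺; ∈-filter⁻; ∈-downFrom⁺; ∈-downFrom⁻)
open import Data.List.Properties using (length-map; length-++)
open import Data.List.Relation.Unary.All using (All; []; _∷_)
import Data.List.Relation.Unary.Unique.Propositional.Properties as Unique
open import Data.Nat
open import Data.Nat.Coprimality as Coprime using (Coprime)
open import Data.Nat.Divisibility
open import Data.Nat.DivMod
open import Data.Nat.GCD using (gcd; gcd-greatest; gcd[m,n]∣m; gcd[m,n]∣n; gcd[m,n]≢0; module Bézout)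
open import Data.Nat.ListAction using (product)
open import Data.Nat.Primality
open import Data.Nat.Primality.Factorisation using (factorise)
open import Data.Nat.Properties
import Data.Nat.Tactic.RingSolver as ℕS
open import Data.Product using (Σ; ∃; ∃₂; _×_; _,_; proj₁; proj₂; ∃-syntax)
open import Data.Rational as ℚ using (ℚ; 0ℚ; 1ℚ)
import Data.Rational.Properties as ℚP
open import Data.Rational.Solver using (module +-*-Solver)
import Data.Rational.Unnormalised as ℚᵘ
import Data.Rational.Unnormalised.Properties as ℚᵘP
open import Data.Sum using (_⊎_; inj₁; inj₂)
open import Data.Unit using (⊤; tt)
open import Function using (_∘_; id; case_of_)
open import Function.Bundles using (_⇔_; mk⇔)
open import Relation.Binary.Definitions using (tri<; tri≈; tri>)
open import Relation.Binary.PropositionalEquality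
open import Relation.Nullary
open import Relation.Nullary.Decidable using (map′; _×-dec_; _⊎-dec_; _→-dec_; ¬?; decidable-stable)
open import Relation.Unary using (Decidable)

-- Congruences

-- Solvability is tested modulo b² because a common factor g of x and b also divides z: g² splits
-- off n, and n / g² is then needed modulo b / g. The exceptional set is sparse as a whole, so it is
-- discarded without asking how it spreads over the classes modulo b², and periodicity counts the
-- rest.
--
-- The comparison that forces the sieve density to 0 is quantitative. Let δ be the product of 1 -
-- 1/p over the p ≤ z in P. It is the proportion of the g + j b with j < L that avoid these p. Every
-- such number is at most b L and still has a factor in P, so δ ≤ (b + 1) Σ 1/p over the p in P with
-- z < p ≤ b L. As ∏ p/(p - 1) ≥ 1 + Σ 1/p, passing from z to b L raises 1/δ by at least 1/(b + 1),
-- and repetition makes 1/δ unbounded. All this is done in ℕ with denominators cleared.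
--
-- For negative n, -n is represented with -a in place of a. Both signs have the same proportion,
-- since the local densities depend on the discriminant alone.

infix 4 _≡_[mod_]

record _≡_[mod_] (x y : ℤ) (m : ℕ) : Set where
  constructor mod-by
  field
    quot : ℤ
    eqn  : x ≡ y ℤ.+ quot ℤ.* + m

module _ {m : ℕ} where

  ≡⇒mod : ∀ {x y} → x ≡ y → x ≡ y [mod m ]
  ≡⇒mod {x} refl = mod-by (+ 0) (sym (ℤP.+-identityʳ x))

  mod-refl : ∀ {x} → x ≡ x [mod m ]
  mod-refl = ≡⇒mod refl

  mod-sym : ∀ {x y} → x ≡ y [mod m ] → y ≡ x [mod m ]
  mod-sym {x} {y} (mod-by q refl) = mod-by (ℤ.- q) (lem y q (+ m))
    where
    lem : ∀ y q m → y ≡ y ℤ.+ q ℤ.* m ℤ.+ (ℤ.- q) ℤ.* m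
    lem = ℤS.solve-∀

  mod-trans : ∀ {x y z} → x ≡ y [mod m ] → y ≡ z [mod m ] → x ≡ z [mod m ]
  mod-trans {z = z} (mod-by q refl) (mod-by r refl) = mod-by (r ℤ.+ q) (lem z q r (+ m))
    where
    lem : ∀ z q r m → z ℤ.+ r ℤ.* m ℤ.+ q ℤ.* m ≡ z ℤ.+ (r ℤ.+ q) ℤ.* m
    lem = ℤS.solve-∀

  mod-+ : ∀ {x y x′ y′} → x ≡ y [mod m ] → x′ ≡ y′ [mod m ] → x ℤ.+ x′ ≡ y ℤ.+ y′ [mod m ]
  mod-+ {y = y} {y′ = y′} (mod-by q refl) (mod-by r refl) = mod-by (q ℤ.+ r) (lem y y′ q r (+ m))
    where
    lem : ∀ y z q r m → y ℤ.+ q ℤ.* m ℤ.+ (z ℤ.+ r ℤ.* m) ≡ y ℤ.+ z ℤ.+ (q ℤ.+ r) ℤ.* m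
    lem = ℤS.solve-∀

  mod-* : ∀ {x y x′ y′} → x ≡ y [mod m ] → x′ ≡ y′ [mod m ] → x ℤ.* x′ ≡ y ℤ.* y′ [mod m ]
  mod-* {y = y} {y′ = y′} (mod-by q refl) (mod-by r refl) =
    mod-by (y ℤ.* r ℤ.+ q ℤ.* y′ ℤ.+ q ℤ.* r ℤ.* + m) (lem y y′ q r (+ m))
    where
    lem : ∀ y z q r m → (y ℤ.+ q ℤ.* m) ℤ.* (z ℤ.+ r ℤ.* m) ≡
          y ℤ.* z ℤ.+ (y ℤ.* r ℤ.+ q ℤ.* z ℤ.+ q ℤ.* r ℤ.* m) ℤ.* m
    lem = ℤS.solve-∀

  mod-*ˡ : ∀ a {x y} → x ≡ y [mod m ] → a ℤ.* x ≡ a ℤ.* y [mod m ]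
  mod-*ˡ a e = mod-* (mod-refl {a}) e

  mod-*ʳ : ∀ a {x y} → x ≡ y [mod m ] → x ℤ.* a ≡ y ℤ.* a [mod m ]
  mod-*ʳ a e = mod-* e (mod-refl {a})

  mod-+ˡ : ∀ a {x y} → x ≡ y [mod m ] → a ℤ.+ x ≡ a ℤ.+ y [mod m ]
  mod-+ˡ a e = mod-+ (mod-refl {a}) e

  ∣-⇒mod : ∀ {x y} → + m ℤ∣.∣ x ℤ.- y → x ≡ y [mod m ]
  ∣-⇒mod {x} {y} (ℤ∣.divides q e) = mod-by q (trans (lem x y) (cong (ℤ._+_ y) e))
    where
    lem : ∀ x y → x ≡ y ℤ.+ (x ℤ.- y)
    lem = ℤS.solve-∀

  mod⇒∣- : ∀ {x y} → x ≡ y [mod m ] → + m ℤ∣.∣ x ℤ.- y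
  mod⇒∣- {y = y} (mod-by q refl) = ℤ∣.divides q (lem y (q ℤ.* + m))
    where
    lem : ∀ y z → y ℤ.+ z ℤ.- y ≡ z
    lem = ℤS.solve-∀

  mod⇒∣ : ∀ {x} → x ≡ + 0 [mod m ] → + m ℤ∣.∣ x
  mod⇒∣ (mod-by q e) = ℤ∣.divides q (trans e (ℤP.+-identityˡ _))

  ∣⇒mod : ∀ {x} → + m ℤ∣.∣ x → x ≡ + 0 [mod m ]
  ∣⇒mod (ℤ∣.divides q e) = mod-by q (trans e (sym (ℤP.+-identityˡ _)))

  mod-respˡ-∣ : ∀ {x y} → x ≡ y [mod m ] → + m ℤ∣.∣ x → + m ℤ∣.∣ y
  mod-respˡ-∣ e d = mod⇒∣ (mod-trans (mod-sym e) (∣⇒mod d))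

abstract

  mod? : ∀ m x y → Dec (x ≡ y [mod m ])
  mod? m x y = map′ ∣-⇒mod mod⇒∣- (+ m ℤ∣.∣? (x ℤ.- y))

+∣⇒∣ : ∀ {m n} → + m ℤ∣.∣ + n → m ∣ n
+∣⇒∣ = ℤ∣.∣⇒∣ᵤ

∣⇒+∣ : ∀ {m n} → m ∣ n → + m ℤ∣.∣ + n
∣⇒+∣ = ℤ∣.∣ᵤ⇒∣

mod-coarsen : ∀ {m n x y} → m ∣ n → x ≡ y [mod n ] → x ≡ y [mod m ]
mod-coarsen m∣n e = ∣-⇒mod (ℤ∣.∣-trans (∣⇒+∣ m∣n) (mod⇒∣- e))

mod-rem : ∀ m .{{_ : NonZero m}} x → x ≡ + (x ℤDM.%ℕ m) [mod m ]
mod-rem m x = mod-by (x ℤDM./ℕ m) (ℤDM.a≡a%ℕn+[a/ℕn]*n x m)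

∣-small : ∀ {m} z → + m ℤ∣.∣ z → ℤ.∣ z ∣ < m → z ≡ + 0
∣-small {m} z d lt with ℤ.∣ z ∣ in eq | ℤ∣.∣⇒∣ᵤ d
... | zero  | _ = ℤP.∣i∣≡0⇒i≡0 eq
... | suc k | e = ⊥-elim (<⇒≱ lt (∣⇒≤ e))

private
  monus-diff-< : ∀ {m} x y → x < m → y < m → ℤ.∣ + x ℤ.- + y ∣ < m
  monus-diff-< {m} x y x<m y<m rewrite ℤP.[+m]-[+n]≡m⊖n x y with ≤-total y x
  ... | inj₁ y≤x rewrite ℤP.⊖-≥ y≤x = ≤-<-trans (m∸n≤m x y) x<m
  ... | inj₂ x≤y rewrite ℤP.∣⊖∣-≤ x≤y = ≤-<-trans (m∸n≤m y x) y<m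

mod-<-≡ : ∀ {m x y} → x < m → y < m → + x ≡ + y [mod m ] → x ≡ y
mod-<-≡ {m} {x} {y} x<m y<m e =
  ℤP.+-injective (ℤP.i-j≡0⇒i≡j (+ x) (+ y) (∣-small _ (mod⇒∣- e) (monus-diff-< x y x<m y<m)))

abstract

  bézout : ∀ {m n} → Coprime m n → ∃₂ λ u v → u ℤ.* + m ℤ.+ v ℤ.* + n ≡ + 1
  bézout {m} {n} c with Coprime.coprime-Bézout c
  ... | Bézout.+- x y e = + x , ℤ.- (+ y) , lem
    where
    e′ : + x ℤ.* + m ≡ + 1 ℤ.+ + y ℤ.* + n
    e′ = trans (sym (ℤP.pos-* x m)) (trans (cong +_ (sym e)) (cong (ℤ._+_ (+ 1)) (ℤP.pos-* y n)))
    alg : ∀ Y → + 1 ℤ.+ Y ℤ.+ ℤ.- Y ≡ + 1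
    alg = ℤS.solve-∀
    lem : + x ℤ.* + m ℤ.+ ℤ.- (+ y) ℤ.* + n ≡ + 1
    lem = trans (cong₂ ℤ._+_ e′ (sym (ℤP.neg-distribˡ-* (+ y) (+ n)))) (alg (+ y ℤ.* + n))
  ... | Bézout.-+ x y e = ℤ.- (+ x) , + y , lem
    where
    e′ : + y ℤ.* + n ≡ + 1 ℤ.+ + x ℤ.* + m
    e′ = trans (sym (ℤP.pos-* y n)) (trans (cong +_ (sym e)) (cong (ℤ._+_ (+ 1)) (ℤP.pos-* x m)))
    alg : ∀ X → ℤ.- X ℤ.+ (+ 1 ℤ.+ X) ≡ + 1
    alg = ℤS.solve-∀
    lem : ℤ.- (+ x) ℤ.* + m ℤ.+ + y ℤ.* + n ≡ + 1
    lem = trans (cong₂ ℤ._+_ (sym (ℤP.neg-distribˡ-* (+ x) (+ m))) e′) (alg (+ x ℤ.* + m))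

  coprime-inverse : ∀ {m n} → Coprime m n → ∃ λ u → + m ℤ.* u ≡ + 1 [mod n ]
  coprime-inverse {m} {n} c with bézout c
  ... | u , v , e = u , mod-by (ℤ.- v) (trans (lem (+ m) u v (+ n)) (cong (ℤ._+ (ℤ.- v) ℤ.* + n) e))
    where
    lem : ∀ m u v n → m ℤ.* u ≡ u ℤ.* m ℤ.+ v ℤ.* n ℤ.+ (ℤ.- v) ℤ.* n
    lem = ℤS.solve-∀

  crt : ∀ {m n} → Coprime m n → ∀ x y → ∃ λ z → z ≡ x [mod m ] × z ≡ y [mod n ]
  crt {m} {n} c x y with bézout c
  ... | u , v , e =
    x ℤ.* (v ℤ.* + n) ℤ.+ y ℤ.* (u ℤ.* + m) ,
    mod-by (u ℤ.* (y ℤ.- x)) (trans (alg₁ x y u v (+ m) (+ n)) (one x e)) ,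
    mod-by (v ℤ.* (x ℤ.- y)) (trans (alg₂ x y u v (+ m) (+ n)) (one y e))
    where
    one : ∀ x {s w} → s ≡ + 1 → x ℤ.* s ℤ.+ w ≡ x ℤ.+ w
    one x {w = w} e = cong (ℤ._+ w) (trans (cong (x ℤ.*_) e) (ℤP.*-identityʳ x))
    alg₁ : ∀ x y u v m n → x ℤ.* (v ℤ.* n) ℤ.+ y ℤ.* (u ℤ.* m) ≡
           x ℤ.* (u ℤ.* m ℤ.+ v ℤ.* n) ℤ.+ u ℤ.* (y ℤ.- x) ℤ.* m
    alg₁ = ℤS.solve-∀
    alg₂ : ∀ x y u v m n → x ℤ.* (v ℤ.* n) ℤ.+ y ℤ.* (u ℤ.* m) ≡
           y ℤ.* (u ℤ.* m ℤ.+ v ℤ.* n) ℤ.+ v ℤ.* (x ℤ.- y) ℤ.* n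
    alg₂ = ℤS.solve-∀

coprime-*-∣ : ∀ {m n k} → Coprime m n → m ∣ k → n ∣ k → m * n ∣ k
coprime-*-∣ {m} {n} {k} c (divides q refl) n∣ =
  subst (_∣ q * m) (*-comm n m) (*-monoˡ-∣ m (Coprime.coprime-divisor (Coprime.sym c) (subst (n ∣_) (*-comm q m) n∣)))

mod-combine : ∀ {m n x y} → Coprime m n → x ≡ y [mod m ] → x ≡ y [mod n ] → x ≡ y [mod m * n ]
mod-combine c e f = ∣-⇒mod (ℤ∣.∣ᵤ⇒∣ (coprime-*-∣ c (ℤ∣.∣⇒∣ᵤ (mod⇒∣- e)) (ℤ∣.∣⇒∣ᵤ (mod⇒∣- f))))

-- Counting

indicator : {A : Set} → Dec A → ℕ
indicator (yes _) = 1
indicator (no _)  = 0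

cnt : {𝓟 : ℕ → Set} → Decidable 𝓟 → ℕ → ℕ
cnt P? zero    = 0
cnt P? (suc n) = indicator (P? n) + cnt P? n

private
  variable
    𝓟 𝓠 𝓡 : ℕ → Set

_∩?_ : Decidable 𝓟 → Decidable 𝓠 → Decidable (λ k → 𝓟 k × 𝓠 k)
(P? ∩? Q?) k = P? k ×-dec Q? k

∁? : Decidable 𝓟 → Decidable (λ k → ¬ 𝓟 k)
∁? P? k = ¬? (P? k)

indicator-mono : {A B : Set} (a : Dec A) (b : Dec B) → (A → B) → indicator a ≤ indicator b
indicator-mono (yes a) (yes _) f = ≤-refl
indicator-mono (yes a) (no ¬b) f = ⊥-elim (¬b (f a))
indicator-mono (no _)  b       f = z≤n

indicator-yes : {A : Set} (a : Dec A) → A → indicator a ≡ 1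
indicator-yes (yes _) _ = refl
indicator-yes (no ¬a) a = ⊥-elim (¬a a)

indicator-no : {A : Set} (a : Dec A) → ¬ A → indicator a ≡ 0
indicator-no (yes a) ¬a = ⊥-elim (¬a a)
indicator-no (no _)  _  = refl

cnt-⊆ : (P? : Decidable 𝓟) (Q? : Decidable 𝓠) → ∀ n → (∀ k → k < n → 𝓟 k → 𝓠 k) → cnt P? n ≤ cnt Q? n
cnt-⊆ P? Q? zero    f = z≤n
cnt-⊆ P? Q? (suc n) f =
  +-mono-≤ (indicator-mono (P? n) (Q? n) (f n ≤-refl)) (cnt-⊆ P? Q? n (λ k k<n → f k (m≤n⇒m≤1+n k<n)))

cnt-cong : (P? : Decidable 𝓟) (Q? : Decidable 𝓠) → ∀ n → (∀ k → k < n → 𝓟 k → 𝓠 k) → (∀ k → k < n → 𝓠 k → 𝓟 k) →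
           cnt P? n ≡ cnt Q? n
cnt-cong P? Q? n f g = ≤-antisym (cnt-⊆ P? Q? n f) (cnt-⊆ Q? P? n g)

cnt-mono : (P? : Decidable 𝓟) → ∀ {m n} → m ≤ n → cnt P? m ≤ cnt P? n
cnt-mono P? {m} {n} m≤n = go (≤⇒≤′ m≤n)
  where
  go : ∀ {n} → m ≤′ n → cnt P? m ≤ cnt P? n
  go ≤′-refl     = ≤-refl
  go (≤′-step l) = ≤-trans (go l) (m≤n+m _ _)

cnt-∪ : (P? : Decidable 𝓟) (Q? : Decidable 𝓠) (R? : Decidable 𝓡) → ∀ n → (∀ k → k < n → 𝓟 k → 𝓠 k ⊎ 𝓡 k) →
        cnt P? n ≤ cnt Q? n + cnt R? n
cnt-∪ P? Q? R? zero    f = z≤n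
cnt-∪ P? Q? R? (suc n) f = begin
  indicator (P? n) + cnt P? n                                            ≤⟨ +-mono-≤ (step (P? n) (Q? n) (R? n) (f n ≤-refl)) (cnt-∪ P? Q? R? n (λ k k<n → f k (m≤n⇒m≤1+n k<n))) ⟩
  (indicator (Q? n) + indicator (R? n)) + (cnt Q? n + cnt R? n)            ≡⟨ lem (indicator (Q? n)) _ _ _ ⟩
  indicator (Q? n) + cnt Q? n + (indicator (R? n) + cnt R? n)              ∎
  where
  open ≤-Reasoning
  lem : ∀ a b c d → (a + b) + (c + d) ≡ a + c + (b + d)
  lem = ℕS.solve-∀
  step : {A B C : Set} (a : Dec A) (b : Dec B) (c : Dec C) → (A → B ⊎ C) → indicator a ≤ indicator b + indicator c
  step (no _)  b       c       f = z≤n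
  step (yes _) (yes _) c       f = s≤s z≤n
  step (yes _) (no _)  (yes _) f = s≤s z≤n
  step (yes a) (no ¬b) (no ¬c) f with f a
  ... | inj₁ b = ⊥-elim (¬b b)
  ... | inj₂ c = ⊥-elim (¬c c)

cnt-split : (P? : Decidable 𝓟) (Q? : Decidable 𝓠) → ∀ n → cnt P? n ≡ cnt (P? ∩? Q?) n + cnt (P? ∩? ∁? Q?) n
cnt-split P? Q? zero    = refl
cnt-split P? Q? (suc n) = begin
  indicator (P? n) + cnt P? n      ≡⟨ cong₂ _+_ (step (P? n) (Q? n)) (cnt-split P? Q? n) ⟩
  (i + j) + (c + d)                ≡⟨ lem i j c d ⟩
  i + c + (j + d)                  ∎
  where
  open ≡-Reasoning
  i = indicator ((P? ∩? Q?) n)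
  j = indicator ((P? ∩? ∁? Q?) n)
  c = cnt (P? ∩? Q?) n
  d = cnt (P? ∩? ∁? Q?) n
  lem : ∀ a b c d → (a + b) + (c + d) ≡ a + c + (b + d)
  lem = ℕS.solve-∀
  step : {A B : Set} (a : Dec A) (b : Dec B) → indicator a ≡ indicator (a ×-dec b) + indicator (a ×-dec ¬? b)
  step (no _)  _       = refl
  step (yes _) (yes _) = refl
  step (yes _) (no _)  = refl

cnt-none : (P? : Decidable 𝓟) → ∀ n → (∀ k → k < n → ¬ 𝓟 k) → cnt P? n ≡ 0
cnt-none P? zero    f = refl
cnt-none P? (suc n) f rewrite indicator-no (P? n) (f n ≤-refl) = cnt-none P? n (λ k k<n → f k (m≤n⇒m≤1+n k<n))

cnt-all : (P? : Decidable 𝓟) → ∀ n → (∀ k → k < n → 𝓟 k) → cnt P? n ≡ n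
cnt-all P? zero    f = refl
cnt-all P? (suc n) f rewrite indicator-yes (P? n) (f n ≤-refl) = cong suc (cnt-all P? n (λ k k<n → f k (m≤n⇒m≤1+n k<n)))

cnt-∁ : (P? : Decidable 𝓟) → ∀ n → cnt P? n + cnt (∁? P?) n ≡ n
cnt-∁ P? n = begin
  cnt P? n + cnt (∁? P?) n                     ≡⟨ cong₂ _+_ (cnt-cong P? (⊤? ∩? P?) n (λ _ _ → tt ,_) (λ _ _ → proj₂))
                                                             (cnt-cong (∁? P?) (⊤? ∩? ∁? P?) n (λ _ _ → tt ,_) (λ _ _ → proj₂)) ⟩
  cnt (⊤? ∩? P?) n + cnt (⊤? ∩? ∁? P?) n       ≡⟨ sym (cnt-split ⊤? P? n) ⟩
  cnt ⊤? n                                     ≡⟨ cnt-all ⊤? n (λ _ _ → tt) ⟩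
  n                                            ∎
  where
  open ≡-Reasoning
  ⊤? : Decidable (λ (_ : ℕ) → ⊤)
  ⊤? _ = yes tt

cnt-+ : (P? : Decidable 𝓟) → ∀ m n → cnt P? (n + m) ≡ cnt P? m + cnt (λ k → P? (k + m)) n
cnt-+ P? m zero    = sym (+-identityʳ _)
cnt-+ P? m (suc n) = begin
  indicator (P? (n + m)) + cnt P? (n + m)                            ≡⟨ cong (_+_ (indicator (P? (n + m)))) (cnt-+ P? m n) ⟩
  indicator (P? (n + m)) + (cnt P? m + cnt (λ k → P? (k + m)) n)     ≡⟨ lem (indicator (P? (n + m))) (cnt P? m) _ ⟩
  cnt P? m + (indicator (P? (n + m)) + cnt (λ k → P? (k + m)) n)     ∎
  where
  open ≡-Reasoning
  lem : ∀ a b c → a + (b + c) ≡ b + (a + c)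
  lem = ℕS.solve-∀

cnt-remove : (P? : Decidable 𝓟) → ∀ i n → i < n → 𝓟 i → suc (cnt (P? ∩? ∁? (_≟ i)) n) ≤ cnt P? n
cnt-remove {𝓟} P? i (suc n) i<n Pi = by-cases (n ≟ i)
  where
  open ≤-Reasoning
  P∖i? = P? ∩? ∁? (_≟ i)
  by-cases : Dec (n ≡ i) → suc (cnt P∖i? (suc n)) ≤ cnt P? (suc n)
  by-cases (yes refl) = begin
    suc (indicator (P∖i? n) + cnt P∖i? n)  ≡⟨ cong (λ z → suc (z + cnt P∖i? n)) (indicator-no (P∖i? n) (λ p → proj₂ p refl)) ⟩
    suc (cnt P∖i? n)                       ≤⟨ s≤s (cnt-⊆ P∖i? P? n (λ _ _ → proj₁)) ⟩
    suc (cnt P? n)                         ≡⟨ cong (_+ cnt P? n) (sym (indicator-yes (P? n) Pi)) ⟩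
    indicator (P? n) + cnt P? n            ∎
  by-cases (no n≢i) = begin
    suc (indicator (P∖i? n) + cnt P∖i? n)  ≡⟨ sym (+-suc _ _) ⟩
    indicator (P∖i? n) + suc (cnt P∖i? n)  ≤⟨ +-mono-≤ (indicator-mono (P∖i? n) (P? n) proj₁) (cnt-remove P? i n (≤∧≢⇒< (s≤s⁻¹ i<n) (n≢i ∘ sym)) Pi) ⟩
    indicator (P? n) + cnt P? n            ∎

-- Pigeonhole by induction on `n`: the partner `i` of the last element is deleted from `𝓠`, and the
-- second hypothesis ensures that no earlier element is paired with `i`. With a relation in place of
-- a function, congruence itself can be the pairing, and `cnt-bij` can use it in both directions.
cnt-inj : (P? : Decidable 𝓟) (Q? : Decidable 𝓠) (_∼_ : ℕ → ℕ → Set) → ∀ n m →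
          (∀ k → k < n → 𝓟 k → ∃ λ i → i < m × 𝓠 i × k ∼ i) →
          (∀ {k k′ i} → k < n → k′ < n → 𝓟 k → 𝓟 k′ → i < m → 𝓠 i → k ∼ i → k′ ∼ i → k ≡ k′) →
          cnt P? n ≤ cnt Q? m
cnt-inj P? Q? _∼_ zero    m f inj = z≤n
cnt-inj {𝓠 = 𝓠} P? Q? _∼_ (suc n) m f inj with P? n
... | no _   = cnt-inj P? Q? _∼_ n m (λ k k<n → f k (m≤n⇒m≤1+n k<n)) (λ a b → inj (m≤n⇒m≤1+n a) (m≤n⇒m≤1+n b))
... | yes Pn with f n ≤-refl Pn
...   | i , i<m , Qi , n∼i = ≤-trans (s≤s ih) (cnt-remove Q? i m i<m Qi)
  where
  f′ : ∀ k → k < n → _ → ∃ λ j → j < m × (𝓠 j × ¬ j ≡ i) × k ∼ j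
  f′ k k<n Pk with f k (m≤n⇒m≤1+n k<n) Pk
  ... | j , j<m , Qj , k∼j = j , j<m , (Qj , λ { refl → <⇒≢ k<n (inj (m≤n⇒m≤1+n k<n) ≤-refl Pk Pn j<m Qj k∼j n∼i) }) , k∼j
  ih = cnt-inj P? (Q? ∩? ∁? (_≟ i)) _∼_ n m f′ (λ a b Pk Pk′ i<m Qi → inj (m≤n⇒m≤1+n a) (m≤n⇒m≤1+n b) Pk Pk′ i<m (proj₁ Qi))

cnt-bij : (P? : Decidable 𝓟) (Q? : Decidable 𝓠) (_∼_ : ℕ → ℕ → Set) → ∀ n m →
          (∀ k → k < n → 𝓟 k → ∃ λ i → i < m × 𝓠 i × k ∼ i) →
          (∀ i → i < m → 𝓠 i → ∃ λ k → k < n × 𝓟 k × k ∼ i) →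
          (∀ {k k′ i} → k < n → k′ < n → 𝓟 k → 𝓟 k′ → i < m → 𝓠 i → k ∼ i → k′ ∼ i → k ≡ k′) →
          (∀ {i i′ k} → i < m → i′ < m → 𝓠 i → 𝓠 i′ → k < n → 𝓟 k → k ∼ i → k ∼ i′ → i ≡ i′) →
          cnt P? n ≡ cnt Q? m
cnt-bij P? Q? _∼_ n m f g inj surj =
  ≤-antisym (cnt-inj P? Q? _∼_ n m f inj) (cnt-inj Q? P? (λ i k → k ∼ i) m n g surj)

Periodic : ℕ → (ℕ → Set) → Set
Periodic m 𝓟 = ∀ {x y} → + x ≡ + y [mod m ] → 𝓟 x → 𝓟 y

mod-+m : ∀ k m → + (k + m) ≡ + k [mod m ]
mod-+m k m = mod-by (+ 1) (cong (ℤ._+_ (+ k)) (sym (ℤP.*-identityˡ (+ m))))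

cnt-periodic : (P? : Decidable 𝓟) → ∀ m → Periodic m 𝓟 → ∀ t → cnt P? (t * m) ≡ t * cnt P? m
cnt-periodic P? m per zero    = refl
cnt-periodic {𝓟} P? m per (suc t) = begin
  cnt P? (m + t * m)                              ≡⟨ cong (cnt P?) (+-comm m (t * m)) ⟩
  cnt P? (t * m + m)                              ≡⟨ cnt-+ P? m (t * m) ⟩
  cnt P? m + cnt (λ k → P? (k + m)) (t * m)       ≡⟨ cong (_+_ (cnt P? m)) (cnt-cong (λ k → P? (k + m)) P? (t * m) (λ k _ → per (mod-+m k m)) (λ k _ → per (mod-sym (mod-+m k m)))) ⟩
  cnt P? m + cnt P? (t * m)                       ≡⟨ cong (_+_ (cnt P? m)) (cnt-periodic P? m per t) ⟩
  cnt P? m + t * cnt P? m                         ∎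
  where open ≡-Reasoning

module _ {m n : ℕ} .{{_ : NonZero m}} .{{_ : NonZero n}} (c : Coprime m n) where

  private instance
    mn≢0 : NonZero (m * n)
    mn≢0 = m*n≢0 m n

  -- Inside one residue class modulo `m`, reduction modulo `n` is a bijection onto all residues: CRT
  -- gives existence, and `mod-combine` gives uniqueness.
  cnt-class : (Q? : Decidable 𝓠) → Periodic n 𝓠 → ∀ r →
              cnt ((λ j → mod? m (+ j) (+ r)) ∩? Q?) (m * n) ≡ cnt Q? n
  cnt-class {𝓠} Q? per r =
    cnt-bij ((λ j → mod? m (+ j) (+ r)) ∩? Q?) Q? (λ j i → + j ≡ + i [mod n ]) (m * n) n
      (λ j _ (_ , Qj) → + j ℤDM.%ℕ n , ℤDM.n%ℕd<d (+ j) n , per (mod-rem n (+ j)) Qj , mod-rem n (+ j))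
      lift
      (λ j< j′< (j≡r , _) (j′≡r , _) _ _ j∼i j′∼i →
        mod-<-≡ j< j′< (mod-combine c (mod-trans j≡r (mod-sym j′≡r)) (mod-trans j∼i (mod-sym j′∼i))))
      (λ i< i′< _ _ _ _ j∼i j∼i′ → mod-<-≡ i< i′< (mod-trans (mod-sym j∼i) j∼i′))
    where
    lift : ∀ i → i < n → 𝓠 i → ∃ λ j → j < m * n × (+ j ≡ + r [mod m ] × 𝓠 j) × + j ≡ + i [mod n ]
    lift i _ Qi with crt c (+ r) (+ i)
    ... | z , z≡r , z≡i =
      z ℤDM.%ℕ (m * n) , ℤDM.n%ℕd<d z (m * n) ,
      (mod-trans (mod-sym (mod-coarsen (m∣m*n n) (mod-rem (m * n) z))) z≡r , per (mod-sym j≡i) Qi) , j≡i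
      where j≡i = mod-trans (mod-sym (mod-coarsen (n∣m*n m) (mod-rem (m * n) z))) z≡i

  cnt-crt : (P? : Decidable 𝓟) (Q? : Decidable 𝓠) → Periodic m 𝓟 → Periodic n 𝓠 →
            cnt (P? ∩? Q?) (m * n) ≡ cnt P? m * cnt Q? n
  cnt-crt {𝓟} {𝓠} P? Q? perP perQ = trans (cnt-cong (P? ∩? Q?) (below m) (m * n) (λ j _ (p , q) → (ℤDM.n%ℕd<d (+ j) m , p) , q) (λ j _ ((_ , p) , q) → p , q)) (go m ≤-refl)
    where
    open ≡-Reasoning
    below : ∀ r → Decidable (λ j → ((+ j ℤDM.%ℕ m) < r × 𝓟 j) × 𝓠 j)
    below r j = (((+ j ℤDM.%ℕ m) <? r) ×-dec P? j) ×-dec Q? j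
    at : ∀ r → Decidable (λ j → + j ≡ + r [mod m ] × 𝓠 j)
    at r = (λ j → mod? m (+ j) (+ r)) ∩? Q?
    last : ∀ r → r < m → (d : Dec (𝓟 r)) → cnt (below (suc r) ∩? ∁? (below r)) (m * n) ≡ indicator d * cnt Q? n
    last r r<m (yes Pr) = trans (cnt-cong (below (suc r) ∩? ∁? (below r)) (at r) (m * n)
                      (λ j _ (((j< , Pj) , Qj) , ¬b) → subst (λ z → + j ≡ + z [mod m ]) (≤-antisym (s≤s⁻¹ j<) (≮⇒≥ (λ l → ¬b ((l , Pj) , Qj)))) (mod-rem m (+ j)) , Qj)
                      (λ j _ (j≡r , Qj) → let e = mod-<-≡ (ℤDM.n%ℕd<d (+ j) m) r<m (mod-trans (mod-sym (mod-rem m (+ j))) j≡r)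
                                          in ((s≤s (≤-reflexive e) , perP (mod-sym j≡r) Pr) , Qj) , λ ((l , _) , _) → <⇒≢ l e))
                    (trans (cnt-class Q? perQ r) (sym (+-identityʳ _)))
    last r r<m (no ¬Pr) = cnt-none (below (suc r) ∩? ∁? (below r)) (m * n)
                     (λ j _ (((j< , Pj) , Qj) , ¬b) → ¬Pr (perP (subst (λ z → + j ≡ + z [mod m ]) (≤-antisym (s≤s⁻¹ j<) (≮⇒≥ (λ l → ¬b ((l , Pj) , Qj)))) (mod-rem m (+ j))) Pj))
    go : ∀ r → r ≤ m → cnt (below r) (m * n) ≡ cnt P? r * cnt Q? n
    go zero    _   = cnt-none (below 0) (m * n) (λ { _ _ ((() , _) , _) })
    go (suc r) r<m = begin
      cnt (below (suc r)) (m * n)                                            ≡⟨ cnt-split (below (suc r)) (below r) (m * n) ⟩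
      cnt (below (suc r) ∩? below r) (m * n) + cnt (below (suc r) ∩? ∁? (below r)) (m * n)
        ≡⟨ cong₂ _+_ (trans (cnt-cong (below (suc r) ∩? below r) (below r) (m * n) (λ _ _ → proj₂) (λ _ _ b@((l , p) , q) → ((m≤n⇒m≤1+n l , p) , q) , b)) (go r (<⇒≤ r<m))) (last r r<m (P? r)) ⟩
      cnt P? r * cnt Q? n + indicator (P? r) * cnt Q? n                      ≡⟨ +-comm (cnt P? r * cnt Q? n) _ ⟩
      indicator (P? r) * cnt Q? n + cnt P? r * cnt Q? n                      ≡⟨ sym (*-distribʳ-+ (cnt Q? n) (indicator (P? r)) (cnt P? r)) ⟩
      cnt P? (suc r) * cnt Q? n                                              ∎

-- Sieving by a set of primes

prime∤⇒coprime : ∀ {p n} → Prime p → ¬ p ∣ n → Coprime p n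
prime∤⇒coprime pp p∤n (d∣p , d∣n) with prime⇒irreducible pp d∣p
... | inj₁ d≡1  = d≡1
... | inj₂ refl = ⊥-elim (p∤n d∣n)

pos-lin : ∀ h j m → + (h + j * m) ≡ + h ℤ.+ + j ℤ.* + m
pos-lin h j m = cong (ℤ._+_ (+ h)) (ℤP.pos-* j m)

mod-lin : ∀ {k x y} h m → + x ≡ + y [mod k ] → + (h + x * m) ≡ + (h + y * m) [mod k ]
mod-lin {k} {x} {y} h m e =
  subst₂ (λ s t → s ≡ t [mod k ]) (sym (pos-lin h x m)) (sym (pos-lin h y m)) (mod-+ˡ (+ h) (mod-*ʳ (+ m) e))

∣-mod : ∀ {k x y} → + x ≡ + y [mod k ] → k ∣ x → k ∣ y
∣-mod e k∣x = +∣⇒∣ (mod-respˡ-∣ e (∣⇒+∣ k∣x))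

m<suc[m/n]*n : ∀ m n .{{_ : NonZero n}} → m < suc (m / n) * n
m<suc[m/n]*n m n = begin-strict
  m                     ≡⟨ m≡m%n+[m/n]*n m n ⟩
  m % n + m / n * n     <⟨ +-monoˡ-< _ (m%n<n m n) ⟩
  n + m / n * n         ∎
  where open ≤-Reasoning

-- As `m` is invertible modulo `p`, the only root is -h / m.
cnt-roots : ∀ {p} → Prime p → ∀ h m → ¬ p ∣ m → cnt (λ j → p ∣? (h + j * m)) p ≡ 1
cnt-roots {p} pp h m p∤m =
  cnt-bij {𝓠 = λ _ → ⊤} (λ j → p ∣? (h + j * m)) (λ _ → yes tt) (λ _ _ → ⊤) p 1
    (λ _ _ _ → 0 , s≤s z≤n , tt , tt) (λ _ _ _ → root) unique
    (λ { (s≤s z≤n) (s≤s z≤n) _ _ _ _ _ _ → refl })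
  where
  instance
    p≢0 : NonZero p
    p≢0 = prime⇒nonZero pp
  m⊥p : Coprime m p
  m⊥p = Coprime.sym (prime∤⇒coprime pp p∤m)
  root : ∃ λ j → j < p × p ∣ h + j * m × ⊤
  root = let (u , mu≡1) = coprime-inverse m⊥p
             j = (ℤ.- (+ h) ℤ.* u) ℤDM.%ℕ p
             j≡ : + j ≡ ℤ.- (+ h) ℤ.* u [mod p ]
             j≡ = mod-sym (mod-rem p (ℤ.- (+ h) ℤ.* u))
             e : + h ℤ.+ + j ℤ.* + m ≡ + 0 [mod p ]
             e = mod-trans (mod-+ˡ (+ h) (mod-*ʳ (+ m) j≡))
                   (mod-trans (≡⇒mod (lem₁ (+ h) u (+ m)))
                     (mod-trans (mod-+ˡ (+ h) (mod-*ˡ (ℤ.- (+ h)) mu≡1)) (≡⇒mod (lem₂ (+ h)))))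
         in j , ℤDM.n%ℕd<d (ℤ.- (+ h) ℤ.* u) p , +∣⇒∣ (mod⇒∣ (subst (λ s → s ≡ + 0 [mod p ]) (sym (pos-lin h j m)) e)) , tt
    where
    lem₁ : ∀ h u m → h ℤ.+ ℤ.- h ℤ.* u ℤ.* m ≡ h ℤ.+ ℤ.- h ℤ.* (m ℤ.* u)
    lem₁ = ℤS.solve-∀
    lem₂ : ∀ h → h ℤ.+ ℤ.- h ℤ.* + 1 ≡ + 0
    lem₂ = ℤS.solve-∀
  unique : ∀ {k k′ i} → k < p → k′ < p → p ∣ h + k * m → p ∣ h + k′ * m → i < 1 → ⊤ → ⊤ → ⊤ → k ≡ k′
  unique {k} {k′} k< k′< d d′ _ _ _ _ = mod-<-≡ k< k′< (∣-⇒mod (ℤ∣.∣ᵤ⇒∣ p∣))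
    where
    diff : + p ℤ∣.∣ (+ k ℤ.- + k′) ℤ.* + m
    diff = subst (+ p ℤ∣.∣_) (trans (cong₂ ℤ._-_ (pos-lin h k m) (pos-lin h k′ m)) (lem (+ h) (+ k) (+ k′) (+ m)))
             (ℤ∣.∣m∣n⇒∣m-n (∣⇒+∣ d) (∣⇒+∣ d′))
      where
      lem : ∀ h k l m → (h ℤ.+ k ℤ.* m) ℤ.- (h ℤ.+ l ℤ.* m) ≡ (k ℤ.- l) ℤ.* m
      lem = ℤS.solve-∀
    p∣ : p ∣ ℤ.∣ + k ℤ.- + k′ ∣
    p∣ with euclidsLemma ℤ.∣ + k ℤ.- + k′ ∣ m pp (subst (p ∣_) (ℤP.abs-* (+ k ℤ.- + k′) (+ m)) (ℤ∣.∣⇒∣ᵤ diff))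
    ... | inj₁ x = x
    ... | inj₂ x = ⊥-elim (p∤m x)

-- A function of the decision itself, so that a proof about `modulus` or `coprimes` splits on
-- `P? (suc z)` once and both sides reduce together.
scaleIf : {A : Set} → Dec A → ℕ → ℕ → ℕ
scaleIf (yes _) p x = p * x
scaleIf (no _)  p x = x

module Sieve {P : ℕ → Set} (P? : Decidable P) (P⇒prime : ∀ {p} → P p → Prime p) where

  Avoids : ℕ → ℕ → Set
  Avoids z n = ∀ {p} → p < suc z → P p → ¬ p ∣ n

  avoids? : ∀ z → Decidable (Avoids z)
  avoids? z n = allUpTo? (λ p → P? p →-dec ¬? (p ∣? n)) (suc z)

  -- The density of the n avoiding all p ≤ z in P is coprimes z / modulus z.
  modulus coprimes : ℕ → ℕ
  modulus zero     = 1
  modulus (suc z)  = scaleIf (P? (suc z)) (suc z) (modulus z)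
  coprimes zero    = 1
  coprimes (suc z) = scaleIf (P? (suc z)) z (coprimes z)

  prime∤modulus : ∀ {p} → Prime p → ∀ z → z < p → ¬ p ∣ modulus z
  prime∤modulus pp zero    _   d = ¬prime[1] (subst Prime (∣1⇒≡1 d) pp)
  prime∤modulus {p} pp (suc z) z<p = by-cases (P? (suc z))
    where
    ih = prime∤modulus pp z (<-trans ≤-refl z<p)
    by-cases : (d : Dec (P (suc z))) → ¬ p ∣ scaleIf d (suc z) (modulus z)
    by-cases (no _)  d = ih d
    by-cases (yes _) d with euclidsLemma (suc z) (modulus z) pp d
    ... | inj₁ x = <⇒≱ z<p (∣⇒≤ x)
    ... | inj₂ x = ih x

  modulus≢0 : ∀ z → NonZero (modulus z)
  modulus≢0 zero    = _
  modulus≢0 (suc z) = by-cases (P? (suc z))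
    where
    by-cases : (d : Dec (P (suc z))) → NonZero (scaleIf d (suc z) (modulus z))
    by-cases (no _)  = modulus≢0 z
    by-cases (yes _) = m*n≢0 (suc z) (modulus z) {{_}} {{modulus≢0 z}}

  coprimes≢0 : ∀ z → NonZero (coprimes z)
  coprimes≢0 zero    = _
  coprimes≢0 (suc z) = by-cases z (P? (suc z))
    where
    by-cases : ∀ y → (d : Dec (P (suc y))) → NonZero (scaleIf d y (coprimes z))
    by-cases y       (no _)   = coprimes≢0 z
    -- The factor p - 1 could vanish only for p = 1, which is not prime.
    by-cases zero    (yes p1) = ⊥-elim (¬prime[1] (P⇒prime p1))
    by-cases (suc y) (yes _)  = m*n≢0 (suc y) (coprimes z) {{_}} {{coprimes≢0 z}}

  avoids-pred : ∀ {z n} → Avoids (suc z) n → Avoids z n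
  avoids-pred a p<  = a (m≤n⇒m≤1+n p<)

  avoids-suc : ∀ {z n} → (P (suc z) → ¬ suc z ∣ n) → Avoids z n → Avoids (suc z) n
  avoids-suc {z} ¬d a {p} p< with m≤n⇒m<n∨m≡n (s≤s⁻¹ p<)
  ... | inj₁ l    = a l
  ... | inj₂ refl = ¬d

  module Progression (h m : ℕ) (P∤m : ∀ {p} → P p → ¬ p ∣ m) where

    avoids-periodic : ∀ z → Periodic (modulus z) (λ j → Avoids z (h + j * m))
    avoids-periodic zero    _ _ (s≤s z≤n) p0 = ⊥-elim (¬prime[0] (P⇒prime p0))
    avoids-periodic (suc z) {x} {y} = by-cases (P? (suc z))
      where
      by-cases : (d : Dec (P (suc z))) → + x ≡ + y [mod scaleIf d (suc z) (modulus z) ] →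
                 Avoids (suc z) (h + x * m) → Avoids (suc z) (h + y * m)
      by-cases (yes _)  e a = avoids-suc (λ Pz d → a ≤-refl Pz (∣-mod (mod-sym (mod-lin h m (mod-coarsen (m∣m*n _) e))) d))
                                (avoids-periodic z (mod-coarsen (n∣m*n (suc z)) e) (avoids-pred a))
      by-cases (no ¬Pz) e a = avoids-suc (λ Pz → ⊥-elim (¬Pz Pz)) (avoids-periodic z e (avoids-pred a))

    -- The count is independent of `h` and `m`: each prime of `P` forbids exactly one residue of j,
    -- and CRT multiplies the numbers of survivors. Hence a density established along g + j b is
    -- also the density among all integers, the case h = 0, m = 1.
    cnt-avoids : ∀ z → cnt (λ j → avoids? z (h + j * m)) (modulus z) ≡ coprimes z
    cnt-avoids zero    = cnt-all (λ j → avoids? 0 (h + j * m)) 1 (λ { _ _ (s≤s z≤n) p0 → ⊥-elim (¬prime[0] (P⇒prime p0)) })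
    cnt-avoids (suc z) = by-cases (P? (suc z))
      where
      A? : ∀ z → Decidable (λ j → Avoids z (h + j * m))
      A? z j = avoids? z (h + j * m)
      D? : Decidable (λ j → suc z ∣ h + j * m)
      D? j = suc z ∣? (h + j * m)
      by-cases : (d : Dec (P (suc z))) → cnt (A? (suc z)) (scaleIf d (suc z) (modulus z)) ≡ scaleIf d z (coprimes z)
      by-cases (no ¬Pz) = trans (cnt-cong (A? (suc z)) (A? z) (modulus z) (λ _ _ → avoids-pred) (λ _ _ → avoids-suc (λ Pz → ⊥-elim (¬Pz Pz)))) (cnt-avoids z)
      by-cases (yes Pz) = begin
        cnt (A? (suc z)) (suc z * modulus z)        ≡⟨ cnt-cong (A? (suc z)) (∁? D? ∩? A? z) (suc z * modulus z) (λ _ _ a → a ≤-refl Pz , avoids-pred a) (λ _ _ (¬d , a) → avoids-suc (λ _ → ¬d) a) ⟩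
        cnt (∁? D? ∩? A? z) (suc z * modulus z)     ≡⟨ cnt-crt {{_}} {{modulus≢0 z}} (prime∤⇒coprime pz (prime∤modulus pz z ≤-refl)) (∁? D?) (A? z) (λ e ¬d d → ¬d (∣-mod (mod-lin h m (mod-sym e)) d)) (avoids-periodic z) ⟩
        cnt (∁? D?) (suc z) * cnt (A? z) (modulus z) ≡⟨ cong₂ _*_ nonroots (cnt-avoids z) ⟩
        z * coprimes z                              ∎
        where
        open ≡-Reasoning
        pz = P⇒prime Pz
        nonroots : cnt (∁? D?) (suc z) ≡ z
        nonroots = suc-injective (trans (cong (_+ cnt (∁? D?) (suc z)) (sym (cnt-roots pz h m (P∤m Pz)))) (cnt-∁ D? (suc z)))

  cnt-avoids-all : ∀ z → cnt (avoids? z) (modulus z) ≡ coprimes z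
  cnt-avoids-all z =
    trans (cnt-cong (avoids? z) (λ j → avoids? z (0 + j * 1)) (modulus z)
            (λ j _ → subst (Avoids z) (sym (*-identityʳ j))) (λ j _ → subst (Avoids z) (*-identityʳ j)))
          (cnt-avoids z)
    where open Progression 0 1 (λ Pp d → ¬prime[1] (subst Prime (∣1⇒≡1 d) (P⇒prime Pp)))

  avoids-all-periodic : ∀ z → Periodic (modulus z) (Avoids z)
  avoids-all-periodic z {x} {y} e a = subst (Avoids z) (*-identityʳ y) (avoids-periodic z e (subst (Avoids z) (sym (*-identityʳ x)) a))
    where open Progression 0 1 (λ Pp d → ¬prime[1] (subst Prime (∣1⇒≡1 d) (P⇒prime Pp)))

-- The sieve density of a set of primes that hits a whole progression

module Divergence {P : ℕ → Set} (P? : Decidable P) (P⇒prime : ∀ {p} → P p → Prime p)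
                  (b : ℕ) .{{_ : NonZero b}} (P∤b : ∀ {p} → P p → ¬ p ∣ b)
                  (g : ℕ) (0<g : 0 < g) (g<b : g < b)
                  (hit : ∀ j → ∃ λ p → P p × p ∣ g + j * b) where

  open Sieve P? P⇒prime
  open Progression g b P∤b
  open ≤-Reasoning

  private
    A? : ∀ z → Decidable (λ j → Avoids z (g + j * b))
    A? z j = avoids? z (g + j * b)

  -- Integral substitute for X · Σ 1 / p over the p in P with z < p ≤ d + z.
  reciprocals : ℕ → ℕ → ℕ → ℕ
  reciprocals X z zero    = 0
  reciprocals X z (suc d) = indicator (P? (suc (d + z))) * (X / suc (d + z)) + reciprocals X z d

  -- There are at most L / p + 1 multiples, and p ≤ b L lets the extra 1 be paid for by b L / p.
  -- This is the source of the factor b + 1 in `gain`.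
  cnt-multiples : ∀ p → (Pp : P p) → ∀ L → p ≤ b * L → cnt (λ j → p ∣? (g + j * b)) L ≤ ((L + b * L) / p) {{prime⇒nonZero (P⇒prime Pp)}}
  cnt-multiples p Pp L p≤ = begin
    cnt D? L                        ≤⟨ cnt-mono D? (<⇒≤ (m<suc[m/n]*n L p)) ⟩
    cnt D? (suc (L / p) * p)        ≡⟨ cnt-periodic D? p (λ e → ∣-mod (mod-lin g b e)) (suc (L / p)) ⟩
    suc (L / p) * cnt D? p          ≡⟨ cong (suc (L / p) *_) (cnt-roots (P⇒prime Pp) g b (P∤b Pp)) ⟩
    suc (L / p) * 1                 ≡⟨ *-identityʳ _ ⟩
    suc (L / p)                     ≡⟨ sym (m*n/n≡m (suc (L / p)) p) ⟩
    suc (L / p) * p / p             ≤⟨ /-monoˡ-≤ p bound ⟩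
    (L + b * L) / p                 ∎
    where
    instance
      p≢0 : NonZero p
      p≢0 = prime⇒nonZero (P⇒prime Pp)
    D? : Decidable (λ j → p ∣ g + j * b)
    D? j = p ∣? (g + j * b)
    bound : p + L / p * p ≤ L + b * L
    bound = begin
      p + L / p * p   ≤⟨ +-mono-≤ p≤ (m/n*n≤m L p) ⟩
      b * L + L       ≡⟨ +-comm (b * L) L ⟩
      L + b * L       ∎

  -- Raising the sieve limit by one loses at most the multiples of the new prime p, of which there
  -- are at most X / p.
  union-bound : ∀ L z d → d + z ≤ b * L → cnt (A? z) L ≤ cnt (A? (d + z)) L + reciprocals (L + b * L) z d
  union-bound L z zero    _  = m≤m+n _ _
  union-bound L z (suc d) l  = begin
    cnt (A? z) L                                              ≤⟨ union-bound L z d (<⇒≤ l) ⟩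
    cnt (A? (d + z)) L + reciprocals X z d                    ≤⟨ +-monoˡ-≤ _ (step (P? (suc (d + z)))) ⟩
    cnt (A? (suc (d + z))) L + indicator (P? (suc (d + z))) * (X / suc (d + z)) + reciprocals X z d
                                                              ≡⟨ +-assoc (cnt (A? (suc (d + z))) L) _ _ ⟩
    cnt (A? (suc (d + z))) L + reciprocals X z (suc d)        ∎
    where
    X = L + b * L
    D? : Decidable (λ j → suc (d + z) ∣ g + j * b)
    D? j = suc (d + z) ∣? (g + j * b)
    step : (e : Dec (P (suc (d + z)))) → cnt (A? (d + z)) L ≤ cnt (A? (suc (d + z))) L + indicator e * (X / suc (d + z))
    step (no ¬Pp) = ≤-trans (cnt-⊆ (A? (d + z)) (A? (suc (d + z))) L (λ _ _ → avoids-suc (λ Pp → ⊥-elim (¬Pp Pp)))) (m≤m+n _ _)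
    step (yes Pp) = begin
      cnt (A? (d + z)) L                                      ≤⟨ cnt-∪ (A? (d + z)) (A? (suc (d + z))) D? L split ⟩
      cnt (A? (suc (d + z))) L + cnt D? L                     ≤⟨ +-monoʳ-≤ (cnt (A? (suc (d + z))) L) (cnt-multiples (suc (d + z)) Pp L l) ⟩
      cnt (A? (suc (d + z))) L + X / suc (d + z)              ≡⟨ cong (_+_ (cnt (A? (suc (d + z))) L)) (sym (*-identityˡ (X / suc (d + z)))) ⟩
      cnt (A? (suc (d + z))) L + 1 * (X / suc (d + z))        ∎
      where
      split : ∀ j → j < L → Avoids (d + z) (g + j * b) → Avoids (suc (d + z)) (g + j * b) ⊎ suc (d + z) ∣ g + j * b
      split j _ a with D? j
      ... | yes e = inj₂ e
      ... | no ¬e = inj₁ (avoids-suc (λ _ → ¬e) a)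

  -- For j < L the number g + j b is at most b L, so the prime supplied by `hit` lies within the
  -- sieve limit.
  none-avoids : ∀ L → cnt (A? (b * L)) L ≡ 0
  none-avoids L = cnt-none (A? (b * L)) L λ j j<L a →
    let (p , Pp , p∣) = hit j
        instance nz : NonZero (g + j * b)
                 nz = >-nonZero (≤-trans 0<g (m≤m+n g (j * b)))
    in a (s≤s (begin
         p          ≤⟨ ∣⇒≤ p∣ ⟩
         g + j * b  ≤⟨ +-monoˡ-≤ (j * b) (<⇒≤ g<b) ⟩
         suc j * b  ≤⟨ *-monoˡ-≤ b j<L ⟩
         L * b      ≡⟨ *-comm L b ⟩
         b * L      ∎)) Pp p∣

  -- This is ∏ p / (p - 1) ≥ 1 + Σ 1 / p over the p in `P` with z < p ≤ d + z, cleared of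
  -- denominators. A new prime w + 1 multiplies the left side by (w + 1) / w; that suffices because
  -- w t ≤ X for its rounded term t = X / (w + 1).
  growth : ∀ X z d → modulus z * coprimes (d + z) * (X + reciprocals X z d) ≤ modulus (d + z) * coprimes z * X
  growth X z zero = ≤-reflexive (cong (modulus z * coprimes z *_) (+-identityʳ X))
  growth X z (suc d) = step (P? (suc (d + z)))
    where
    w = d + z
    T = reciprocals X z d
    step : (e : Dec (P (suc w))) →
           modulus z * scaleIf e w (coprimes w) * (X + (indicator e * (X / suc w) + T)) ≤
           scaleIf e (suc w) (modulus w) * coprimes z * X
    step (no _)  = growth X z d
    step (yes _) = begin
      modulus z * (w * coprimes w) * (X + (1 * t + T))  ≡⟨ lem₁ (modulus z) w (coprimes w) X t T ⟩
      modulus z * coprimes w * (w * (X + T) + w * t)    ≤⟨ *-monoʳ-≤ (modulus z * coprimes w) (+-monoʳ-≤ (w * (X + T)) wt≤) ⟩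
      modulus z * coprimes w * (w * (X + T) + (X + T))  ≡⟨ lem₂ (modulus z * coprimes w) w (X + T) ⟩
      suc w * (modulus z * coprimes w * (X + T))        ≤⟨ *-monoʳ-≤ (suc w) (growth X z d) ⟩
      suc w * (modulus w * coprimes z * X)              ≡⟨ lem₃ (suc w) (modulus w) (coprimes z) X ⟩
      suc w * modulus w * coprimes z * X                ∎
      where
      t = X / suc w
      wt≤ : w * t ≤ X + T
      wt≤ = begin
        w * t       ≤⟨ m≤n+m (w * t) t ⟩
        suc w * t   ≡⟨ *-comm (suc w) t ⟩
        t * suc w   ≤⟨ m/n*n≤m X (suc w) ⟩
        X           ≤⟨ m≤m+n X T ⟩
        X + T       ∎
      lem₁ : ∀ m w c X t T → m * (w * c) * (X + (1 * t + T)) ≡ m * c * (w * (X + T) + w * t)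
      lem₁ = ℕS.solve-∀
      lem₂ : ∀ m w X → m * (w * X + X) ≡ suc w * (m * X)
      lem₂ = ℕS.solve-∀
      lem₃ : ∀ w m c X → w * (m * c * X) ≡ w * m * c * X
      lem₃ = ℕS.solve-∀

  -- In fractions: modulus z′ / coprimes z′ ≥ modulus z / coprimes z + 1 / (b + 1).
  gain : ∀ z → ∃ λ z′ → coprimes z′ * (suc b * modulus z + coprimes z) ≤ modulus z′ * coprimes z * suc b
  gain z = b * L , *-cancelʳ-≤ _ _ (suc z * M) {{tM≢0}} (begin
    c′ * (suc b * M + c) * (suc z * M)       ≡⟨ lem₁ c′ b M c (suc z) ⟩
    M * c′ * (X + suc z * c)                 ≤⟨ *-monoʳ-≤ (M * c′) (+-monoʳ-≤ X bound) ⟩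
    M * c′ * (X + T)                         ≡⟨ cong (λ w → M * coprimes w * (X + T)) (sym d+z) ⟩
    M * coprimes (d + z) * (X + T)           ≤⟨ growth X z d ⟩
    modulus (d + z) * c * X                  ≡⟨ cong (λ w → modulus w * c * X) d+z ⟩
    M′ * c * X                               ≡⟨ lem₂ M′ c b (suc z) M ⟩
    M′ * c * suc b * (suc z * M)             ∎)
    where
    M = modulus z
    c = coprimes z
    -- A whole number of periods `M`, so that exactly `suc z * c` terms avoid the primes up to z;
    -- the factor `suc z` guarantees z ≤ b L.
    L = suc z * M
    M′ = modulus (b * L)
    c′ = coprimes (b * L)
    X = L + b * L
    d = b * L ∸ z
    T = reciprocals X z d
    tM≢0 : NonZero (suc z * M)
    tM≢0 = m*n≢0 (suc z) M {{_}} {{modulus≢0 z}}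
    z≤bL : z ≤ b * L
    z≤bL = begin
      z            ≤⟨ n≤1+n z ⟩
      suc z        ≤⟨ m≤m*n (suc z) M {{modulus≢0 z}} ⟩
      L            ≤⟨ m≤n*m L b ⟩
      b * L        ∎
    d+z : d + z ≡ b * L
    d+z = m∸n+n≡m z≤bL
    bound : suc z * c ≤ T
    bound = begin
      suc z * c                  ≡⟨ cong (suc z *_) (sym (cnt-avoids z)) ⟩
      suc z * cnt (A? z) M       ≡⟨ sym (cnt-periodic (A? z) M (avoids-periodic z) (suc z)) ⟩
      cnt (A? z) L               ≤⟨ union-bound L z d (≤-reflexive d+z) ⟩
      cnt (A? (d + z)) L + T     ≡⟨ cong (_+ T) (trans (cong (λ w → cnt (A? w) L) d+z) (none-avoids L)) ⟩
      T                          ∎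
    lem₁ : ∀ c′ b M c t → c′ * (suc b * M + c) * (t * M) ≡ M * c′ * (t * M + b * (t * M) + t * c)
    lem₁ = ℕS.solve-∀
    lem₂ : ∀ M′ c b t M → M′ * c * (t * M + b * (t * M)) ≡ M′ * c * suc b * (t * M)
    lem₂ = ℕS.solve-∀

  -- The ratio of `modulus` to `coprimes` is 1 at z = 0, hence at least 1 + i / (b + 1) after i
  -- applications of `gain`.
  iterate-gain : ∀ i → ∃ λ z → (suc b + i) * coprimes z ≤ suc b * modulus z
  iterate-gain zero    = 0 , ≤-reflexive (cong (_* 1) (+-identityʳ (suc b)))
  iterate-gain (suc i) =
    let (z , ih)  = iterate-gain i
        (z′ , le) = gain z
    in z′ , *-cancelʳ-≤ _ _ (coprimes z) {{coprimes≢0 z}} (begin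
      (suc b + suc i) * coprimes z′ * coprimes z                     ≡⟨ lem₁ b i (coprimes z′) (coprimes z) ⟩
      coprimes z′ * ((suc b + i) * coprimes z + coprimes z)          ≤⟨ *-monoʳ-≤ (coprimes z′) (+-monoˡ-≤ (coprimes z) ih) ⟩
      coprimes z′ * (suc b * modulus z + coprimes z)                 ≤⟨ le ⟩
      modulus z′ * coprimes z * suc b                                ≡⟨ lem₂ (modulus z′) (coprimes z) b ⟩
      suc b * modulus z′ * coprimes z                                ∎)
    where
    lem₁ : ∀ b i c′ c → (suc b + suc i) * c′ * c ≡ c′ * ((suc b + i) * c + c)
    lem₁ = ℕS.solve-∀
    lem₂ : ∀ m c b → m * c * suc b ≡ suc b * m * c
    lem₂ = ℕS.solve-∀

  density→0 : ∀ K → ∃ λ z → K * coprimes z ≤ modulus z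
  density→0 K =
    let (z , le) = iterate-gain (suc b * K)
    in z , *-cancelˡ-≤ (suc b) (begin
      suc b * (K * coprimes z)             ≡⟨ sym (*-assoc (suc b) K (coprimes z)) ⟩
      suc b * K * coprimes z               ≤⟨ *-monoˡ-≤ (coprimes z) (m≤n+m (suc b * K) (suc b)) ⟩
      (suc b + suc b * K) * coprimes z     ≤⟨ le ⟩
      suc b * modulus z                    ∎)

  abstract
    avoids-sparse : ∀ K → ∃₂ λ z N₀ → ∀ N → N₀ ≤ N → K * cnt (avoids? z) N ≤ N
    avoids-sparse K =
      -- The factor 2 pays for the incomplete last period as soon as N is at least the modulus.
      let (z , le) = density→0 (2 * K)
          instance M≢0 : NonZero (modulus z)
                   M≢0 = modulus≢0 z
          M = modulus z
          c = coprimes z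
      in z , M , λ N M≤N → *-cancelˡ-≤ 2 (begin
        2 * (K * cnt (avoids? z) N)                     ≤⟨ *-monoʳ-≤ 2 (*-monoʳ-≤ K (cnt-mono (avoids? z) (<⇒≤ (m<suc[m/n]*n N M)))) ⟩
        2 * (K * cnt (avoids? z) (suc (N / M) * M))     ≡⟨ cong (λ t → 2 * (K * t)) (cnt-periodic (avoids? z) M (avoids-all-periodic z) (suc (N / M))) ⟩
        2 * (K * (suc (N / M) * cnt (avoids? z) M))     ≡⟨ cong (λ t → 2 * (K * (suc (N / M) * t))) (cnt-avoids-all z) ⟩
        2 * (K * (suc (N / M) * c))                     ≡⟨ lem K (suc (N / M)) c ⟩
        suc (N / M) * (2 * K * c)                       ≤⟨ *-monoʳ-≤ (suc (N / M)) le ⟩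
        M + N / M * M                                   ≤⟨ +-mono-≤ M≤N (m/n*n≤m N M) ⟩
        N + N                                           ≡⟨ cong (_+_ N) (sym (+-identityʳ N)) ⟩
        2 * N                                           ∎)
      where
      lem : ∀ K t c → 2 * (K * (t * c)) ≡ t * (2 * K * c)
      lem = ℕS.solve-∀

-- Divisors of almost all integers in residue classes

-- Density 1 in a constructive form: for each `K` there is a decidable exceptional set of proportion
-- at most 1 / K. The set may vary with `K`, because the sieve bound z in `missing` is chosen from
-- `K`.
record AlmostAll (G : ℕ → Set) : Set₁ where
  constructor almost-all
  field
    exceptions : ∀ K → Σ (ℕ → Set) λ E → Σ (Decidable E) λ E? →
                 (∀ n → 0 < n → ¬ E n → G n) × ∃ λ N₀ → ∀ N → N₀ ≤ N → K * cnt E? N ≤ N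

open AlmostAll

sparse-∪ : ∀ {E F : ℕ → Set} (E? : Decidable E) (F? : Decidable F) K N →
           2 * K * cnt E? N ≤ N → 2 * K * cnt F? N ≤ N → K * cnt (λ n → E? n ⊎-dec F? n) N ≤ N
sparse-∪ E? F? K N e f = *-cancelˡ-≤ 2 (begin
  2 * (K * cnt (λ n → E? n ⊎-dec F? n) N)   ≤⟨ *-monoʳ-≤ 2 (*-monoʳ-≤ K (cnt-∪ (λ n → E? n ⊎-dec F? n) E? F? N (λ _ _ → id))) ⟩
  2 * (K * (cnt E? N + cnt F? N))           ≡⟨ lem K (cnt E? N) (cnt F? N) ⟩
  2 * K * cnt E? N + 2 * K * cnt F? N       ≤⟨ +-mono-≤ e f ⟩
  N + N                                     ≡⟨ cong (_+_ N) (sym (+-identityʳ N)) ⟩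
  2 * N                                     ∎)
  where
  open ≤-Reasoning
  lem : ∀ K x y → 2 * (K * (x + y)) ≡ 2 * K * x + 2 * K * y
  lem = ℕS.solve-∀

aa-map : ∀ {G H} → (∀ n → 0 < n → G n → H n) → AlmostAll G → AlmostAll H
aa-map f (almost-all ex) .exceptions K =
  let (E , E? , g , N₀ , le) = ex K in E , E? , (λ n 0<n ¬e → f n 0<n (g n 0<n ¬e)) , N₀ , le

aa-pure : ∀ {G} → (∀ n → 0 < n → G n) → AlmostAll G
aa-pure f .exceptions K =
  (λ _ → ⊥) , (λ _ → no id) , (λ n 0<n _ → f n 0<n) , 0 ,
  λ N _ → ≤-trans (≤-reflexive (trans (cong (K *_) (cnt-none (λ _ → no id) N (λ _ _ → id))) (*-zeroʳ K))) z≤n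

aa-∩ : ∀ {G H} → AlmostAll G → AlmostAll H → AlmostAll (λ n → G n × H n)
aa-∩ (almost-all ex) (almost-all ex′) .exceptions K =
  let (E , E? , g , N₀ , le) = ex (2 * K)
      (F , F? , h , N₁ , le′) = ex′ (2 * K)
  in (λ n → E n ⊎ F n) , (λ n → E? n ⊎-dec F? n) ,
     (λ n 0<n ¬e → g n 0<n (¬e ∘ inj₁) , h n 0<n (¬e ∘ inj₂)) , N₀ + N₁ ,
     λ N N≥ → sparse-∪ E? F? K N (le N (≤-trans (m≤m+n N₀ N₁) N≥)) (le′ N (≤-trans (m≤n+m N₁ N₀) N≥))

-- The exceptions are p times those of `G`, and division by p maps them injectively to smaller
-- numbers, so sparseness is inherited with the same N₀.
aa-quotient : ∀ {G} p .{{_ : NonZero p}} → AlmostAll G → AlmostAll (λ n → ∀ m → n ≡ m * p → G m)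
aa-quotient {G} p (almost-all ex) .exceptions K =
  let (E , E? , g , N₀ , le) = ex K
      F? : Decidable (λ n → p ∣ n × E (n / p))
      F? n = (p ∣? n) ×-dec E? (n / p)
  in (λ n → p ∣ n × E (n / p)) , F? ,
     (λ { _ 0<n ¬e zero refl → ⊥-elim (<-irrefl refl 0<n)
        ; _ 0<n ¬e m@(suc _) refl → g m (s≤s z≤n) (λ e → ¬e (n∣m*n m , subst E (sym (m*n/n≡m m p)) e)) }) ,
     N₀ , λ N N≥ → ≤-trans (*-monoʳ-≤ K (cnt-inj F? E? (λ n m → n ≡ m * p) N N
       (λ n n<N (p∣n , e) → n / p , ≤-<-trans (m/n≤m n p) n<N , e , sym (m/n*n≡m p∣n))
       (λ _ _ _ _ _ _ x y → trans x (sym y)))) (le N N≥)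

module _ (b : ℕ) .{{_ : NonZero b}} where

  mod⇒% : ∀ {x y} → + x ≡ + y [mod b ] → x % b ≡ y % b
  mod⇒% {x} {y} e = mod-<-≡ (m%n<n x b) (m%n<n y b)
    (mod-trans (mod-sym (mod-rem b (+ x))) (mod-trans e (mod-rem b (+ y))))

  mod-*% : ∀ x y → + (x * (y % b)) ≡ + (x * y) [mod b ]
  mod-*% x y = subst₂ (λ s t → s ≡ t [mod b ]) (sym (ℤP.pos-* x (y % b))) (sym (ℤP.pos-* x y)) (mod-*ˡ (+ x) (mod-sym (mod-rem b (+ y))))

  Moves : (ℕ → Set) → ℕ → Set
  Moves S n = ∃ λ s → s < b × S s × ¬ S ((n * s) % b)

  moves? : ∀ {S} → Decidable S → Decidable (Moves S)
  moves? S? n = anyUpTo? (λ s → S? s ×-dec ¬? (S? ((n * s) % b))) b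

  -- Multiply s by the primes one after another. The residue starts in `S` and ends outside, so some
  -- prime makes the step out of `S`, starting from the residue reached just before it.
  product-moves : ∀ {S} → Decidable S → ∀ ps → All Prime ps → Moves S (product ps) →
                  ∃ λ p → Prime p × p ∣ product ps × Moves S p
  product-moves {S} S? [] [] (s , s<b , Ss , ¬S) =
    ⊥-elim (¬S (subst S (sym (trans (cong (_% b) (*-identityˡ s)) (m<n⇒m%n≡m s<b))) Ss))
  product-moves {S} S? (p ∷ ps) (pp ∷ pps) (s , s<b , Ss , ¬S) = by-cases (S? ((p * s) % b))
    where
    by-cases : Dec (S ((p * s) % b)) → _
    by-cases (no ¬Sps) = p , pp , m∣m*n (product ps) , s , s<b , Ss , ¬Sps
    by-cases (yes Sps) =
      let (q , pq , q∣ , mv) = product-moves S? ps pps ((p * s) % b , m%n<n (p * s) b , Sps , ¬S ∘ subst S eq)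
      in q , pq , ∣n⇒∣m*n p q∣ , mv
      where
      lem : ∀ x p s → x * (p * s) ≡ p * x * s
      lem = ℕS.solve-∀
      eq : (product ps * ((p * s) % b)) % b ≡ (p * product ps * s) % b
      eq = trans (mod⇒% (mod-*% (product ps) (p * s))) (cong (_% b) (lem (product ps) p s))

  prime-moves : ∀ {S} → Decidable S → ∀ n .{{_ : NonZero n}} → Moves S n → ∃ λ p → Prime p × p ∣ n × Moves S p
  prime-moves {S} S? n mv with factorise n
  ... | record { factors = ps ; isFactorisation = refl ; factorsPrime = pps } = product-moves S? ps pps mv

  -- An interpolation that makes the induction possible: for S = {1} it says that the divisors of n
  -- meet every unit class, and once `S` contains all units it holds trivially with d = 1.
  Covers : (ℕ → Set) → ℕ → Set
  Covers S n = ∀ c → c < b → Coprime c b → ∃ λ d → d ∣ n × ∃ λ s → S s × + (s * d) ≡ + c [mod b ]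

  Grow : ℕ → (ℕ → Set) → ℕ → Set
  Grow p S x = S x ⊎ ∃ λ s → s < b × (S s × (p * s) % b ≡ x)

  grow? : ∀ p {S} → Decidable S → Decidable (Grow p S)
  grow? p S? x = S? x ⊎-dec anyUpTo? (λ s → S? s ×-dec ((p * s) % b ≟ x)) b

  -- A divisor d of m used with the multiplier p s is traded for the divisor d p of m p with the
  -- multiplier s.
  covers-grow : ∀ {p S m} → Covers (Grow p S) m → Covers S (m * p)
  covers-grow {p} {S} {m} cov c c<b c⊥b with cov c c<b c⊥b
  ... | d , d∣m , s , inj₁ Ss , e = d , ∣m⇒∣m*n p d∣m , s , Ss , e
  ... | d , d∣m , _ , inj₂ (s , _ , Ss , refl) , e = d * p , *-monoˡ-∣ p d∣m , s , Ss , mod-trans (mod-sym e′) e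
    where
    lem : ∀ d p s → d * (p * s) ≡ s * (d * p)
    lem = ℕS.solve-∀
    e′ : + (((p * s) % b) * d) ≡ + (s * (d * p)) [mod b ]
    e′ = mod-trans (≡⇒mod (cong +_ (*-comm ((p * s) % b) d))) (mod-trans (mod-*% d (p * s)) (≡⇒mod (cong +_ (lem d p s))))

  -- Induction on the number of residues missing from S: almost every n has a prime factor p moving S,
  -- among boundedly many such p, and n / p then has to cover only with the larger set S ∪ pS.
  aa-covers : ∀ k {S} (S? : Decidable S) → S (1 % b) → cnt (∁? S?) b ≤ k → AlmostAll (Covers S)
  aa-covers k {S} S? S1 le = by-cases (anyUpTo? (λ c → Coprime.coprime? c b ×-dec ¬? (S? c)) b)
    where
    -- The residue p s that escapes from `S` belongs to `Grow p S`, so the number of missing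
    -- residues drops.
    grown : ∀ {p} → Moves S p → ∀ k → cnt (∁? S?) b ≤ suc k → cnt (∁? (grow? p S?)) b ≤ k
    grown {p} (s , s<b , Ss , ¬S) k le = s≤s⁻¹ (≤-trans (s≤s
      (cnt-⊆ (∁? (grow? p S?)) (∁? S? ∩? ∁? (_≟ ((p * s) % b))) b
         (λ x _ ¬g → ¬g ∘ inj₁ , λ x≡ → ¬g (inj₂ (s , s<b , Ss , sym x≡)))))
      (≤-trans (cnt-remove (∁? S?) ((p * s) % b) b (m%n<n (p * s) b) ¬S) le))

    missing : ∀ k → cnt (∁? S?) b ≤ k → ∀ g → g < b → Coprime g b → ¬ S g → AlmostAll (Covers S)
    missing zero    le g g<b _   ¬Sg = ⊥-elim (n≮0 (≤-trans (cnt-remove (∁? S?) g b g<b ¬Sg) le))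
    missing (suc k) le g g<b g⊥b ¬Sg .exceptions K =
      let (z , N₀ , sparse) = avoids-sparse (2 * K)
          (E , E? , G , N₁ , sparse′) = exceptions (covers-multiples z) (2 * K)
      in (λ n → Avoids z n ⊎ E n) , (λ n → avoids? z n ⊎-dec E? n) ,
         (λ n 0<n ¬e → from-prime z n (¬e ∘ inj₁) (G n 0<n (¬e ∘ inj₂))) , N₀ + N₁ ,
         λ N N≥ → sparse-∪ (avoids? z) E? K N (sparse N (≤-trans (m≤m+n N₀ N₁) N≥)) (sparse′ N (≤-trans (m≤n+m N₁ N₀) N≥))
      where
      P : ℕ → Set
      P p = Prime p × ¬ p ∣ b × Moves S p
      P? : Decidable P
      P? p = prime? p ×-dec ¬? (p ∣? b) ×-dec moves? S? p
      -- If g = 0, coprimality forces b = 1; then 0 is the residue `1 % b`, which lies in `S`.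
      0<g : 0 < g
      0<g = n≢0⇒n>0 λ { refl → ¬Sg (subst S (lem b (Coprime.0-coprimeTo-m⇒m≡1 g⊥b)) S1) }
        where
        lem : ∀ b .{{_ : NonZero b}} → b ≡ 1 → 1 % b ≡ 0
        lem _ refl = refl
      hit : ∀ j → ∃ λ p → P p × p ∣ g + j * b
      hit j =
        let instance n≢0 : NonZero (g + j * b)
                     n≢0 = >-nonZero (≤-trans 0<g (m≤m+n g (j * b)))
            (p , pp , p∣n , mv) = prime-moves S? (g + j * b)
              (1 % b , m%n<n 1 b , S1 , ¬Sg ∘ subst S (trans (mod⇒% (mod-*% (g + j * b) 1)) (trans (cong (_% b) (*-identityʳ _)) (trans ([m+kn]%n≡m%n g j b) (m<n⇒m%n≡m g<b)))))
        -- A prime dividing both g + j b and b would divide g, which is prime to b.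
        in p , (pp , (λ p∣b → ¬prime[1] (subst Prime (g⊥b (∣m+n∣m⇒∣n (subst (p ∣_) (+-comm g (j * b)) p∣n) (∣n⇒∣m*n j p∣b) , p∣b)) pp)) , mv) , p∣n
      open Sieve P? proj₁
      open Divergence P? proj₁ b (proj₁ ∘ proj₂) g 0<g g<b hit

      -- Bounding p by z leaves finitely many primes, so the exceptional sets of the recursive
      -- calls, one for each `Grow p S`, can be united.
      covers-multiples : ∀ z → AlmostAll (λ n → ∀ p → p < suc z → P p → p ∣ n → Covers S n)
      covers-multiples zero = aa-pure λ { _ _ _ (s≤s z≤n) (p0 , _) _ → ⊥-elim (¬prime[0] p0) }
      covers-multiples (suc z) = step (P? (suc z))
        where
        step : Dec (P (suc z)) → AlmostAll (λ n → ∀ p → p < suc (suc z) → P p → p ∣ n → Covers S n)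
        step (no ¬P) = aa-map (λ n _ f p p< Pp p∣n → case m≤n⇒m<n∨m≡n (s≤s⁻¹ p<) of λ
          { (inj₁ l) → f p l Pp p∣n ; (inj₂ refl) → ⊥-elim (¬P Pp) }) (covers-multiples z)
        step (yes (_ , _ , mv)) = aa-map (λ n _ (f , h) p p< Pp p∣n → case m≤n⇒m<n∨m≡n (s≤s⁻¹ p<) of λ
          { (inj₁ l) → f p l Pp p∣n
          ; (inj₂ refl) → subst (Covers S) (sym (_∣_.equality p∣n)) (covers-grow (h (quotient p∣n) (_∣_.equality p∣n))) })
          (aa-∩ (covers-multiples z) (aa-quotient (suc z) (aa-covers k (grow? (suc z) S?) (inj₁ S1) (grown {suc z} mv k le))))

      from-prime : ∀ z n → ¬ Avoids z n → (∀ p → p < suc z → P p → p ∣ n → Covers S n) → Covers S n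
      from-prime z n ¬av f = found (anyUpTo? (λ p → P? p ×-dec (p ∣? n)) (suc z))
        where
        found : Dec _ → Covers S n
        found (yes (p , p< , Pp , p∣n)) = f p p< Pp p∣n
        found (no ¬∃) = ⊥-elim (¬av (λ {p} p< Pp p∣n → ¬∃ (p , p< , Pp , p∣n)))

    by-cases : Dec _ → AlmostAll (Covers S)
    by-cases (yes (g , g<b , g⊥b , ¬Sg)) = missing k le g g<b g⊥b ¬Sg
    by-cases (no ¬∃) = aa-pure λ n _ c c<b c⊥b → 1 , 1∣ n , c ,
      decidable-stable (S? c) (λ ¬Sc → ¬∃ (c , c<b , c⊥b , ¬Sc)) , ≡⇒mod (cong +_ (*-identityʳ c))

  HasAllDivisorClasses : ℕ → Set
  HasAllDivisorClasses n = ∀ c → c < b → Coprime c b → ∃ λ d → d ∣ n × + d ≡ + c [mod b ]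

  aa-divisor-classes : AlmostAll HasAllDivisorClasses
  aa-divisor-classes = aa-map {G = Covers (_≡ 1 % b)} (λ { n _ cov c c<b c⊥b → let (d , d∣n , s , s≡ , e) = cov c c<b c⊥b in
      d , d∣n , mod-trans (mod-sym (lem d s s≡)) e })
    (aa-covers (cnt (∁? (_≟ (1 % b))) b) (_≟ (1 % b)) refl ≤-refl)
    where
    lem : ∀ d s → s ≡ 1 % b → + (s * d) ≡ + d [mod b ]
    lem d s refl = mod-trans (≡⇒mod (cong +_ (*-comm (1 % b) d))) (mod-trans (mod-*% d 1) (≡⇒mod (cong +_ (*-identityʳ d))))

-- Values of the form modulo b²

coprime-*ʳ : ∀ {k m n} → Coprime k m → Coprime k n → Coprime k (m * n)
coprime-*ʳ k⊥m k⊥n {d} (d∣k , d∣mn) =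
  k⊥n (d∣k , Coprime.coprime-divisor (λ (e∣d , e∣m) → k⊥m (∣-trans e∣d d∣k , e∣m)) d∣mn)

coprime-∣ʳ : ∀ {k m n} → k ∣ n → Coprime m n → Coprime m k
coprime-∣ʳ k∣n m⊥n (d∣m , d∣k) = m⊥n (d∣m , ∣-trans d∣k k∣n)

coprime-^ˡ : ∀ {m n} e → Coprime m n → Coprime (m ^ e) n
coprime-^ˡ {n = n} zero    _   = Coprime.1-coprimeTo n
coprime-^ˡ (suc e) m⊥n = Coprime.sym (coprime-*ʳ (Coprime.sym m⊥n) (Coprime.sym (coprime-^ˡ e m⊥n)))

∣-≡mod : ∀ {d m x y} → x ≡ y [mod m ] → d ∣ m → d ∣ ℤ.∣ x ∣ → d ∣ ℤ.∣ y ∣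
∣-≡mod e d∣m d∣x = ℤ∣.∣⇒∣ᵤ (mod-respˡ-∣ (mod-coarsen d∣m e) (ℤ∣.∣ᵤ⇒∣ d∣x))

coprime-mod : ∀ {m x y} → x ≡ y [mod m ] → Coprime ℤ.∣ x ∣ m → Coprime ℤ.∣ y ∣ m
coprime-mod e x⊥m (d∣y , d∣m) = x⊥m (∣-≡mod (mod-sym e) d∣m d∣y , d∣m)

mod-cancelˡ : ∀ {m x y} a → Coprime ℤ.∣ a ∣ m → a ℤ.* x ≡ a ℤ.* y [mod m ] → x ≡ y [mod m ]
mod-cancelˡ {m} {x} {y} a a⊥m e =
  ∣-⇒mod (ℤ∣.∣ᵤ⇒∣ (Coprime.coprime-divisor (Coprime.sym a⊥m)
    (subst (m ∣_) (trans (cong ℤ.∣_∣ (lem a x y)) (ℤP.abs-* a (x ℤ.- y))) (ℤ∣.∣⇒∣ᵤ (mod⇒∣- e)))))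
  where
  lem : ∀ a x y → a ℤ.* x ℤ.- a ℤ.* y ≡ a ℤ.* (x ℤ.- y)
  lem = ℤS.solve-∀

mod-scale : ∀ g {m x y} → x ≡ y [mod m ] → + g ℤ.* x ≡ + g ℤ.* y [mod g * m ]
mod-scale g {m} {y = y} (mod-by q refl) = mod-by q (trans (lem (+ g) y q (+ m)) (cong (λ t → + g ℤ.* y ℤ.+ q ℤ.* t) (sym (ℤP.pos-* g m))))
  where
  lem : ∀ g y q m → g ℤ.* (y ℤ.+ q ℤ.* m) ≡ g ℤ.* y ℤ.+ q ℤ.* (g ℤ.* m)
  lem = ℤS.solve-∀

mod-unscale : ∀ g .{{_ : NonZero g}} {m x y} → + g ℤ.* x ≡ + g ℤ.* y [mod g * m ] → x ≡ y [mod m ]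
mod-unscale g {m} {x} {y} (mod-by q e) = mod-by q (ℤP.*-cancelˡ-≡ (+ g) x _ (trans e (trans (cong (λ t → + g ℤ.* y ℤ.+ q ℤ.* t) (ℤP.pos-* g m)) (sym (lem (+ g) y q (+ m))))))
  where
  lem : ∀ g y q m → g ℤ.* (y ℤ.+ q ℤ.* m) ≡ g ℤ.* y ℤ.+ q ℤ.* (g ℤ.* m)
  lem = ℤS.solve-∀

-- If the next prime p divides y, then y is replaced by y + m B. This keeps y modulo both m and B,
-- and p does not divide m B: otherwise p would be a common factor of y and m or of y and B.
coprime-lift-product : ∀ {m x} → Coprime ℤ.∣ x ∣ m → ∀ ps → All Prime ps →
                       ∃ λ y → y ≡ x [mod m ] × Coprime ℤ.∣ y ∣ (product ps)
coprime-lift-product {x = x} x⊥m [] [] = x , mod-refl , Coprime.sym (Coprime.1-coprimeTo _)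
coprime-lift-product {m} {x} x⊥m (p ∷ ps) (pp ∷ pps) =
  let (y , y≡x , y⊥B) = coprime-lift-product x⊥m ps pps in by-cases y y≡x y⊥B (p ∣? ℤ.∣ y ∣)
  where
  B = product ps
  by-cases : ∀ y → y ≡ x [mod m ] → Coprime ℤ.∣ y ∣ B → Dec (p ∣ ℤ.∣ y ∣) →
             ∃ λ y → y ≡ x [mod m ] × Coprime ℤ.∣ y ∣ (p * B)
  by-cases y y≡x y⊥B (no p∤y) = y , y≡x , coprime-*ʳ (Coprime.sym (prime∤⇒coprime pp p∤y)) y⊥B
  by-cases y y≡x y⊥B (yes p∣y) =
    y′ , mod-trans (mod-by (+ B) (cong (ℤ._+_ y) (ℤP.*-comm (+ m) (+ B)))) y≡x ,
    coprime-*ʳ (Coprime.sym (prime∤⇒coprime pp p∤y′)) (coprime-mod {x = y} (mod-sym (mod-by (+ m) refl)) y⊥B)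
    where
    y′ = y ℤ.+ + m ℤ.* + B
    p≢1 : ¬ p ≡ 1
    p≢1 refl = ¬prime[1] pp
    p∤y′ : ¬ p ∣ ℤ.∣ y′ ∣
    p∤y′ p∣y′ with euclidsLemma m B pp (subst (p ∣_) (ℤP.abs-* (+ m) (+ B)) (ℤ∣.∣⇒∣ᵤ (ℤ∣.∣m+n∣m⇒∣n {+ p} {y} (ℤ∣.∣ᵤ⇒∣ p∣y′) (ℤ∣.∣ᵤ⇒∣ p∣y))))
    ... | inj₁ p∣m = p≢1 (x⊥m (∣-≡mod y≡x p∣m p∣y , p∣m))
    ... | inj₂ p∣B = p≢1 (y⊥B (p∣y , p∣B))

abstract
  coprime-lift : ∀ {m x} → Coprime ℤ.∣ x ∣ m → ∀ b .{{_ : NonZero b}} → ∃ λ y → y ≡ x [mod m ] × Coprime ℤ.∣ y ∣ b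
  coprime-lift x⊥m b with factorise b
  ... | record { factors = ps ; isFactorisation = refl ; factorsPrime = pps } = coprime-lift-product x⊥m ps pps

-- n = x (a x + b y) for some y, with z for the second factor.
Rep : ℤ → ℕ → ℤ → Set
Rep a b n = ∃₂ λ x z → (x ℤ.* z ≡ n) × z ≡ a ℤ.* x [mod b ]

Loc : ℤ → ℕ → ℤ → Set
Loc a b n = ∃₂ λ x z → x ℤ.* z ≡ n [mod b * b ] × z ≡ a ℤ.* x [mod b ]

rep⇒loc : ∀ {a b n} → Rep a b n → Loc a b n
rep⇒loc (x , z , e , f) = x , z , ≡⇒mod e , f

loc-0 : ∀ a b → Loc a b (+ 0)
loc-0 a b = + 0 , + 0 , mod-refl , ≡⇒mod (sym (ℤP.*-zeroʳ a))

loc-mod : ∀ {a b m n} → m ≡ n [mod b * b ] → Loc a b m → Loc a b n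
loc-mod e (x , z , f , h) = x , z , mod-trans f e , h

abstract
  loc? : ∀ a b .{{_ : NonZero b}} n → Dec (Loc a b n)
  loc? a b n = map′ (λ (x , _ , z , _ , e) → + x , + z , e) reduce
                 (anyUpTo? (λ x → anyUpTo? (λ z → mod? (b * b) (+ x ℤ.* + z) n ×-dec mod? b (+ z) (a ℤ.* + x)) (b * b)) (b * b))
    where
    instance
      b²≢0 : NonZero (b * b)
      b²≢0 = m*n≢0 b b
    reduce : Loc a b n → ∃ λ x → x < b * b × ∃ λ z → z < b * b × (+ x ℤ.* + z ≡ n [mod b * b ] × + z ≡ a ℤ.* + x [mod b ])
    reduce (x , z , e , f) =
      x ℤDM.%ℕ (b * b) , ℤDM.n%ℕd<d x (b * b) , z ℤDM.%ℕ (b * b) , ℤDM.n%ℕd<d z (b * b) ,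
      mod-trans (mod-sym (mod-* x≡ z≡)) e ,
      mod-trans (mod-sym (mod-coarsen (m∣m*n b) z≡)) (mod-trans f (mod-*ˡ a (mod-coarsen (m∣m*n b) x≡)))
      where
      x≡ : x ≡ + (x ℤDM.%ℕ (b * b)) [mod b * b ]
      x≡ = mod-rem (b * b) x
      z≡ : z ≡ + (z ℤDM.%ℕ (b * b)) [mod b * b ]
      z≡ = mod-rem (b * b) z

-- With g = gcd(x₀, b), both x₀ = g x₁ and z₀ = g z₁, so n = g² n₁ with n₁ ≡ x₁ z₁ modulo b₁ = b /
-- g, and x₁ is a unit modulo b₁. A divisor d of n with d ≡ x₁ (mod b₁) takes the place of x₁, and k
-- = n₁ / d that of z₁. Cancelling d gives k ≡ z₁ ≡ a d (mod b₁), and multiplying by g restores the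
-- congruence modulo b.
loc⇒rep : ∀ a b .{{_ : NonZero b}} n → HasAllDivisorClasses b n → Loc a b (+ n) → Rep a b (+ n)
loc⇒rep a b n classes (x₀ , z₀ , x₀z₀≡n , z₀≡ax₀) =
  + g ℤ.* + d , + g ℤ.* + k ,
  trans (lem₁ (+ g) (+ d) (+ k)) (trans (cong (λ t → + g ℤ.* + g ℤ.* t) (sym n₁≡kd)) (sym n≡)) ,
  subst (λ t → + g ℤ.* + k ≡ a ℤ.* (+ g ℤ.* + d) [mod t ]) (sym b≡gb₁)
    (mod-trans (mod-scale g k≡ad) (≡⇒mod (lem₂ (+ g) a (+ d))))
  where
  lem₁ : ∀ g d k → g ℤ.* d ℤ.* (g ℤ.* k) ≡ g ℤ.* g ℤ.* (k ℤ.* d)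
  lem₁ = ℤS.solve-∀
  lem₂ : ∀ g a d → g ℤ.* (a ℤ.* d) ≡ a ℤ.* (g ℤ.* d)
  lem₂ = ℤS.solve-∀
  lem₃ : ∀ g x z → x ℤ.* g ℤ.* (z ℤ.* g) ≡ g ℤ.* (g ℤ.* (x ℤ.* z))
  lem₃ = ℤS.solve-∀
  g = gcd ℤ.∣ x₀ ∣ b
  instance
    g≢0 : NonZero g
    g≢0 = ≢-nonZero (gcd[m,n]≢0 ℤ.∣ x₀ ∣ b (inj₂ (≢-nonZero⁻¹ b)))
  g∣b : g ∣ b
  g∣b = gcd[m,n]∣n ℤ.∣ x₀ ∣ b
  g∣x₀ : + g ℤ∣.∣ x₀
  g∣x₀ = ℤ∣.∣ᵤ⇒∣ (gcd[m,n]∣m ℤ.∣ x₀ ∣ b)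
  g∣z₀ : + g ℤ∣.∣ z₀
  g∣z₀ = mod-respˡ-∣ (mod-sym (mod-coarsen g∣b z₀≡ax₀)) (ℤ∣.∣n⇒∣m*n a g∣x₀)
  x₁ = ℤ∣._∣_.quotient g∣x₀
  z₁ = ℤ∣._∣_.quotient g∣z₀
  x₀≡ : x₀ ≡ x₁ ℤ.* + g
  x₀≡ = ℤ∣._∣_.equality g∣x₀
  z₀≡ : z₀ ≡ z₁ ℤ.* + g
  z₀≡ = ℤ∣._∣_.equality g∣z₀
  b₁ = b / g
  b≡gb₁ : b ≡ g * b₁
  b≡gb₁ = sym (m*[n/m]≡n g∣b)
  x₁⊥b₁ : Coprime ℤ.∣ x₁ ∣ b₁
  x₁⊥b₁ = subst (λ t → Coprime t b₁) eq (Coprime.coprime-/gcd ℤ.∣ x₀ ∣ b)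
    where
    eq : ℤ.∣ x₀ ∣ / g ≡ ℤ.∣ x₁ ∣
    eq = trans (cong (_/ g) (trans (cong ℤ.∣_∣ x₀≡) (ℤP.abs-* x₁ (+ g)))) (m*n/n≡m ℤ.∣ x₁ ∣ g)
  x₀z₀≡ : x₀ ℤ.* z₀ ≡ + g ℤ.* (+ g ℤ.* (x₁ ℤ.* z₁))
  x₀z₀≡ = trans (cong₂ ℤ._*_ x₀≡ z₀≡) (lem₃ (+ g) x₁ z₁)
  g²∣n : g * g ∣ n
  g²∣n = +∣⇒∣ (mod-respˡ-∣ (mod-coarsen (*-pres-∣ g∣b g∣b) x₀z₀≡n)
           (ℤ∣.divides (x₁ ℤ.* z₁) (trans x₀z₀≡ (trans (lem (+ g) (x₁ ℤ.* z₁)) (cong (x₁ ℤ.* z₁ ℤ.*_) (sym (ℤP.pos-* g g)))))))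
    where
    lem : ∀ g y → g ℤ.* (g ℤ.* y) ≡ y ℤ.* (g ℤ.* g)
    lem = ℤS.solve-∀
  n₁ = quotient g²∣n
  n≡ : + n ≡ + g ℤ.* + g ℤ.* + n₁
  n≡ = trans (cong +_ (trans (_∣_.equality g²∣n) (*-comm n₁ (g * g)))) (trans (ℤP.pos-* (g * g) n₁) (cong (ℤ._* + n₁) (ℤP.pos-* g g)))
  n₁≡x₁z₁ : + n₁ ≡ x₁ ℤ.* z₁ [mod b₁ ]
  n₁≡x₁z₁ = mod-sym (mod-coarsen (n∣m*n b₁) (mod-unscale g (mod-unscale g
    (subst₂ (λ s t → s ≡ + g ℤ.* (+ g ℤ.* + n₁) [mod t ]) x₀z₀≡
      (trans (cong₂ _*_ b≡gb₁ b≡gb₁) (lem g b₁))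
      (mod-trans x₀z₀≡n (≡⇒mod (trans n≡ (ℤP.*-assoc (+ g) (+ g) (+ n₁)))))))))
    where
    lem : ∀ g b → g * b * (g * b) ≡ g * (g * (b * b))
    lem = ℕS.solve-∀
  z₁≡ax₁ : z₁ ≡ a ℤ.* x₁ [mod b₁ ]
  z₁≡ax₁ = mod-unscale g (subst₂ (λ s t → s ≡ + g ℤ.* (a ℤ.* x₁) [mod t ]) (trans z₀≡ (ℤP.*-comm z₁ (+ g))) b≡gb₁
    (mod-trans z₀≡ax₀ (≡⇒mod (trans (cong (a ℤ.*_) x₀≡) (lem a x₁ (+ g))))))
    where
    lem : ∀ a x g → a ℤ.* (x ℤ.* g) ≡ g ℤ.* (a ℤ.* x)
    lem = ℤS.solve-∀
  lifted = coprime-lift x₁⊥b₁ b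
  y = proj₁ lifted
  -- The divisor classes are units modulo b, whereas x₁ is only known to be a unit modulo b₁; hence
  -- the lift `y`.
  c = y ℤDM.%ℕ b
  y≡c : y ≡ + c [mod b ]
  y≡c = mod-rem b y
  divisor = classes c (ℤDM.n%ℕd<d y b) (coprime-mod y≡c (proj₂ (proj₂ lifted)))
  d = proj₁ divisor
  d≡y : + d ≡ y [mod b ]
  d≡y = mod-trans (proj₂ (proj₂ divisor)) (mod-sym y≡c)
  d⊥b : Coprime d b
  d⊥b = coprime-mod (mod-sym d≡y) (proj₂ (proj₂ lifted))
  b₁∣b : b₁ ∣ b
  b₁∣b = subst (b₁ ∣_) (sym b≡gb₁) (n∣m*n g)
  d≡x₁ : + d ≡ x₁ [mod b₁ ]
  d≡x₁ = mod-trans (mod-coarsen b₁∣b d≡y) (proj₁ (proj₂ lifted))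
  d∣n₁ : d ∣ n₁
  d∣n₁ = Coprime.coprime-divisor (coprime-*ʳ (coprime-∣ʳ g∣b d⊥b) (coprime-∣ʳ g∣b d⊥b))
    (subst (d ∣_) (trans (_∣_.equality g²∣n) (*-comm n₁ (g * g))) (proj₁ (proj₂ divisor)))
  k = quotient d∣n₁
  n₁≡kd : + n₁ ≡ + k ℤ.* + d
  n₁≡kd = trans (cong +_ (_∣_.equality d∣n₁)) (ℤP.pos-* k d)
  k≡ad : + k ≡ a ℤ.* + d [mod b₁ ]
  k≡ad = mod-trans (mod-cancelˡ (+ d) (coprime-∣ʳ b₁∣b d⊥b)
           (mod-trans (≡⇒mod (trans (ℤP.*-comm (+ d) (+ k)) (sym n₁≡kd))) (mod-trans n₁≡x₁z₁ (mod-*ʳ z₁ (mod-sym d≡x₁)))))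
         (mod-trans z₁≡ax₁ (mod-*ˡ a (mod-sym d≡x₁)))

aa-loc⇒rep : ∀ a b .{{_ : NonZero b}} → AlmostAll (λ n → Loc a b (+ n) → Rep a b (+ n))
aa-loc⇒rep a b = aa-map (λ n _ → loc⇒rep a b n) (aa-divisor-classes b)

localCount : ℤ → ∀ b .{{_ : NonZero b}} → ℕ
localCount a b = cnt (λ n → loc? a b (+ n)) (b * b)

localCount-* : ∀ a m n .{{_ : NonZero m}} .{{_ : NonZero n}} .{{_ : NonZero (m * n)}} → Coprime m n →
               localCount a (m * n) ≡ localCount a m * localCount a n
localCount-* a m n m⊥n = begin
  cnt (L (m * n)) (m * n * (m * n))              ≡⟨ cong (cnt (L (m * n))) (lem m n) ⟩
  cnt (L (m * n)) (m * m * (n * n))              ≡⟨ cnt-cong (L (m * n)) (L m ∩? L n) (m * m * (n * n)) (λ k _ → split k) (λ k _ → join k) ⟩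
  cnt (L m ∩? L n) (m * m * (n * n))             ≡⟨ cnt-crt m²⊥n² (L m) (L n) (loc-mod {a}) (loc-mod {a}) ⟩
  localCount a m * localCount a n                ∎
  where
  open ≡-Reasoning
  instance
    m²≢0 : NonZero (m * m)
    m²≢0 = m*n≢0 m m
    n²≢0 : NonZero (n * n)
    n²≢0 = m*n≢0 n n
  L : ∀ b .{{_ : NonZero b}} → Decidable (λ k → Loc a b (+ k))
  L b k = loc? a b (+ k)
  lem : ∀ m n → m * n * (m * n) ≡ m * m * (n * n)
  lem = ℕS.solve-∀
  m⊥n² : Coprime m (n * n)
  m⊥n² = coprime-*ʳ m⊥n m⊥n
  m²⊥n² : Coprime (m * m) (n * n)
  m²⊥n² = Coprime.sym (coprime-*ʳ (Coprime.sym m⊥n²) (Coprime.sym m⊥n²))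
  split : ∀ k → Loc a (m * n) (+ k) → Loc a m (+ k) × Loc a n (+ k)
  split k (x , z , e , f) =
    (x , z , mod-coarsen (*-pres-∣ {o = m} {p = m} (m∣m*n n) (m∣m*n n)) e , mod-coarsen (m∣m*n n) f) ,
    (x , z , mod-coarsen (*-pres-∣ {o = n} {p = n} (n∣m*n m) (n∣m*n m)) e , mod-coarsen (n∣m*n m) f)
  join : ∀ k → Loc a m (+ k) × Loc a n (+ k) → Loc a (m * n) (+ k)
  join k ((x₁ , z₁ , e₁ , f₁) , (x₂ , z₂ , e₂ , f₂)) =
    let (x , x≡₁ , x≡₂) = crt m²⊥n² x₁ x₂
        (z , z≡₁ , z≡₂) = crt m²⊥n² z₁ z₂
        coarse : ∀ {b x y} → x ≡ y [mod b * b ] → x ≡ y [mod b ]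
        coarse {b} = mod-coarsen (m∣m*n b)
    in x , z ,
       subst (λ t → x ℤ.* z ≡ + k [mod t ]) (sym (lem m n))
         (mod-combine m²⊥n² (mod-trans (mod-* x≡₁ z≡₁) e₁) (mod-trans (mod-* x≡₂ z≡₂) e₂)) ,
       mod-combine m⊥n (mod-trans (coarse z≡₁) (mod-trans f₁ (mod-*ˡ a (mod-sym (coarse x≡₁)))))
                       (mod-trans (coarse z≡₂) (mod-trans f₂ (mod-*ˡ a (mod-sym (coarse x≡₂)))))

-- Prime powers

cnt-image : ∀ {P Q : ℕ → Set} (P? : Decidable P) (Q? : Decidable Q) (f : ℕ → ℕ) n m →
                (∀ {i j} → f i ≡ f j → i ≡ j) →
                (∀ k → k < n → P k → ∃ λ i → i < m × Q i × k ≡ f i) →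
                (∀ i → i < m → Q i → f i < n × P (f i)) →
                cnt P? n ≡ cnt Q? m
cnt-image P? Q? f n m f-inj to from =
  cnt-bij P? Q? (λ k i → k ≡ f i) n m to (λ i i<m Qi → let (l , Pf) = from i i<m Qi in f i , l , Pf , refl)
    (λ _ _ _ _ _ _ x y → trans x (sym y)) (λ _ _ _ _ _ _ x y → f-inj (trans (sym x) y))

mod-neg-∸ : ∀ {q y} → y ≤ q → + (q ∸ y) ≡ ℤ.- (+ y) [mod q ]
mod-neg-∸ {q} {y} y≤q = mod-by (+ 1) (trans (lem (+ (q ∸ y)) (+ y)) (cong (λ t → ℤ.- (+ y) ℤ.+ + 1 ℤ.* t) (cong +_ (m∸n+n≡m y≤q))))
  where
  lem : ∀ u y → u ≡ ℤ.- y ℤ.+ + 1 ℤ.* (u ℤ.+ y)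
  lem = ℤS.solve-∀

module PrimePower {p : ℕ} (pp : Prime p) (a : ℤ) (p∤a : ¬ p ∣ ℤ.∣ a ∣) where

  private instance
    p≢0 : NonZero p
    p≢0 = prime⇒nonZero pp

  euclidℤ : ∀ x y → p ∣ ℤ.∣ x ℤ.* y ∣ → p ∣ ℤ.∣ x ∣ ⊎ p ∣ ℤ.∣ y ∣
  euclidℤ x y d = euclidsLemma ℤ.∣ x ∣ ℤ.∣ y ∣ pp (subst (p ∣_) (ℤP.abs-* x y) d)

  -- p ^ e enters only through this property.
  PowerLike : ℕ → Set
  PowerLike q = ∀ {n} → ¬ p ∣ n → Coprime n q

  powerLike-^ : ∀ e → PowerLike (p ^ e)
  powerLike-^ e p∤n = Coprime.sym (coprime-^ˡ e (prime∤⇒coprime pp p∤n))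

  -- The factor not divisible by p is coprime to q and cancels, so all of q divides the other one.
  powerLike-∣-* : ∀ {q} → PowerLike q → ∀ u v → ¬ (p ∣ ℤ.∣ u ∣ × p ∣ ℤ.∣ v ∣) → q ∣ ℤ.∣ u ℤ.* v ∣ →
                  q ∣ ℤ.∣ u ∣ ⊎ q ∣ ℤ.∣ v ∣
  powerLike-∣-* {q} pow u v ¬both d with p ∣? ℤ.∣ u ∣
  ... | no p∤u  = inj₂ (Coprime.coprime-divisor (Coprime.sym (pow p∤u)) (subst (q ∣_) (ℤP.abs-* u v) d))
  ... | yes p∣u = inj₁ (Coprime.coprime-divisor (Coprime.sym (pow (λ p∣v → ¬both (p∣u , p∣v))))
                         (subst (q ∣_) (trans (ℤP.abs-* u v) (*-comm ℤ.∣ u ∣ ℤ.∣ v ∣)) d))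

  -- From x z = n and z ≡ a x follows n ≡ a x², so the unit values form the coset of the unit
  -- squares by a.
  UnitSq : ℕ → ℕ → Set
  UnitSq q n = ¬ p ∣ n × ∃ λ x → + n ≡ a ℤ.* (x ℤ.* x) [mod q ]

  abstract
    unitSq? : ∀ q .{{_ : NonZero q}} → Decidable (UnitSq q)
    unitSq? q n = ¬? (p ∣? n) ×-dec
      map′ (λ (x , _ , e) → + x , e)
           (λ (x , e) → x ℤDM.%ℕ q , ℤDM.n%ℕd<d x q , mod-trans e (mod-*ˡ a (mod-* (mod-rem q x) (mod-rem q x))))
           (anyUpTo? (λ x → mod? q (+ n) (a ℤ.* (+ x ℤ.* + x))) q)

  unitSq-periodic : ∀ q → p ∣ q → Periodic q (UnitSq q)
  unitSq-periodic q p∣q e (p∤x , y , f) =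
    (λ p∣ → p∤x (∣-≡mod (mod-sym e) p∣q p∣)) , y , mod-trans (mod-sym e) f

  p∤root : ∀ {q n x} → p ∣ q → ¬ p ∣ n → + n ≡ a ℤ.* (x ℤ.* x) [mod q ] → ¬ p ∣ ℤ.∣ x ∣
  p∤root {x = x} p∣q p∤n e p∣x = p∤n (∣-≡mod (mod-sym e) p∣q
    (ℤ∣.∣⇒∣ᵤ {+ p} (ℤ∣.∣n⇒∣m*n a (ℤ∣.∣n⇒∣m*n x (ℤ∣.∣ᵤ⇒∣ p∣x)))))

  p∤value : ∀ x → ¬ p ∣ ℤ.∣ x ∣ → ¬ p ∣ ℤ.∣ a ℤ.* (x ℤ.* x) ∣
  p∤value x p∤x d with euclidℤ a (x ℤ.* x) d
  ... | inj₁ p∣a = p∤a p∣a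
  ... | inj₂ d′ with euclidℤ x x d′
  ...   | inj₁ p∣x = p∤x p∣x
  ...   | inj₂ p∣x = p∤x p∣x

  module _ (q′ : ℕ) .{{_ : NonZero q′}} .{{_ : NonZero (p * q′)}} (pow : PowerLike (p * q′)) where

    private
      q = p * q′
      p∣q : p ∣ q
      p∣q = m∣m*n q′
      q²≡ : q * q ≡ p * (p * (q′ * q′))
      q²≡ = lem p q′
        where
        lem : ∀ p q → p * q * (p * q) ≡ p * (p * (q * q))
        lem = ℕS.solve-∀
      instance
        q²≢0 : NonZero (q * q)
        q²≢0 = m*n≢0 q q

    -- For a unit n the condition n ≡ a x² modulo q is already enough: z = n / x, computed modulo
    -- q², satisfies x z ≡ n exactly there and z ≡ a x modulo q. The set therefore has period q and
    -- is counted q times.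
    localCount-units : cnt ((λ n → loc? a q (+ n)) ∩? ∁? (p ∣?_)) (q * q) ≡ q * cnt (unitSq? q) q
    localCount-units = trans
      (cnt-cong ((λ n → loc? a q (+ n)) ∩? ∁? (p ∣?_)) (unitSq? q) (q * q) (λ n _ → to n) (λ n _ → from n))
      (cnt-periodic (unitSq? q) q (unitSq-periodic q p∣q) q)
      where
      lem₁ : ∀ x a → x ℤ.* (a ℤ.* x) ≡ a ℤ.* (x ℤ.* x)
      lem₁ = ℤS.solve-∀
      lem₂ : ∀ x n u → x ℤ.* (n ℤ.* u) ≡ n ℤ.* (x ℤ.* u)
      lem₂ = ℤS.solve-∀
      lem₃ : ∀ a x u → a ℤ.* (x ℤ.* x) ℤ.* u ≡ a ℤ.* x ℤ.* (x ℤ.* u)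
      lem₃ = ℤS.solve-∀
      to : ∀ n → Loc a q (+ n) × ¬ p ∣ n → UnitSq q n
      to n ((x , z , e , f) , p∤n) = p∤n , x ,
        mod-trans (mod-sym (mod-coarsen (m∣m*n q) e)) (mod-trans (mod-*ˡ x f) (≡⇒mod (lem₁ x a)))
      from : ∀ n → UnitSq q n → Loc a q (+ n) × ¬ p ∣ n
      from n (p∤n , x , e) =
        let y = x ℤDM.%ℕ q
            n≡ : + n ≡ a ℤ.* (+ y ℤ.* + y) [mod q ]
            n≡ = mod-trans e (mod-*ˡ a (mod-* (mod-rem q x) (mod-rem q x)))
            y⊥q : Coprime y q
            y⊥q = pow (p∤root {x = + y} p∣q p∤n n≡)
            -- The inverse is taken modulo q², because x z ≡ n must hold there.
            (u , yu≡1) = coprime-inverse {y} {q * q} (coprime-*ʳ y⊥q y⊥q)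
        in (+ y , + n ℤ.* u ,
            mod-trans (≡⇒mod (lem₂ (+ y) (+ n) u)) (mod-trans (mod-*ˡ (+ n) yu≡1) (≡⇒mod (ℤP.*-identityʳ (+ n)))) ,
            mod-trans (mod-*ʳ u n≡) (mod-trans (≡⇒mod (lem₃ a (+ y) u))
              (mod-trans (mod-*ˡ (a ℤ.* + y) (mod-coarsen (m∣m*n q) yu≡1)) (≡⇒mod (ℤP.*-identityʳ (a ℤ.* + y)))))) ,
           p∤n

    -- If p divides n, it divides x or z, and by z ≡ a x with p prime to a it divides both. So n =
    -- p² i, and dividing x and z by p turns the conditions modulo q² and q into those modulo q′²
    -- and q′.
    localCount-nonunits : cnt ((λ n → loc? a q (+ n)) ∩? (p ∣?_)) (q * q) ≡ localCount a q′
    localCount-nonunits = cnt-image ((λ n → loc? a q (+ n)) ∩? (p ∣?_)) (λ n → loc? a q′ (+ n)) (λ n → p * (p * n)) (q * q) (q′ * q′)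
      (λ e → *-cancelˡ-≡ _ _ p (*-cancelˡ-≡ _ _ p e)) to from
      where
      pos-p² : ∀ n → + (p * (p * n)) ≡ + p ℤ.* (+ p ℤ.* + n)
      pos-p² n = trans (ℤP.pos-* p (p * n)) (cong (+ p ℤ.*_) (ℤP.pos-* p n))
      lem₁ : ∀ p x z → x ℤ.* p ℤ.* (z ℤ.* p) ≡ p ℤ.* (p ℤ.* (x ℤ.* z))
      lem₁ = ℤS.solve-∀
      lem₂ : ∀ a p x → a ℤ.* (x ℤ.* p) ≡ p ℤ.* (a ℤ.* x)
      lem₂ = ℤS.solve-∀
      p∣both : ∀ x z → z ≡ a ℤ.* x [mod q ] → p ∣ ℤ.∣ x ∣ ⊎ p ∣ ℤ.∣ z ∣ → + p ℤ∣.∣ x × + p ℤ∣.∣ z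
      p∣both x z f (inj₁ p∣x) = ℤ∣.∣ᵤ⇒∣ p∣x ,
        mod-respˡ-∣ (mod-sym (mod-coarsen p∣q f)) (ℤ∣.∣n⇒∣m*n a (ℤ∣.∣ᵤ⇒∣ p∣x))
      p∣both x z f (inj₂ p∣z) with euclidℤ a x (∣-≡mod f p∣q p∣z)
      ... | inj₁ p∣a = ⊥-elim (p∤a p∣a)
      ... | inj₂ p∣x = ℤ∣.∣ᵤ⇒∣ p∣x , ℤ∣.∣ᵤ⇒∣ p∣z
      to : ∀ n → n < q * q → Loc a q (+ n) × p ∣ n → ∃ λ i → i < q′ * q′ × Loc a q′ (+ i) × n ≡ p * (p * i)
      to n n<q² ((x , z , e , f) , p∣n) = divided (p∣both x z f (euclidℤ x z (∣-≡mod (mod-sym e) (∣m⇒∣m*n q p∣q) p∣n)))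
        where
        divided : + p ℤ∣.∣ x × + p ℤ∣.∣ z → ∃ λ i → i < q′ * q′ × Loc a q′ (+ i) × n ≡ p * (p * i)
        divided (ℤ∣.divides x′ refl , ℤ∣.divides z′ refl) =
          i , *-cancelˡ-< p _ _ (*-cancelˡ-< p _ _ (subst₂ _<_ n≡ q²≡ n<q²)) ,
          (x′ , z′ , mod-unscale p (mod-unscale p (subst₂ (λ s t → s ≡ + p ℤ.* (+ p ℤ.* + i) [mod t ]) (lem₁ (+ p) x′ z′) q²≡
                       (mod-trans e (≡⇒mod (trans (cong +_ n≡) (pos-p² i)))))) ,
                     mod-unscale p (subst (λ s → s ≡ + p ℤ.* (a ℤ.* x′) [mod q ]) (ℤP.*-comm z′ (+ p))
                       (mod-trans f (≡⇒mod (lem₂ a (+ p) x′))))) ,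
          n≡
          where
          p²∣n : p * p ∣ n
          p²∣n = ∣-≡mod e (*-pres-∣ {o = p} {p = p} p∣q p∣q) (ℤ∣.∣⇒∣ᵤ {+ (p * p)} (ℤ∣.divides (x′ ℤ.* z′)
                   (trans (lem (+ p) x′ z′) (cong (x′ ℤ.* z′ ℤ.*_) (sym (ℤP.pos-* p p))))))
            where
            lem : ∀ p x z → x ℤ.* p ℤ.* (z ℤ.* p) ≡ x ℤ.* z ℤ.* (p ℤ.* p)
            lem = ℤS.solve-∀
          i = quotient p²∣n
          n≡ : n ≡ p * (p * i)
          n≡ = trans (_∣_.equality p²∣n) (trans (*-comm i (p * p)) (*-assoc p p i))
      from : ∀ i → i < q′ * q′ → Loc a q′ (+ i) → p * (p * i) < q * q × (Loc a q (+ (p * (p * i))) × p ∣ p * (p * i))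
      from i i< (x , z , e , f) =
        subst (p * (p * i) <_) (sym q²≡) (*-monoʳ-< p (*-monoʳ-< p i<)) ,
        (x ℤ.* + p , z ℤ.* + p ,
         subst₂ (λ s t → s ≡ + (p * (p * i)) [mod t ]) (sym (lem₁ (+ p) x z)) (sym q²≡)
           (mod-trans (mod-scale p (mod-scale p e)) (≡⇒mod (sym (pos-p² i)))) ,
         mod-trans (≡⇒mod (ℤP.*-comm z (+ p))) (mod-trans (mod-scale p f) (≡⇒mod (sym (lem₂ a (+ p) x))))) ,
        m∣m*n (p * i)

    localCount-step : localCount a q ≡ q * cnt (unitSq? q) q + localCount a q′
    localCount-step = trans (cnt-split (λ n → loc? a q (+ n)) (p ∣?_) (q * q))
      (trans (cong₂ _+_ localCount-nonunits localCount-units) (+-comm (localCount a q′) _))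

localCount-1 : ∀ a → localCount a 1 ≡ 1
localCount-1 a = cnt-all (λ n → loc? a 1 (+ n)) 1 λ { _ (s≤s z≤n) → loc-0 a 1 }

localCount-cong : ∀ a {m n} .{{_ : NonZero m}} .{{_ : NonZero n}} → m ≡ n → localCount a m ≡ localCount a n
localCount-cong a refl = refl

module OddPrime {p : ℕ} (pp : Prime p) (r : ℕ) (p≡ : p ≡ suc (2 * r)) (a : ℤ) (p∤a : ¬ p ∣ ℤ.∣ a ∣) where

  open PrimePower pp a p∤a

  private instance
    p≢0 : NonZero p
    p≢0 = prime⇒nonZero pp

  p∤2 : ¬ p ∣ 2
  p∤2 d = too-large r (subst Prime p≡ pp) (subst (_≤ 2) p≡ (∣⇒≤ d))
    where
    too-large : ∀ r → Prime (suc (2 * r)) → ¬ suc (2 * r) ≤ 2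
    too-large zero    p1 _ = ¬prime[1] p1
    too-large (suc r) _  (s≤s (s≤s le)) = n≮0 (subst (_≤ 0) (+-suc r (r + 0)) le)

  odd-^ : ∀ e → ∃ λ k → p ^ e ≡ suc (2 * k)
  odd-^ zero    = 0 , refl
  odd-^ (suc e) = let (k , eq) = odd-^ e in r * p ^ e + k , trans (cong (_* p ^ e) p≡) (trans (lem₁ r (p ^ e)) (trans (cong (_+_ (2 * (r * p ^ e))) eq) (lem₂ (r * p ^ e) k)))
    where
    lem₁ : ∀ r q → suc (2 * r) * q ≡ 2 * (r * q) + q
    lem₁ = ℕS.solve-∀
    lem₂ : ∀ x k → 2 * x + suc (2 * k) ≡ suc (2 * (x + k))
    lem₂ = ℕS.solve-∀

  module _ (q′ k k′ : ℕ) .{{_ : NonZero (p * q′)}} (pow : PowerLike (p * q′))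
           (q≡ : p * q′ ≡ suc (2 * k)) (q′≡ : q′ ≡ suc (2 * k′)) where

    private
      q = p * q′
      p∣q : p ∣ q
      p∣q = m∣m*n q′

    -- Because p (2 k′ + 1) = 2 k + 1, the bounds i p ≤ k and i ≤ k′ are equivalent; i = 0 is
    -- included.
    cnt-multiples-half : cnt (p ∣?_) (suc k) ≡ suc k′
    cnt-multiples-half = trans
      (cnt-image {Q = λ _ → ⊤} (p ∣?_) (λ _ → yes tt) (λ i → i * p) (suc k) (suc k′) (λ {i} {j} → *-cancelʳ-≡ i j p) to from)
      (cnt-all (λ _ → yes tt) (suc k′) (λ _ _ → tt))
      where
      open ≤-Reasoning
      lem : ∀ i p → 2 * (i * p) ≡ p * (2 * i)
      lem = ℕS.solve-∀
      to : ∀ y → y < suc k → p ∣ y → ∃ λ i → i < suc k′ × ⊤ × y ≡ i * p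
      to y y≤k (divides i refl) = i , s≤s (*-cancelˡ-≤ 2 (s≤s⁻¹ (*-cancelˡ-< p _ _ (begin-strict
        p * (2 * i)     ≡⟨ sym (lem i p) ⟩
        2 * (i * p)     ≤⟨ *-monoʳ-≤ 2 (s≤s⁻¹ y≤k) ⟩
        2 * k           <⟨ n<1+n (2 * k) ⟩
        suc (2 * k)     ≡⟨ sym q≡ ⟩
        p * q′          ≡⟨ cong (p *_) q′≡ ⟩
        p * suc (2 * k′) ∎)))) , tt , refl
      from : ∀ i → i < suc k′ → ⊤ → i * p < suc k × p ∣ i * p
      from i i≤k′ _ = s≤s (*-cancelˡ-≤ 2 (s≤s⁻¹ (begin-strict
        2 * (i * p)       ≡⟨ lem i p ⟩
        p * (2 * i)       ≤⟨ *-monoʳ-≤ p (*-monoʳ-≤ 2 (s≤s⁻¹ i≤k′)) ⟩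
        p * (2 * k′)      <⟨ *-monoʳ-< p (n<1+n (2 * k′)) ⟩
        p * suc (2 * k′)  ≡⟨ cong (p *_) (sym q′≡) ⟩
        p * q′            ≡⟨ q≡ ⟩
        suc (2 * k)       ∎))) , n∣m*n i

    -- Each unit square modulo q has exactly one root y with 0 ≤ y ≤ (q - 1) / 2.
    cnt-unitSq-half : cnt (unitSq? q) q ≡ cnt (∁? (p ∣?_)) (suc k)
    cnt-unitSq-half = cnt-bij (unitSq? q) (∁? (p ∣?_)) (λ n y → + n ≡ a ℤ.* (+ y ℤ.* + y) [mod q ]) q (suc k) to from
      (λ n< n′< _ _ _ _ e e′ → mod-<-≡ n< n′< (mod-trans e (mod-sym e′)))
      (λ {y} {y′} → unique {y} {y′})
      where
      neg-sq : ∀ y → ℤ.- y ℤ.* ℤ.- y ≡ y ℤ.* y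
      neg-sq = ℤS.solve-∀
      to : ∀ n → n < q → UnitSq q n → ∃ λ y → y < suc k × ¬ p ∣ y × + n ≡ a ℤ.* (+ y ℤ.* + y) [mod q ]
      to n _ (p∤n , x , e) with x ℤDM.%ℕ q ≤? k
      ... | yes y≤k = y , s≤s y≤k , p∤root {x = + y} p∣q p∤n e′ , e′
        where
        y = x ℤDM.%ℕ q
        e′ : + n ≡ a ℤ.* (+ y ℤ.* + y) [mod q ]
        e′ = mod-trans e (mod-*ˡ a (mod-* (mod-rem q x) (mod-rem q x)))
      -- A root in the upper half is replaced by its negative, which has the same square.
      ... | no y≰k = y , s≤s y≤k , p∤root {x = + y} p∣q p∤n e′ , e′
        where
        y₀ = x ℤDM.%ℕ q
        y = q ∸ y₀
        y≡ : + y ≡ ℤ.- (+ y₀) [mod q ]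
        y≡ = mod-neg-∸ (<⇒≤ (ℤDM.n%ℕd<d x q))
        e′ : + n ≡ a ℤ.* (+ y ℤ.* + y) [mod q ]
        e′ = mod-trans e (mod-*ˡ a (mod-trans (mod-* (mod-rem q x) (mod-rem q x))
               (mod-trans (≡⇒mod (sym (neg-sq (+ y₀)))) (mod-sym (mod-* y≡ y≡)))))
        y≤k : y ≤ k
        y≤k = ≤-trans (∸-monoʳ-≤ q (≰⇒> y≰k)) (≤-reflexive (trans (cong (_∸ suc k) q≡) (trans (m+n∸m≡n k (k + 0)) (+-identityʳ k))))
      from : ∀ y → y < suc k → ¬ p ∣ y → ∃ λ n → n < q × UnitSq q n × + n ≡ a ℤ.* (+ y ℤ.* + y) [mod q ]
      from y _ p∤y = val ℤDM.%ℕ q , ℤDM.n%ℕd<d val q ,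
        ((λ d → p∤value (+ y) p∤y (∣-≡mod (mod-sym e) p∣q d)) , + y , mod-sym e) , mod-sym e
        where
        val = a ℤ.* (+ y ℤ.* + y)
        e = mod-rem q val
      unique : ∀ {y y′ n} → y < suc k → y′ < suc k → ¬ p ∣ y → ¬ p ∣ y′ → n < q → UnitSq q n →
               + n ≡ a ℤ.* (+ y ℤ.* + y) [mod q ] → + n ≡ a ℤ.* (+ y′ ℤ.* + y′) [mod q ] → y ≡ y′
      unique {y} {y′} y≤k y′≤k p∤y p∤y′ _ _ e e′ = conclude (powerLike-∣-* pow (+ y ℤ.- + y′) (+ y ℤ.+ + y′) ¬both q∣)
        where
        open ≤-Reasoning
        factor-sq : ∀ x y → x ℤ.* x ℤ.- y ℤ.* y ≡ (x ℤ.- y) ℤ.* (x ℤ.+ y)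
        factor-sq = ℤS.solve-∀
        double : ∀ x y → (x ℤ.- y) ℤ.+ (x ℤ.+ y) ≡ + 2 ℤ.* x
        double = ℤS.solve-∀
        k<q : k < q
        k<q = subst (k <_) (sym q≡) (s≤s (m≤m+n k (k + 0)))
        q∣ : q ∣ ℤ.∣ (+ y ℤ.- + y′) ℤ.* (+ y ℤ.+ + y′) ∣
        q∣ = subst (λ t → q ∣ ℤ.∣ t ∣) (factor-sq (+ y) (+ y′))
               (ℤ∣.∣⇒∣ᵤ (mod⇒∣- (mod-cancelˡ a (pow p∤a) (mod-trans (mod-sym e) e′))))
        -- A common divisor p would divide the sum 2 y, but p is odd and prime to y.
        ¬both : ¬ (p ∣ ℤ.∣ + y ℤ.- + y′ ∣ × p ∣ ℤ.∣ + y ℤ.+ + y′ ∣)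
        ¬both (d , d′) with euclidℤ (+ 2) (+ y) (subst (λ t → p ∣ ℤ.∣ t ∣) (double (+ y) (+ y′)) (ℤ∣.∣⇒∣ᵤ {+ p} (ℤ∣.∣m∣n⇒∣m+n {m = + y ℤ.- + y′} (ℤ∣.∣ᵤ⇒∣ d) (ℤ∣.∣ᵤ⇒∣ d′))))
        ... | inj₁ x = p∤2 x
        ... | inj₂ x = p∤y x
        conclude : q ∣ ℤ.∣ + y ℤ.- + y′ ∣ ⊎ q ∣ ℤ.∣ + y ℤ.+ + y′ ∣ → y ≡ y′
        conclude (inj₁ d) = mod-<-≡ (≤-<-trans (s≤s⁻¹ y≤k) k<q) (≤-<-trans (s≤s⁻¹ y′≤k) k<q) (∣-⇒mod (ℤ∣.∣ᵤ⇒∣ d))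
        -- As y + y′ ≤ 2 k < q, divisibility by q leaves only y + y′ = 0.
        conclude (inj₂ d) with y + y′ in eq
        ... | zero  = trans (m+n≡0⇒m≡0 y eq) (sym (m+n≡0⇒n≡0 y eq))
        ... | suc s = ⊥-elim (<⇒≱ (begin-strict
                suc s        ≡⟨ sym eq ⟩
                y + y′       ≤⟨ +-mono-≤ (s≤s⁻¹ y≤k) (s≤s⁻¹ y′≤k) ⟩
                k + k        ≡⟨ cong (_+_ k) (sym (+-identityʳ k)) ⟩
                2 * k        <⟨ n<1+n (2 * k) ⟩
                suc (2 * k)  ≡⟨ sym q≡ ⟩
                q            ∎) (∣⇒≤ d))

    -- The k + 1 candidates for a root consist of k′ + 1 multiples of p and one root for each unit
    -- square, so twice the number of squares is 2 k - 2 k′ = q - q′.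
    cnt-unitSq : 2 * cnt (unitSq? q) q + q′ ≡ q
    cnt-unitSq = suc-injective (begin
      suc (2 * cnt (unitSq? q) q + q′)           ≡⟨ cong₂ (λ s t → suc (2 * s + t)) cnt-unitSq-half q′≡ ⟩
      suc (2 * c + suc (2 * k′))                 ≡⟨ lem c k′ ⟩
      2 * (suc k′ + c)                           ≡⟨ cong (2 *_) (trans (cong (_+ c) (sym cnt-multiples-half)) (cnt-∁ (p ∣?_) (suc k))) ⟩
      2 * suc k                                  ≡⟨ lem′ k ⟩
      suc (suc (2 * k))                          ≡⟨ cong suc (sym q≡) ⟩
      suc q                                      ∎)
      where
      open ≡-Reasoning
      c = cnt (∁? (p ∣?_)) (suc k)
      lem : ∀ c k → suc (2 * c + suc (2 * k)) ≡ 2 * (suc k + c)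
      lem = ℕS.solve-∀
      lem′ : ∀ k → 2 * suc k ≡ suc (suc (2 * k))
      lem′ = ℕS.solve-∀

  -- The recursion is R(q) = q (q - q′) / 2 + R(q′) with q = p q′ and R(1) = 1; its geometric sum
  -- has denominator 2 (p + 1). Dividing by q², with a_p = 2 e, gives the numerator p + p^(1-a_p) +
  -- 2 p^(-a_p). The proof adds (p + 1) q q′ to both sides to avoid subtraction.
  localCount-odd : ∀ e .{{_ : NonZero (p ^ e)}} → localCount a (p ^ e) * (2 + (p + p)) ≡ p * (p ^ e * p ^ e) + p + 2
  localCount-odd zero    = trans (cong (_* (2 + (p + p))) (localCount-1 a)) (lem p)
    where
    lem : ∀ p → 1 * (2 + (p + p)) ≡ p * 1 + p + 2
    lem = ℕS.solve-∀
  localCount-odd (suc e) = +-cancelʳ-≡ (suc p * (q * q′)) _ _ (begin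
    localCount a q * (2 + (p + p)) + suc p * (q * q′)
      ≡⟨ cong (λ t → t * (2 + (p + p)) + suc p * (q * q′)) (localCount-step q′ (powerLike-^ (suc e))) ⟩
    (q * s + localCount a q′) * (2 + (p + p)) + suc p * (q * q′)
      ≡⟨ lem₁ q s (localCount a q′) p q′ ⟩
    suc p * q * (2 * s + q′) + localCount a q′ * (2 + (p + p))
      ≡⟨ cong₂ (λ x y → suc p * q * x + y) (cnt-unitSq q′ (proj₁ (odd-^ (suc e))) (proj₁ (odd-^ e)) (powerLike-^ (suc e)) (proj₂ (odd-^ (suc e))) (proj₂ (odd-^ e))) (localCount-odd e) ⟩
    suc p * q * q + (p * (q′ * q′) + p + 2)
      ≡⟨ lem₂ p q′ ⟩
    p * (q * q) + p + 2 + suc p * (q * q′)   ∎)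
    where
    open ≡-Reasoning
    q′ = p ^ e
    q = p * q′
    instance
      q′≢0 : NonZero q′
      q′≢0 = m^n≢0 p e
    s = cnt (unitSq? q) q
    lem₁ : ∀ q s R p q′ → (q * s + R) * (2 + (p + p)) + suc p * (q * q′) ≡ suc p * q * (2 * s + q′) + R * (2 + (p + p))
    lem₁ = ℕS.solve-∀
    lem₂ : ∀ p q → suc p * (p * q) * (p * q) + (p * (q * q) + p + 2) ≡ p * (p * q * (p * q)) + p + 2 + suc p * (p * q * q)
    lem₂ = ℕS.solve-∀

module EvenPrime (a : ℤ) (2∤a : ¬ 2 ∣ ℤ.∣ a ∣) where

  open PrimePower prime[2] a 2∤a

  private
    2∤1 : ¬ 2 ∣ 1
    2∤1 d with ∣⇒≤ d
    ... | s≤s ()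

    T : ℤ → ℤ
    T w = w ℤ.* w ℤ.+ w

    oddSq : ℤ → ℤ
    oddSq w = + 1 ℤ.+ + 4 ℤ.* T w

    odd-sq : ∀ w → (+ 1 ℤ.+ w ℤ.* + 2) ℤ.* (+ 1 ℤ.+ w ℤ.* + 2) ≡ oddSq w
    odd-sq w = lem w
      where
      lem : ∀ w → (+ 1 ℤ.+ w ℤ.* + 2) ℤ.* (+ 1 ℤ.+ w ℤ.* + 2) ≡ + 1 ℤ.+ + 4 ℤ.* (w ℤ.* w ℤ.+ w)
      lem = ℤS.solve-∀

    odd-form : ∀ x → ¬ 2 ∣ ℤ.∣ x ∣ → ∃ λ w → x ≡ + 1 ℤ.+ w ℤ.* + 2
    odd-form x 2∤x with x ℤDM.%ℕ 2 | ℤDM.n%ℕd<d x 2 | ℤDM.a≡a%ℕn+[a/ℕn]*n x 2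
    ... | 0             | _                  | e = ⊥-elim (2∤x (ℤ∣.∣⇒∣ᵤ (ℤ∣.divides (x ℤDM./ℕ 2) (trans e (ℤP.+-identityˡ _)))))
    ... | 1             | _                  | e = x ℤDM./ℕ 2 , e
    ... | suc (suc _)   | s≤s (s≤s ())       | _

    odd-root : ∀ {q n x} → 2 ∣ q → ¬ 2 ∣ n → + n ≡ a ℤ.* (x ℤ.* x) [mod q ] → ∃ λ w → + n ≡ a ℤ.* oddSq w [mod q ]
    odd-root {q} {x = x} 2∣q 2∤n e =
      let (w , x≡) = odd-form x (p∤root {x = x} 2∣q 2∤n e)
      in w , mod-trans e (≡⇒mod (cong (a ℤ.*_) (trans (cong₂ ℤ._*_ x≡ x≡) (odd-sq w))))

    unitSq-rem : ∀ q .{{_ : NonZero q}} → 2 ∣ q → ∀ w → UnitSq q ((a ℤ.* oddSq w) ℤDM.%ℕ q)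
    unitSq-rem q 2∣q w =
      (λ d → p∤value x 2∤x (∣-≡mod (mod-sym e) 2∣q d)) , x , mod-sym e
      where
      x = + 1 ℤ.+ w ℤ.* + 2
      2∤x : ¬ 2 ∣ ℤ.∣ x ∣
      2∤x d = 2∤1 (+∣⇒∣ (ℤ∣.∣m+n∣n⇒∣m {+ 2} {+ 1} {w ℤ.* + 2} (ℤ∣.∣ᵤ⇒∣ d) (ℤ∣.divides w refl)))
      e : a ℤ.* (x ℤ.* x) ≡ + ((a ℤ.* oddSq w) ℤDM.%ℕ q) [mod q ]
      e = mod-trans (≡⇒mod (cong (a ℤ.*_) (odd-sq w))) (mod-rem q (a ℤ.* oddSq w))

  -- Odd squares are 1 modulo 4.
  cnt-unitSq-∣4 : ∀ q .{{_ : NonZero q}} → 2 ∣ q → q ∣ 4 → cnt (unitSq? q) q ≡ 1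
  cnt-unitSq-∣4 q 2∣q q∣4 =
    cnt-bij {𝓠 = λ _ → ⊤} (unitSq? q) (λ _ → yes tt) (λ n _ → + n ≡ a [mod q ]) q 1
      (λ n _ (2∤n , x , e) → 0 , s≤s z≤n , tt ,
        (let (w , e′) = odd-root {x = x} 2∣q 2∤n e in mod-trans e′ (value w)))
      (λ _ _ _ → (a ℤ.* oddSq (+ 0)) ℤDM.%ℕ q , ℤDM.n%ℕd<d (a ℤ.* oddSq (+ 0)) q , unitSq-rem q 2∣q (+ 0) ,
        mod-trans (mod-sym (mod-rem q (a ℤ.* oddSq (+ 0)))) (value (+ 0)))
      (λ n< n′< _ _ _ _ e e′ → mod-<-≡ n< n′< (mod-trans e (mod-sym e′)))
      (λ { (s≤s z≤n) (s≤s z≤n) _ _ _ _ _ _ → refl })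
    where
    value : ∀ w → a ℤ.* oddSq w ≡ a [mod q ]
    value w = mod-trans (mod-*ˡ a (mod-coarsen q∣4 (mod-by (T w) (cong (ℤ._+_ (+ 1)) (ℤP.*-comm (+ 4) (T w)))))) (≡⇒mod (ℤP.*-identityʳ a))

  -- (2 y + 1)² modulo 8 Y depends only on the class of y (y + 1) modulo 2 Y, and each class
  -- has one representative with 0 ≤ y < Y.
  module _ (f : ℕ) where

    private
      Y = 2 ^ f
      2Y = 2 * Y
      q = 2 * (2 * 2Y)
      instance
        Y≢0 : NonZero Y
        Y≢0 = m^n≢0 2 f
        2Y≢0 : NonZero 2Y
        2Y≢0 = m*n≢0 2 Y
        4Y≢0 : NonZero (2 * 2Y)
        4Y≢0 = m*n≢0 2 2Y
        q≢0 : NonZero q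
        q≢0 = m*n≢0 2 (2 * 2Y)
      q≡ : 4 * 2Y ≡ q
      q≡ = *-assoc 2 2 2Y
      2∣q : 2 ∣ q
      2∣q = m∣m*n (2 * 2Y)
      Y<2Y : Y < 2Y
      Y<2Y = m<m+n Y (subst (0 <_) (sym (+-identityʳ Y)) (>-nonZero⁻¹ Y))

      oddSq-mod : ∀ {w y} → T w ≡ T y [mod 2Y ] → oddSq w ≡ oddSq y [mod q ]
      oddSq-mod {w} {y} e = mod-+ˡ (+ 1) (subst (λ t → + 4 ℤ.* T w ≡ + 4 ℤ.* T y [mod t ]) q≡ (mod-scale 4 e))

      T-mod : ∀ {w y} → w ≡ y [mod 2Y ] → T w ≡ T y [mod 2Y ]
      T-mod e = mod-+ (mod-* e e) e

      -- `T` takes the same value at w and -1 - w, and this reflection exchanges the two halves of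
      -- the residues modulo `2Y`.
      representative : ∀ w → ∃ λ y → y < Y × T w ≡ T (+ y) [mod 2Y ]
      representative w with w ℤDM.%ℕ 2Y <? Y
      ... | yes y<Y = w ℤDM.%ℕ 2Y , y<Y , T-mod (mod-rem 2Y w)
      ... | no y≮Y  = 2Y ∸ suc y₀ , bound ,
                      mod-trans (T-mod (mod-rem 2Y w)) (mod-trans (≡⇒mod (reflect (+ y₀))) (mod-sym (T-mod (mod-neg-∸ {y = suc y₀} (ℤDM.n%ℕd<d w 2Y)))))
        where
        y₀ = w ℤDM.%ℕ 2Y
        reflect : ∀ y → y ℤ.* y ℤ.+ y ≡ ℤ.- (+ 1 ℤ.+ y) ℤ.* ℤ.- (+ 1 ℤ.+ y) ℤ.+ ℤ.- (+ 1 ℤ.+ y)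
        reflect = ℤS.solve-∀
        bound : 2Y ∸ suc y₀ < Y
        bound = begin-strict
          2Y ∸ suc y₀   ≤⟨ ∸-monoʳ-≤ 2Y (s≤s (≮⇒≥ y≮Y)) ⟩
          2Y ∸ suc Y    <⟨ ∸-monoʳ-< (n<1+n Y) Y<2Y ⟩
          2Y ∸ Y        ≡⟨ trans (m+n∸m≡n Y (Y + 0)) (+-identityʳ Y) ⟩
          Y             ∎
          where open ≤-Reasoning

      unique : ∀ {y y′} → y < Y → y′ < Y → T (+ y) ≡ T (+ y′) [mod 2Y ] → y ≡ y′
      unique {y} {y′} y<Y y′<Y e = conclude (powerLike-∣-* (powerLike-^ (suc f)) (+ y ℤ.- + y′) (+ y ℤ.+ + y′ ℤ.+ + 1) ¬both d)
        where
        open ≤-Reasoning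
        factor-T : ∀ x y → x ℤ.* x ℤ.+ x ℤ.- (y ℤ.* y ℤ.+ y) ≡ (x ℤ.- y) ℤ.* (x ℤ.+ y ℤ.+ + 1)
        factor-T = ℤS.solve-∀
        sum : ∀ x y → (x ℤ.- y) ℤ.+ (x ℤ.+ y ℤ.+ + 1) ≡ x ℤ.* + 2 ℤ.+ + 1
        sum = ℤS.solve-∀
        d : 2Y ∣ ℤ.∣ (+ y ℤ.- + y′) ℤ.* (+ y ℤ.+ + y′ ℤ.+ + 1) ∣
        d = subst (λ t → 2Y ∣ ℤ.∣ t ∣) (factor-T (+ y) (+ y′)) (ℤ∣.∣⇒∣ᵤ (mod⇒∣- e))
        -- The two factors add up to the odd number 2 y + 1.
        ¬both : ¬ (2 ∣ ℤ.∣ + y ℤ.- + y′ ∣ × 2 ∣ ℤ.∣ + y ℤ.+ + y′ ℤ.+ + 1 ∣)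
        ¬both (d₁ , d₂) = 2∤1 (+∣⇒∣ (ℤ∣.∣m+n∣m⇒∣n {+ 2} {+ y ℤ.* + 2} {+ 1}
          (subst (+ 2 ℤ∣.∣_) (sum (+ y) (+ y′)) (ℤ∣.∣m∣n⇒∣m+n {m = + y ℤ.- + y′} (ℤ∣.∣ᵤ⇒∣ d₁) (ℤ∣.∣ᵤ⇒∣ d₂)))
          (ℤ∣.divides (+ y) refl)))
        conclude : 2Y ∣ ℤ.∣ + y ℤ.- + y′ ∣ ⊎ 2Y ∣ ℤ.∣ + y ℤ.+ + y′ ℤ.+ + 1 ∣ → y ≡ y′
        conclude (inj₁ d) = mod-<-≡ (<-trans y<Y Y<2Y) (<-trans y′<Y Y<2Y) (∣-⇒mod (ℤ∣.∣ᵤ⇒∣ d))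
        -- y + y′ + 1 is positive but less than `2Y`.
        conclude (inj₂ d) = ⊥-elim (<⇒≱ (begin-strict
          y + y′ + 1     ≡⟨ +-assoc y y′ 1 ⟩
          y + (y′ + 1)   <⟨ +-mono-<-≤ y<Y (subst (_≤ Y + 0) (sym (+-comm y′ 1)) (subst (suc y′ ≤_) (sym (+-identityʳ Y)) y′<Y)) ⟩
          2Y             ∎) (∣⇒≤ {{>-nonZero (m≤n+m 1 (y + y′))}} d))

    cnt-unitSq-8∣ : cnt (unitSq? q) q ≡ Y
    cnt-unitSq-8∣ = trans
      (cnt-bij {𝓠 = λ _ → ⊤} (unitSq? q) (λ _ → yes tt) (λ n y → + n ≡ a ℤ.* oddSq (+ y) [mod q ]) q Y
        (λ n _ (2∤n , x , e) → let (w , e′) = odd-root {x = x} 2∣q 2∤n e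
                                   (y , y<Y , f) = representative w
                               in y , y<Y , tt , mod-trans e′ (mod-*ˡ a (oddSq-mod {w} {+ y} f)))
        (λ y _ _ → let val = a ℤ.* oddSq (+ y) in
          val ℤDM.%ℕ q , ℤDM.n%ℕd<d val q , unitSq-rem q 2∣q (+ y) , mod-sym (mod-rem q val))
        (λ n< n′< _ _ _ _ e e′ → mod-<-≡ n< n′< (mod-trans e (mod-sym e′)))
        (λ {y} {y′} y< y′< _ _ _ _ e e′ → unique y< y′< (T-cancel {+ y} {+ y′} (mod-cancelˡ a (powerLike-^ (3 + f) 2∤a) (mod-trans (mod-sym e) e′)))))
      (cnt-all (λ _ → yes tt) Y (λ _ _ → tt))
      where
      T-cancel : ∀ {w y} → oddSq w ≡ oddSq y [mod q ] → T w ≡ T y [mod 2Y ]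
      T-cancel {w} {y} e = mod-unscale 4 (subst (λ t → + 4 ℤ.* T w ≡ + 4 ℤ.* T y [mod t ]) (sym q≡)
        (∣-⇒mod (subst (+ q ℤ∣.∣_) (lem (+ 4 ℤ.* T w) (+ 4 ℤ.* T y)) (mod⇒∣- e))))
        where
        lem : ∀ x y → + 1 ℤ.+ x ℤ.- (+ 1 ℤ.+ y) ≡ x ℤ.- y
        lem = ℤS.solve-∀

    localCount-8∣ : localCount a q ≡ q * Y + localCount a (2 * 2Y)
    localCount-8∣ = trans (localCount-step (2 * 2Y) (powerLike-^ (3 + f))) (cong (λ t → q * t + localCount a (2 * 2Y)) cnt-unitSq-8∣)

  localCount-2 : localCount a 2 ≡ 3
  localCount-2 = trans (localCount-step 1 (powerLike-^ 1))
    (cong₂ (λ s t → 2 * s + t) (cnt-unitSq-∣4 2 ∣-refl (divides 2 refl)) (localCount-1 a))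

  localCount-4 : localCount a 4 ≡ 7
  localCount-4 = trans (localCount-step 2 (powerLike-^ 2))
    (cong₂ (λ s t → 4 * s + t) (cnt-unitSq-∣4 4 (divides 2 refl) ∣-refl) localCount-2)

  -- From q = 8 on, each step adds q · q / 8, and 12 times this is 2 q² - 2 (q / 2)². The constant
  -- 52 comes from the initial value 7 at q = 4: 12 · 7 = 2 · 16 + 52.
  localCount-2^ : ∀ f .{{_ : NonZero (2 ^ (2 + f))}} → localCount a (2 ^ (2 + f)) * 12 ≡ 2 * (2 ^ (2 + f) * 2 ^ (2 + f)) + 52
  localCount-2^ zero    = cong (_* 12) {localCount a 4} {7} localCount-4
  localCount-2^ (suc f) = begin
    localCount a (2 ^ (3 + f)) * 12                                     ≡⟨ cong (_* 12) (localCount-8∣ f) ⟩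
    (2 ^ (3 + f) * 2 ^ f + R) * 12                                      ≡⟨ *-distribʳ-+ 12 (2 ^ (3 + f) * 2 ^ f) R ⟩
    2 ^ (3 + f) * 2 ^ f * 12 + R * 12                                   ≡⟨ cong (_+_ (2 ^ (3 + f) * 2 ^ f * 12)) (localCount-2^ f {{m^n≢0 2 (2 + f)}}) ⟩
    2 ^ (3 + f) * 2 ^ f * 12 + (2 * (2 ^ (2 + f) * 2 ^ (2 + f)) + 52)   ≡⟨ lem (2 ^ f) ⟩
    2 * (2 ^ (3 + f) * 2 ^ (3 + f)) + 52                                ∎
    where
    open ≡-Reasoning
    R = localCount a (2 ^ (2 + f)) {{m^n≢0 2 (2 + f)}}
    lem : ∀ y → 2 * (2 * (2 * y)) * y * 12 + (2 * (2 * (2 * y) * (2 * (2 * y))) + 52) ≡ 2 * (2 * (2 * (2 * y)) * (2 * (2 * (2 * y)))) + 52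
    lem = ℕS.solve-∀

-- The local densities

toℚᵘ-/ : ∀ i d → ℚ.toℚᵘ (i ℚ./ suc d) ℚᵘ.≃ ℚᵘ.mkℚᵘ i d
toℚᵘ-/ i d = ℚP.toℚᵘ-fromℚᵘ (ℚᵘ.mkℚᵘ i d)

nat-+ : ∀ m n → nat (m + n) ≡ nat m ℚ.+ nat n
nat-+ m n = ℚP.toℚᵘ-injective (begin
  ℚ.toℚᵘ (nat (m + n))                     ≈⟨ toℚᵘ-/ (+ (m + n)) 0 ⟩
  ℚᵘ.mkℚᵘ (+ (m + n)) 0                    ≈⟨ ℚᵘ.*≡* (lem (+ m) (+ n)) ⟩
  ℚᵘ.mkℚᵘ (+ m) 0 ℚᵘ.+ ℚᵘ.mkℚᵘ (+ n) 0     ≈⟨ ℚᵘP.+-cong (ℚᵘP.≃-sym (toℚᵘ-/ (+ m) 0)) (ℚᵘP.≃-sym (toℚᵘ-/ (+ n) 0)) ⟩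
  ℚ.toℚᵘ (nat m) ℚᵘ.+ ℚ.toℚᵘ (nat n)       ≈⟨ ℚᵘP.≃-sym (ℚP.toℚᵘ-homo-+ (nat m) (nat n)) ⟩
  ℚ.toℚᵘ (nat m ℚ.+ nat n)                 ∎)
  where
  open ℚᵘP.≃-Reasoning
  lem : ∀ m n → (m ℤ.+ n) ℤ.* + 1 ≡ (m ℤ.* + 1 ℤ.+ n ℤ.* + 1) ℤ.* + 1
  lem = ℤS.solve-∀

nat-* : ∀ m n → nat (m * n) ≡ nat m ℚ.* nat n
nat-* m n = ℚP.toℚᵘ-injective (begin
  ℚ.toℚᵘ (nat (m * n))                     ≈⟨ toℚᵘ-/ (+ (m * n)) 0 ⟩
  ℚᵘ.mkℚᵘ (+ (m * n)) 0                    ≈⟨ ℚᵘ.*≡* (cong (ℤ._* + 1) (ℤP.pos-* m n)) ⟩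
  ℚᵘ.mkℚᵘ (+ m) 0 ℚᵘ.* ℚᵘ.mkℚᵘ (+ n) 0     ≈⟨ ℚᵘP.*-cong (ℚᵘP.≃-sym (toℚᵘ-/ (+ m) 0)) (ℚᵘP.≃-sym (toℚᵘ-/ (+ n) 0)) ⟩
  ℚ.toℚᵘ (nat m) ℚᵘ.* ℚ.toℚᵘ (nat n)       ≈⟨ ℚᵘP.≃-sym (ℚP.toℚᵘ-homo-* (nat m) (nat n)) ⟩
  ℚ.toℚᵘ (nat m ℚ.* nat n)                 ∎)
  where open ℚᵘP.≃-Reasoning

/-*-nat : ∀ n d .{{_ : NonZero d}} → (+ n ℚ./ d) ℚ.* nat d ≡ nat n
/-*-nat n d@(suc d-1) = ℚP.toℚᵘ-injective (begin
  ℚ.toℚᵘ ((+ n ℚ./ d) ℚ.* nat d)                 ≈⟨ ℚP.toℚᵘ-homo-* (+ n ℚ./ d) (nat d) ⟩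
  ℚ.toℚᵘ (+ n ℚ./ d) ℚᵘ.* ℚ.toℚᵘ (nat d)         ≈⟨ ℚᵘP.*-cong (toℚᵘ-/ (+ n) d-1) (toℚᵘ-/ (+ d) 0) ⟩
  ℚᵘ.mkℚᵘ (+ n) d-1 ℚᵘ.* ℚᵘ.mkℚᵘ (+ d) 0         ≈⟨ ℚᵘ.*≡* (trans (ℤP.*-identityʳ _) (cong (λ t → + n ℤ.* + t) (sym (*-identityʳ d)))) ⟩
  ℚᵘ.mkℚᵘ (+ n) 0                                ≈⟨ ℚᵘP.≃-sym (toℚᵘ-/ (+ n) 0) ⟩
  ℚ.toℚᵘ (nat n)                                 ∎)
  where open ℚᵘP.≃-Reasoning

nat-mono-< : ∀ {m n} → m < n → nat m ℚ.< nat n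
nat-mono-< {m} {n} m<n = ℚP.toℚᵘ-cancel-< (ℚᵘP.<-respˡ-≃ (ℚᵘP.≃-sym (toℚᵘ-/ (+ m) 0)) (ℚᵘP.<-respʳ-≃ (ℚᵘP.≃-sym (toℚᵘ-/ (+ n) 0))
  (ℚᵘ.*<* (subst₂ ℤ._<_ (sym (ℤP.*-identityʳ (+ m))) (sym (ℤP.*-identityʳ (+ n))) (ℤ.+<+ m<n)))))

nat-injective : ∀ {m n} → nat m ≡ nat n → m ≡ n
nat-injective {m} {n} e with <-cmp m n
... | tri< l _ _ = ⊥-elim (ℚP.<-irrefl e (nat-mono-< l))
... | tri≈ _ eq _ = eq
... | tri> _ _ g = ⊥-elim (ℚP.<-irrefl (sym e) (nat-mono-< g))

1/*nat : ∀ d .{{_ : NonZero d}} → (+ 1 ℚ./ d) ℚ.* nat d ≡ 1ℚ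
1/*nat d = /-*-nat 1 d

*-nat-cancel : ∀ d .{{_ : NonZero d}} {x y} → x ℚ.* nat d ≡ y ℚ.* nat d → x ≡ y
*-nat-cancel d {x} {y} e = trans (sym (back x)) (trans (cong (ℚ._* (+ 1 ℚ./ d)) e) (back y))
  where
  back : ∀ x → x ℚ.* nat d ℚ.* (+ 1 ℚ./ d) ≡ x
  back x = trans (ℚP.*-assoc x (nat d) (+ 1 ℚ./ d)) (trans (cong (x ℚ.*_) (trans (ℚP.*-comm (nat d) (+ 1 ℚ./ d)) (1/*nat d))) (ℚP.*-identityʳ x))

invPow-* : ∀ p .{{_ : NonZero p}} a → invPow p a ℚ.* nat (p ^ a) ≡ 1ℚ
invPow-* (suc k) a = 1/*nat (suc k ^ a) {{m^n≢0 (suc k) a}}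

private
  clear-denominators : ∀ X P I J W T → I ℚ.* X ≡ 1ℚ → J ℚ.* W ≡ 1ℚ →
    X ℚ.* ((P ℚ.+ P ℚ.* I ℚ.+ T ℚ.* I) ℚ.* J) ℚ.* W ≡ P ℚ.* X ℚ.+ P ℚ.+ T
  clear-denominators X P I J W T IX JW = trans (lem X P I J W T)
    (trans (cong₂ (λ s t → (P ℚ.* X ℚ.+ P ℚ.* s ℚ.+ T ℚ.* s) ℚ.* t) IX JW) (lem′ X P T))
    where
    open +-*-Solver
    lem : ∀ X P I J W T → X ℚ.* ((P ℚ.+ P ℚ.* I ℚ.+ T ℚ.* I) ℚ.* J) ℚ.* W ≡ (P ℚ.* X ℚ.+ P ℚ.* (I ℚ.* X) ℚ.+ T ℚ.* (I ℚ.* X)) ℚ.* (J ℚ.* W)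
    lem = solve 6 (λ X P I J W T → X :* ((P :+ P :* I :+ T :* I) :* J) :* W := (P :* X :+ P :* (I :* X) :+ T :* (I :* X)) :* (J :* W)) refl
    lem′ : ∀ X P T → (P ℚ.* X ℚ.+ P ℚ.* 1ℚ ℚ.+ T ℚ.* 1ℚ) ℚ.* 1ℚ ≡ P ℚ.* X ℚ.+ P ℚ.+ T
    lem′ = solve 3 (λ X P T → (P :* X :+ P :* con 1ℚ :+ T :* con 1ℚ) :* con 1ℚ := P :* X :+ P :+ T) refl

δodd-* : ∀ p .{{_ : NonZero p}} a → nat (p ^ a) ℚ.* δodd p a ℚ.* nat (2 + (p + p)) ≡ nat (p * p ^ a + p + 2)
δodd-* p a = trans
  (clear-denominators (nat (p ^ a)) (nat p) (invPow p a) (+ 1 ℚ./ (2 + (p + p))) (nat (2 + (p + p))) (nat 2) (invPow-* p a) (1/*nat (2 + (p + p))))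
  (sym (trans (nat-+ (p * p ^ a + p) 2) (cong (ℚ._+ nat 2) (trans (nat-+ (p * p ^ a) p) (cong (ℚ._+ nat p) (nat-* p (p ^ a)))))))

-- 52 = 16 + 32 + 4 collects the coefficients of the three powers of 2 in `δ₂`. The exponent is
-- written 3 + a so that the last clause of `δ₂` reduces.
δ₂-* : ∀ a → nat (2 ^ (3 + a)) ℚ.* δ₂ (3 + a) ℚ.* nat 12 ≡ nat (2 * 2 ^ (3 + a) + 52)
δ₂-* a = trans (clear (nat (2 ^ (3 + a))) (invPow 2 (3 + a)) (+ 1 ℚ./ 12) (nat 12) (invPow-* 2 (3 + a)) (1/*nat 12))
  (sym (trans (nat-+ (2 * 2 ^ (3 + a)) 52) (cong (ℚ._+ nat 52) (nat-* 2 (2 ^ (3 + a))))))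
  where
  open +-*-Solver
  lem : ∀ X I J W A B C E → X ℚ.* ((A ℚ.+ B ℚ.* I ℚ.+ C ℚ.* I ℚ.+ E ℚ.* I) ℚ.* J) ℚ.* W ≡
        (A ℚ.* X ℚ.+ (B ℚ.+ C ℚ.+ E) ℚ.* (I ℚ.* X)) ℚ.* (J ℚ.* W)
  lem = solve 8 (λ X I J W A B C E → X :* ((A :+ B :* I :+ C :* I :+ E :* I) :* J) :* W :=
        (A :* X :+ (B :+ C :+ E) :* (I :* X)) :* (J :* W)) refl
  clear : ∀ X I J W → I ℚ.* X ≡ 1ℚ → J ℚ.* W ≡ 1ℚ →
    X ℚ.* ((nat 2 ℚ.+ nat 16 ℚ.* I ℚ.+ nat 32 ℚ.* I ℚ.+ nat 4 ℚ.* I) ℚ.* J) ℚ.* W ≡ nat 2 ℚ.* X ℚ.+ nat 52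
  clear X I J W IX JW = trans (lem X I J W (nat 2) (nat 16) (nat 32) (nat 4))
    (trans (cong₂ (λ s t → (nat 2 ℚ.* X ℚ.+ nat 52 ℚ.* s) ℚ.* t) IX JW) (ℚP.*-identityʳ _))

δodd-0 : ∀ p .{{_ : NonZero p}} → δodd p 0 ≡ 1ℚ
δodd-0 p = *-nat-cancel (2 + (p + p)) (trans (cong (ℚ._* nat (2 + (p + p))) (sym (ℚP.*-identityˡ (δodd p 0))))
  (trans (δodd-* p 0) (trans (cong nat (lem p)) (sym (ℚP.*-identityˡ (nat (2 + (p + p))))))))
  where
  lem : ∀ p → p * 1 + p + 2 ≡ 2 + (p + p)
  lem = ℕS.solve-∀

δloc-0 : ∀ p → Prime p → δloc p 0 ≡ 1ℚ
δloc-0 0                   p0 = ⊥-elim (¬prime[0] p0)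
δloc-0 1                   p1 = ⊥-elim (¬prime[1] p1)
δloc-0 2                   _  = refl
δloc-0 p@(suc (suc (suc _))) _ = δodd-0 p

-- With X = p^a, the cleared equation at density 1 is (X - 1) (p + 2) = 0.
δodd≡1⇒0 : ∀ p → 1 < p → ∀ a → δodd p a ≡ 1ℚ → a ≡ 0
δodd≡1⇒0 p 1<p zero    _ = refl
δodd≡1⇒0 p@(suc _) 1<p (suc a) e = ⊥-elim (<⇒≢ 1<p^ (sym p^≡1))
  where
  X = p ^ suc a
  eq : p * X + p + 2 ≡ X * (2 + (p + p))
  eq = nat-injective (trans (sym (δodd-* p (suc a))) (trans (cong (λ t → nat X ℚ.* t ℚ.* nat (2 + (p + p))) e)
         (trans (cong (ℚ._* nat (2 + (p + p))) (ℚP.*-identityʳ (nat X))) (sym (nat-* X (2 + (p + p)))))))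
  lem₁ : ∀ p X → p * X + p + 2 ≡ p * X + 1 * (p + 2)
  lem₁ = ℕS.solve-∀
  lem₂ : ∀ p X → X * (2 + (p + p)) ≡ p * X + X * (p + 2)
  lem₂ = ℕS.solve-∀
  p^≡1 : X ≡ 1
  p^≡1 = *-cancelʳ-≡ X 1 (p + 2) {{>-nonZero (s≤s z≤n)}} (sym (+-cancelˡ-≡ (p * X) _ _ (trans (sym (lem₁ p X)) (trans eq (lem₂ p X)))))
  1<p^ : 1 < X
  1<p^ = ≤-trans 1<p (m≤m*n p (p ^ a) {{m^n≢0 p a}})

-- From exponent 3 on, the cleared equation at density 1 becomes 52 = 80 Y for a power Y of 2; the
-- exponents 1 and 2 are excluded by evaluation.
δ₂≡1⇒0 : ∀ a → δ₂ a ≡ 1ℚ → a ≡ 0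
δ₂≡1⇒0 0 _  = refl
δ₂≡1⇒0 1 ()
δ₂≡1⇒0 2 ()
δ₂≡1⇒0 (suc (suc (suc a))) e = ⊥-elim (<⇒≢ 52<80Y (+-cancelˡ-≡ (16 * Y) _ _ (trans (lem₁ Y) (trans eq (lem₂ Y)))))
  where
  Y = 2 ^ a
  X = 2 ^ (3 + a)
  eq : 2 * X + 52 ≡ X * 12
  eq = nat-injective (trans (sym (δ₂-* a)) (trans (cong (λ t → nat X ℚ.* t ℚ.* nat 12) e)
         (trans (cong (ℚ._* nat 12) (ℚP.*-identityʳ (nat X))) (sym (nat-* X 12)))))
  lem₁ : ∀ y → 16 * y + 52 ≡ 2 * (2 * (2 * (2 * y))) + 52
  lem₁ = ℕS.solve-∀
  lem₂ : ∀ y → 2 * (2 * (2 * y)) * 12 ≡ 16 * y + 80 * y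
  lem₂ = ℕS.solve-∀
  52<80Y : 52 < 80 * Y
  52<80Y = ≤-trans (m≤m+n 53 27) (m≤m*n 80 Y {{m^n≢0 2 a}})

δloc≡1⇒0 : ∀ p → Prime p → ∀ a → δloc p a ≡ 1ℚ → a ≡ 0
δloc≡1⇒0 0                   p0 = ⊥-elim (¬prime[0] p0)
δloc≡1⇒0 1                   p1 = ⊥-elim (¬prime[1] p1)
δloc≡1⇒0 2                   _  = δ₂≡1⇒0
δloc≡1⇒0 p@(suc (suc (suc _))) _ = δodd≡1⇒0 p (s≤s (s≤s z≤n))

odd-prime : ∀ k → Prime (3 + k) → ∃ λ r → 3 + k ≡ suc (2 * r)
odd-prime k pp with (3 + k) % 2 | m%n<n (3 + k) 2 | m≡m%n+[m/n]*n (3 + k) 2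
... | 0           | _              | e = ⊥-elim (2∤p (prime⇒irreducible pp (divides ((3 + k) / 2) e)))
  where
  2∤p : ¬ (2 ≡ 1 ⊎ 2 ≡ 3 + k)
  2∤p (inj₁ ())
  2∤p (inj₂ ())
... | 1           | _              | e = (3 + k) / 2 , trans e (cong suc (*-comm ((3 + k) / 2) 2))
... | suc (suc _) | s≤s (s≤s ())   | _

-- The exponent is doubled because the discriminant is b². The condition on `a` is limited to e ≠ 0,
-- since `a` is only known to be prime to b and p divides b only then.
localCount-δ : ∀ a p → Prime p → ∀ e .{{_ : NonZero (p ^ e)}} → (¬ e ≡ 0 → ¬ p ∣ ℤ.∣ a ∣) →
               nat (localCount a (p ^ e)) ≡ nat (p ^ e * p ^ e) ℚ.* δloc p (e + e)
localCount-δ a p pp zero _ = trans (cong nat (localCount-1 a)) (sym (trans (ℚP.*-identityˡ (δloc p 0)) (δloc-0 p pp)))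
localCount-δ a 0 p0 (suc e) _ = ⊥-elim (¬prime[0] p0)
localCount-δ a 1 p1 (suc e) _ = ⊥-elim (¬prime[1] p1)
localCount-δ a 2 _ 1 2∤a = cong nat (EvenPrime.localCount-2 a (2∤a (λ ())))
localCount-δ a 2 _ (suc (suc f)) 2∤a = subst (λ t → nat (localCount a q) ≡ nat (q * q) ℚ.* δ₂ t) (sym e+e)
  (*-nat-cancel 12 (begin
    nat (localCount a q) ℚ.* nat 12               ≡⟨ sym (nat-* (localCount a q) 12) ⟩
    nat (localCount a q * 12)                     ≡⟨ cong nat (EvenPrime.localCount-2^ a (2∤a (λ ())) f) ⟩
    nat (2 * (q * q) + 52)                        ≡⟨ cong (λ t → nat (2 * t + 52)) q² ⟩
    nat (2 * 2 ^ (3 + suc (f + f)) + 52)          ≡⟨ sym (δ₂-* (suc (f + f))) ⟩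
    nat (2 ^ (3 + suc (f + f))) ℚ.* δ₂ (3 + suc (f + f)) ℚ.* nat 12 ≡⟨ cong (λ t → nat t ℚ.* δ₂ (3 + suc (f + f)) ℚ.* nat 12) (sym q²) ⟩
    nat (q * q) ℚ.* δ₂ (3 + suc (f + f)) ℚ.* nat 12 ∎))
  where
  open ≡-Reasoning
  q = 2 ^ (2 + f)
  e+e : 2 + f + (2 + f) ≡ 3 + suc (f + f)
  e+e = lem f
    where
    lem : ∀ f → 2 + f + (2 + f) ≡ 3 + suc (f + f)
    lem = ℕS.solve-∀
  q² : q * q ≡ 2 ^ (3 + suc (f + f))
  q² = trans (sym (^-distribˡ-+-* 2 (2 + f) (2 + f))) (cong (2 ^_) e+e)
localCount-δ a p@(suc (suc (suc k))) pp e@(suc _) p∤a = *-nat-cancel (2 + (p + p)) (begin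
  nat (localCount a q) ℚ.* nat (2 + (p + p))      ≡⟨ sym (nat-* (localCount a q) (2 + (p + p))) ⟩
  nat (localCount a q * (2 + (p + p)))            ≡⟨ cong nat (OddPrime.localCount-odd pp (proj₁ (odd-prime k pp)) (proj₂ (odd-prime k pp)) a (p∤a (λ ())) e) ⟩
  nat (p * (q * q) + p + 2)                       ≡⟨ cong (λ t → nat (p * t + p + 2)) (sym (^-distribˡ-+-* p e e)) ⟩
  nat (p * p ^ (e + e) + p + 2)                   ≡⟨ sym (δodd-* p (e + e)) ⟩
  nat (p ^ (e + e)) ℚ.* δodd p (e + e) ℚ.* nat (2 + (p + p)) ≡⟨ cong (λ t → nat t ℚ.* δodd p (e + e) ℚ.* nat (2 + (p + p))) (^-distribˡ-+-* p e e) ⟩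
  nat (q * q) ℚ.* δodd p (e + e) ℚ.* nat (2 + (p + p)) ∎)
  where
  open ≡-Reasoning
  q = p ^ e

-- Valuations

vGo-spec : ∀ f {p n} → 1 < p → 0 < n → n ≤ f → ∃ λ m → n ≡ p ^ vGo f p n * m × ¬ p ∣ m
vGo-spec zero    _   0<n n≤0 = ⊥-elim (<⇒≱ 0<n n≤0)
vGo-spec (suc f) {p} {suc n} 1<p _ n≤f with p ∣? suc n
... | no p∤  = suc n , sym (+-identityʳ (suc n)) , p∤
... | yes d =
  let instance
        nt : NonTrivial p
        nt = n>1⇒nonTrivial 1<p
        q≢0 : NonZero (quotient d)
        q≢0 = quotient≢0 d
      (m , eq , p∤m) = vGo-spec f {p} {quotient d} 1<p (>-nonZero⁻¹ (quotient d)) (s≤s⁻¹ (≤-trans (quotient-< d) n≤f))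
  in m , trans (_∣_.equality d) (trans (*-comm (quotient d) p) (trans (cong (p *_) eq) (sym (*-assoc p _ m)))) , p∤m

^-*-exponent-unique : ∀ {p} .{{_ : NonZero p}} e f {m n} → ¬ p ∣ m → ¬ p ∣ n → p ^ e * m ≡ p ^ f * n → e ≡ f
^-*-exponent-unique zero    zero    _ _ _ = refl
^-*-exponent-unique {p} zero (suc f) {m} {n} p∤m _ eq =
  ⊥-elim (p∤m (subst (p ∣_) (trans (sym eq) (*-identityˡ m)) (∣m⇒∣m*n n (m∣m*n (p ^ f)))))
^-*-exponent-unique {p} (suc e) zero {m} {n} _ p∤n eq =
  ⊥-elim (p∤n (subst (p ∣_) (trans eq (*-identityˡ n)) (∣m⇒∣m*n m (m∣m*n (p ^ e)))))
^-*-exponent-unique {p} (suc e) (suc f) {m} {n} p∤m p∤n eq = cong suc (^-*-exponent-unique e f p∤m p∤n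
  (*-cancelˡ-≡ _ _ p (trans (sym (*-assoc p (p ^ e) m)) (trans eq (*-assoc p (p ^ f) n)))))

prime>1 : ∀ {p} → Prime p → 1 < p
prime>1 {p} pp = nonTrivial⇒n>1 p {{prime⇒nonTrivial pp}}

v-spec : ∀ {p n} → Prime p → 0 < n → ∃ λ m → n ≡ p ^ v p n * m × ¬ p ∣ m
v-spec {n = n} pp 0<n = vGo-spec n (prime>1 pp) 0<n ≤-refl

0<-factorʳ : ∀ m {n} → 0 < m * n → 0 < n
0<-factorʳ m {zero}  l = ⊥-elim (n≮0 (subst (0 <_) (*-zeroʳ m) l))
0<-factorʳ m {suc n} _ = s≤s z≤n

v-square : ∀ {p b} e {m} → Prime p → 0 < b → b ≡ p ^ e * m → ¬ p ∣ m → v p (b * b) ≡ e + e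
v-square {p} {b} e {m} pp 0<b refl p∤m =
  let (n , eq , p∤n) = v-spec {p} {b * b} pp (*-mono-≤ 0<b 0<b)
  in sym (^-*-exponent-unique (e + e) (v p (b * b)) p∤m² p∤n (trans (trans (cong (_* (m * m)) (^-distribˡ-+-* p e e)) (lem (p ^ e) m)) eq))
  where
  instance
    p≢0 : NonZero p
    p≢0 = prime⇒nonZero pp
  lem : ∀ q m → q * q * (m * m) ≡ q * m * (q * m)
  lem = ℕS.solve-∀
  p∤m² : ¬ p ∣ m * m
  p∤m² d with euclidsLemma m m pp d
  ... | inj₁ x = p∤m x
  ... | inj₂ x = p∤m x

factor-prime : ∀ Δ {p} → Prime p → factor Δ p ≡ δloc p (v p ℤ.∣ Δ ∣)
factor-prime Δ {p} pp with prime? p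
... | yes _ = refl
... | no ¬p = ⊥-elim (¬p pp)

factor-nonprime : ∀ Δ {p} → ¬ Prime p → factor Δ p ≡ 1ℚ
factor-nonprime Δ {p} ¬p with prime? p
... | yes pp = ⊥-elim (¬p pp)
... | no _   = refl

-- The number of local values as a product over primes

no-prime-factor⇒1 : ∀ m .{{_ : NonZero m}} → (∀ {p} → Prime p → ¬ p ∣ m) → m ≡ 1
no-prime-factor⇒1 m none with factorise m
... | record { factors = [] ; isFactorisation = eq } = eq
... | record { factors = p ∷ ps ; isFactorisation = refl ; factorsPrime = pp ∷ _ } = ⊥-elim (none pp (m∣m*n (product ps)))

module _ (a : ℤ) (b : ℕ) .{{_ : NonZero b}} (a⊥b : Coprime ℤ.∣ a ∣ b) (Δ : ℤ) (∣Δ∣≡b² : ℤ.∣ Δ ∣ ≡ b * b) where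

  private
    0<b : 0 < b
    0<b = >-nonZero⁻¹ b

    -- `c` is the part of b made of primes up to z, and `m` is the rest. Induction on z then follows
    -- the recursion of `prodUpTo` factor by factor.
    record Smooth (z : ℕ) : Set where
      constructor smooth
      field
        c m    : ℕ
        b≡cm   : b ≡ c * m
        c-≤    : ∀ {p} → Prime p → p ∣ c → p ≤ z
        m->    : ∀ {p} → Prime p → p ∣ m → z < p
        c≢0    : NonZero c
        count  : nat (localCount a c {{c≢0}}) ≡ nat (c * c) ℚ.* prodUpTo z (factor Δ)

    smooth-step : ∀ z → Smooth z → Dec (Prime (suc z)) → Smooth (suc z)
    smooth-step z (smooth c m b≡cm c-≤ m-> c≢0 count) (no ¬p) = smooth c m b≡cm
      (λ pp d → m≤n⇒m≤1+n (c-≤ pp d))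
      (λ pp d → ≤∧≢⇒< (m-> pp d) (λ { refl → ¬p pp }))
      c≢0
      (trans count (cong (nat (c * c) ℚ.*_) (sym (trans (cong (prodUpTo z (factor Δ) ℚ.*_) (factor-nonprime Δ ¬p)) (ℚP.*-identityʳ _)))))
    smooth-step z (smooth c m b≡cm c-≤ m-> c≢0 count) (yes pp) = smooth (c * p ^ e) m′
      (trans b≡cm (trans (cong (c *_) m≡) (sym (*-assoc c (p ^ e) m′))))
      c′-≤
      (λ qq d → ≤∧≢⇒< (m-> qq (subst (_ ∣_) (sym m≡) (∣n⇒∣m*n (p ^ e) d))) (λ { refl → p∤m′ d }))
      c′≢0
      (begin
        nat (localCount a (c * p ^ e))                                  ≡⟨ cong nat (localCount-* a c (p ^ e) c⊥p^e) ⟩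
        nat (localCount a c * localCount a (p ^ e))                     ≡⟨ nat-* (localCount a c) (localCount a (p ^ e)) ⟩
        nat (localCount a c) ℚ.* nat (localCount a (p ^ e))             ≡⟨ cong₂ ℚ._*_ count (localCount-δ a p pp e p∤a) ⟩
        (nat (c * c) ℚ.* prodUpTo z (factor Δ)) ℚ.* (nat (p ^ e * p ^ e) ℚ.* δloc p (e + e))
                                                                        ≡⟨ interchange (nat (c * c)) _ _ _ ⟩
        (nat (c * c) ℚ.* nat (p ^ e * p ^ e)) ℚ.* (prodUpTo z (factor Δ) ℚ.* δloc p (e + e))
                                                                        ≡⟨ cong₂ ℚ._*_ (sym (nat-* (c * c) (p ^ e * p ^ e))) (cong (prodUpTo z (factor Δ) ℚ.*_) (sym factor≡)) ⟩
        nat (c * c * (p ^ e * p ^ e)) ℚ.* prodUpTo p (factor Δ)         ≡⟨ cong (λ t → nat t ℚ.* prodUpTo p (factor Δ)) (lem c (p ^ e)) ⟩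
        nat (c * p ^ e * (c * p ^ e)) ℚ.* prodUpTo p (factor Δ)         ∎)
      where
      open ≡-Reasoning
      p = suc z
      interchange : ∀ w x y z → (w ℚ.* x) ℚ.* (y ℚ.* z) ≡ (w ℚ.* y) ℚ.* (x ℚ.* z)
      interchange = solve 4 (λ w x y z → (w :* x) :* (y :* z) := (w :* y) :* (x :* z)) refl
        where open +-*-Solver
      lem : ∀ c q → c * c * (q * q) ≡ c * q * (c * q)
      lem = ℕS.solve-∀
      lem′ : ∀ c q m → c * (q * m) ≡ q * (c * m)
      lem′ = ℕS.solve-∀
      e = v p m
      spec = v-spec {p} {m} pp (0<-factorʳ c (subst (0 <_) b≡cm 0<b))
      m′ = proj₁ spec
      m≡ : m ≡ p ^ e * m′
      m≡ = proj₁ (proj₂ spec)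
      p∤m′ : ¬ p ∣ m′
      p∤m′ = proj₂ (proj₂ spec)
      instance
        c≢0′ : NonZero c
        c≢0′ = c≢0
        p^e≢0 : NonZero (p ^ e)
        p^e≢0 = m^n≢0 p e
        c′≢0 : NonZero (c * p ^ e)
        c′≢0 = m*n≢0 c (p ^ e)
      p∤c : ¬ p ∣ c
      p∤c d = <⇒≱ (n<1+n z) (c-≤ pp d)
      c⊥p^e : Coprime c (p ^ e)
      c⊥p^e = Coprime.sym (coprime-^ˡ e (prime∤⇒coprime pp p∤c))
      p∤cm′ : ¬ p ∣ c * m′
      p∤cm′ d with euclidsLemma c m′ pp d
      ... | inj₁ x = p∤c x
      ... | inj₂ x = p∤m′ x
      b≡ : b ≡ p ^ e * (c * m′)
      b≡ = trans b≡cm (trans (cong (c *_) m≡) (lem′ c (p ^ e) m′))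
      factor≡ : factor Δ p ≡ δloc p (e + e)
      factor≡ = trans (factor-prime Δ pp) (cong (δloc p) (trans (cong (v p) ∣Δ∣≡b²) (v-square e pp 0<b b≡ p∤cm′)))
      p∤a : ¬ e ≡ 0 → ¬ p ∣ ℤ.∣ a ∣
      p∤a e≢0 p∣a = ¬prime[1] (subst Prime (a⊥b (p∣a , subst (p ∣_) (sym b≡) (∣m⇒∣m*n (c * m′) (p∣p^ e e≢0)))) pp)
        where
        p∣p^ : ∀ e → ¬ e ≡ 0 → p ∣ p ^ e
        p∣p^ zero    ne = ⊥-elim (ne refl)
        p∣p^ (suc e) _  = m∣m*n (p ^ e)
      c′-≤ : ∀ {q} → Prime q → q ∣ c * p ^ e → q ≤ p
      c′-≤ {q} qq d with euclidsLemma c (p ^ e) qq d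
      ... | inj₁ x = m≤n⇒m≤1+n (c-≤ qq x)
      ... | inj₂ x = ∣⇒≤ (∣p^⇒∣p e x)
        where
        ∣p^⇒∣p : ∀ e → q ∣ p ^ e → q ∣ p
        ∣p^⇒∣p zero    d = ⊥-elim (¬prime[1] (subst Prime (∣1⇒≡1 d) qq))
        ∣p^⇒∣p (suc e) d with euclidsLemma p (p ^ e) qq d
        ... | inj₁ x = x
        ... | inj₂ x = ∣p^⇒∣p e x

    smooth-part : ∀ z → Smooth z
    smooth-part zero = smooth 1 b (sym (*-identityˡ b))
      (λ pp d → ⊥-elim (¬prime[1] (subst Prime (∣1⇒≡1 d) pp)))
      (λ pp _ → <-trans (s≤s z≤n) (prime>1 pp)) _
      (cong nat (localCount-1 a))
    smooth-part (suc z) = smooth-step z (smooth-part z) (prime? (suc z))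

  -- At z = b² the rest `m` has only prime factors above b², yet m ≤ b ≤ b²; so m = 1 and the smooth
  -- part is all of b.
  localCount-density : nat (localCount a b) ≡ nat (b * b) ℚ.* densityFormula Δ
  localCount-density = subst (λ z → nat (localCount a b) ≡ nat (b * b) ℚ.* prodUpTo z (factor Δ)) (sym ∣Δ∣≡b²) (finish (smooth-part (b * b)))
    where
    finish : Smooth (b * b) → nat (localCount a b) ≡ nat (b * b) ℚ.* prodUpTo (b * b) (factor Δ)
    finish (smooth c m b≡cm c-≤ m-> c≢0 count) = subst (λ t → nat t ≡ nat (b * b) ℚ.* prodUpTo (b * b) (factor Δ)) (localCount-cong a {{c≢0}} c≡b)
      (trans count (cong (λ t → nat (t * t) ℚ.* prodUpTo (b * b) (factor Δ)) c≡b))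
      where
      0<m : 0 < m
      0<m = 0<-factorʳ c (subst (0 <_) b≡cm 0<b)
      m≤b² : m ≤ b * b
      m≤b² = ≤-trans (≤-trans (m≤n*m m c {{c≢0}}) (≤-reflexive (sym b≡cm))) (m≤m*n b b)
      m≡1 : m ≡ 1
      m≡1 = no-prime-factor⇒1 m {{>-nonZero 0<m}} (λ pp d → <⇒≱ (m-> pp d) (≤-trans (∣⇒≤ {{>-nonZero 0<m}} d) m≤b²))
      c≡b : c ≡ b
      c≡b = trans (sym (*-identityʳ c)) (trans (cong (c *_) (sym m≡1)) (sym b≡cm))

v-even : ∀ {b p} → 0 < b → Prime p → 2 ∣ v p (b * b)
v-even {b} {p} 0<b pp =
  let (m , eq , p∤m) = v-spec pp 0<b
  in divides (v p b) (trans (v-square (v p b) pp 0<b eq p∤m) (trans (cong (_+_ (v p b)) (sym (+-identityʳ (v p b)))) (*-comm 2 (v p b))))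

factor≡1⇔v≡0 : ∀ Δ {p} → Prime p → (factor Δ p ≡ 1ℚ) ⇔ (v p ℤ.∣ Δ ∣ ≡ 0)
factor≡1⇔v≡0 Δ {p} pp = mk⇔
  (λ e → δloc≡1⇒0 p pp _ (trans (sym (factor-prime Δ pp)) e))
  (λ e → trans (factor-prime Δ pp) (trans (cong (δloc p) e) (δloc-0 p pp)))

-- Reduction to x (a x + b y)

abs-multiple : ∀ i → ∃ λ σ → + ℤ.∣ i ∣ ≡ σ ℤ.* i
abs-multiple i@(+ n)      = + 1 , sym (ℤP.*-identityˡ i)
abs-multiple i@(-[1+ n ]) = ℤ.- (+ 1) , sym (ℤP.-1*i≡-i i)

abstract

  bézoutℤ : ∀ {i j} → Coprime ℤ.∣ i ∣ ℤ.∣ j ∣ → ∃₂ λ s t → i ℤ.* s ℤ.+ j ℤ.* t ≡ + 1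
  bézoutℤ {i} {j} i⊥j =
    let (u , w , e) = bézout i⊥j
        (σ , ∣i∣≡) = abs-multiple i
        (τ , ∣j∣≡) = abs-multiple j
    in u ℤ.* σ , w ℤ.* τ , trans (lem i j u w σ τ) (trans (cong₂ (λ s t → u ℤ.* s ℤ.+ w ℤ.* t) (sym ∣i∣≡) (sym ∣j∣≡)) e)
    where
    lem : ∀ i j u w σ τ → i ℤ.* (u ℤ.* σ) ℤ.+ j ℤ.* (w ℤ.* τ) ≡ u ℤ.* (σ ℤ.* i) ℤ.+ w ℤ.* (τ ℤ.* j)
    lem = ℤS.solve-∀

  divide-gcd : ∀ i j → ¬ j ≡ + 0 → ∃ λ g → ¬ g ≡ + 0 × ∃₂ λ i′ j′ → i ≡ i′ ℤ.* g × (j ≡ j′ ℤ.* g) × Coprime ℤ.∣ i′ ∣ ℤ.∣ j′ ∣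
  divide-gcd i j j≢0 =
    + g , (λ g≡0 → ≢-nonZero⁻¹ g (ℤP.+-injective g≡0)) , i′ , j′ , i≡ , j≡ ,
    subst₂ Coprime (abs-quotient i i′ i≡) (abs-quotient j j′ j≡) (Coprime.coprime-/gcd ℤ.∣ i ∣ ℤ.∣ j ∣)
    where
    g : ℕ
    g = gcd ℤ.∣ i ∣ ℤ.∣ j ∣
    instance
      g≢0 : NonZero g
      g≢0 = ≢-nonZero (gcd[m,n]≢0 ℤ.∣ i ∣ ℤ.∣ j ∣ (inj₂ (j≢0 ∘ ℤP.∣i∣≡0⇒i≡0)))
    g∣i : + g ℤ∣.∣ i
    g∣i = ℤ∣.∣ᵤ⇒∣ (gcd[m,n]∣m ℤ.∣ i ∣ ℤ.∣ j ∣)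
    g∣j : + g ℤ∣.∣ j
    g∣j = ℤ∣.∣ᵤ⇒∣ (gcd[m,n]∣n ℤ.∣ i ∣ ℤ.∣ j ∣)
    i′ j′ : ℤ
    i′ = ℤ∣._∣_.quotient g∣i
    j′ = ℤ∣._∣_.quotient g∣j
    i≡ : i ≡ i′ ℤ.* + g
    i≡ = ℤ∣._∣_.equality g∣i
    j≡ : j ≡ j′ ℤ.* + g
    j≡ = ℤ∣._∣_.equality g∣j
    abs-quotient : ∀ k k′ → k ≡ k′ ℤ.* + g → ℤ.∣ k ∣ / g ≡ ℤ.∣ k′ ∣
    abs-quotient k k′ k≡ = trans (cong (_/ g) (trans (cong ℤ.∣_∣ k≡) (ℤP.abs-* k′ (+ g)))) (m*n/n≡m ℤ.∣ k′ ∣ g)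

*-cancel-0 : ∀ g x → ¬ g ≡ + 0 → g ℤ.* x ≡ + 0 → x ≡ + 0
*-cancel-0 g x g≢0 e with ℤP.i*j≡0⇒i≡0∨j≡0 g e
... | inj₁ g≡0 = ⊥-elim (g≢0 g≡0)
... | inj₂ x≡0 = x≡0

-- With d² the discriminant, (B + d , - 2 A) is isotropic. Dividing by the gcd and completing to a
-- basis of ℤ² turns the form into x (a x + d y).
module Reduction (A B C d : ℤ) (d²≡ : disc A B C ≡ d ℤ.* d) (B+d≢0 : ¬ B ℤ.+ d ≡ + 0) where

  private
    primitive-vector = divide-gcd (+ 2 ℤ.* A) (B ℤ.+ d) B+d≢0
    g = proj₁ primitive-vector
    g≢0 = proj₁ (proj₂ primitive-vector)
    α = proj₁ (proj₂ (proj₂ primitive-vector))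
    β = proj₁ (proj₂ (proj₂ (proj₂ primitive-vector)))
    2A≡ : + 2 ℤ.* A ≡ α ℤ.* g
    2A≡ = proj₁ (proj₂ (proj₂ (proj₂ (proj₂ primitive-vector))))
    B+d≡ : B ℤ.+ d ≡ β ℤ.* g
    B+d≡ = proj₁ (proj₂ (proj₂ (proj₂ (proj₂ (proj₂ primitive-vector)))))
    complement = bézoutℤ {α} {β} (proj₂ (proj₂ (proj₂ (proj₂ (proj₂ (proj₂ primitive-vector))))))
    s = proj₁ complement
    t = proj₁ (proj₂ complement)
    αs+βt≡1 : α ℤ.* s ℤ.+ β ℤ.* t ≡ + 1
    αs+βt≡1 = proj₂ (proj₂ complement)

    4AC≡ : + 4 ℤ.* A ℤ.* C ≡ B ℤ.* B ℤ.- d ℤ.* d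
    4AC≡ = trans (lem (B ℤ.* B) (+ 4 ℤ.* A ℤ.* C)) (cong (ℤ._-_ (B ℤ.* B)) d²≡)
      where
      lem : ∀ x y → y ≡ x ℤ.- (x ℤ.- y)
      lem = ℤS.solve-∀

    -- Multiplied by g², the left side is the value of the form at (B + d, -2 A), namely A (d² - B²
    -- + 4 A C).
    isotropic : A ℤ.* β ℤ.* β ℤ.- B ℤ.* β ℤ.* α ℤ.+ C ℤ.* α ℤ.* α ≡ + 0
    isotropic = *-cancel-0 g _ g≢0 (*-cancel-0 g _ g≢0 (begin
      g ℤ.* (g ℤ.* (A ℤ.* β ℤ.* β ℤ.- B ℤ.* β ℤ.* α ℤ.+ C ℤ.* α ℤ.* α))
        ≡⟨ lem₁ g A B C α β ⟩
      A ℤ.* (β ℤ.* g) ℤ.* (β ℤ.* g) ℤ.- B ℤ.* (β ℤ.* g) ℤ.* (α ℤ.* g) ℤ.+ C ℤ.* (α ℤ.* g) ℤ.* (α ℤ.* g)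
        ≡⟨ cong₂ (λ x y → A ℤ.* x ℤ.* x ℤ.- B ℤ.* x ℤ.* y ℤ.+ C ℤ.* y ℤ.* y) (sym B+d≡) (sym 2A≡) ⟩
      A ℤ.* (B ℤ.+ d) ℤ.* (B ℤ.+ d) ℤ.- B ℤ.* (B ℤ.+ d) ℤ.* (+ 2 ℤ.* A) ℤ.+ C ℤ.* (+ 2 ℤ.* A) ℤ.* (+ 2 ℤ.* A)
        ≡⟨ lem₂ A B C d ⟩
      A ℤ.* (d ℤ.* d ℤ.- B ℤ.* B ℤ.+ + 4 ℤ.* A ℤ.* C)
        ≡⟨ cong (λ x → A ℤ.* (d ℤ.* d ℤ.- B ℤ.* B ℤ.+ x)) 4AC≡ ⟩
      A ℤ.* (d ℤ.* d ℤ.- B ℤ.* B ℤ.+ (B ℤ.* B ℤ.- d ℤ.* d))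
        ≡⟨ lem₃ A B d ⟩
      + 0 ∎))
      where
      open ≡-Reasoning
      lem₁ : ∀ g A B C α β → g ℤ.* (g ℤ.* (A ℤ.* β ℤ.* β ℤ.- B ℤ.* β ℤ.* α ℤ.+ C ℤ.* α ℤ.* α)) ≡
        A ℤ.* (β ℤ.* g) ℤ.* (β ℤ.* g) ℤ.- B ℤ.* (β ℤ.* g) ℤ.* (α ℤ.* g) ℤ.+ C ℤ.* (α ℤ.* g) ℤ.* (α ℤ.* g)
      lem₁ = ℤS.solve-∀
      lem₂ : ∀ A B C d → A ℤ.* (B ℤ.+ d) ℤ.* (B ℤ.+ d) ℤ.- B ℤ.* (B ℤ.+ d) ℤ.* (+ 2 ℤ.* A) ℤ.+ C ℤ.* (+ 2 ℤ.* A) ℤ.* (+ 2 ℤ.* A) ≡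
        A ℤ.* (d ℤ.* d ℤ.- B ℤ.* B ℤ.+ + 4 ℤ.* A ℤ.* C)
      lem₂ = ℤS.solve-∀
      lem₃ : ∀ A B d → A ℤ.* (d ℤ.* d ℤ.- B ℤ.* B ℤ.+ (B ℤ.* B ℤ.- d ℤ.* d)) ≡ + 0
      lem₃ = ℤS.solve-∀

    M = + 2 ℤ.* A ℤ.* s ℤ.* β ℤ.+ B ℤ.* (t ℤ.* β ℤ.- s ℤ.* α) ℤ.- + 2 ℤ.* C ℤ.* t ℤ.* α

    -- `M` is the mixed coefficient in the basis (s, t), (β, -α). The determinant is -1 and the last
    -- coefficient vanishes, so M² = d² is to be expected; the sign follows from g M = d (2 A s + (B
    -- + d) t) = d g (α s + β t).
    polar : M ≡ d
    polar = ℤP.i-j≡0⇒i≡j M d (*-cancel-0 g _ g≢0 (begin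
      g ℤ.* (M ℤ.- d)
        ≡⟨ lem₁ g A B C α β s t d ⟩
      (+ 2 ℤ.* A ℤ.* (β ℤ.* g) ℤ.- B ℤ.* (α ℤ.* g)) ℤ.* s ℤ.+ (B ℤ.* (β ℤ.* g) ℤ.- + 2 ℤ.* C ℤ.* (α ℤ.* g)) ℤ.* t ℤ.- d ℤ.* (g ℤ.* + 1)
        ≡⟨ cong₂ (λ x y → (+ 2 ℤ.* A ℤ.* x ℤ.- B ℤ.* y) ℤ.* s ℤ.+ (B ℤ.* x ℤ.- + 2 ℤ.* C ℤ.* y) ℤ.* t ℤ.- d ℤ.* (g ℤ.* + 1)) (sym B+d≡) (sym 2A≡) ⟩
      (+ 2 ℤ.* A ℤ.* (B ℤ.+ d) ℤ.- B ℤ.* (+ 2 ℤ.* A)) ℤ.* s ℤ.+ (B ℤ.* (B ℤ.+ d) ℤ.- + 2 ℤ.* C ℤ.* (+ 2 ℤ.* A)) ℤ.* t ℤ.- d ℤ.* (g ℤ.* + 1)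
        ≡⟨ lem₂ g A B C d s t ⟩
      d ℤ.* (+ 2 ℤ.* A) ℤ.* s ℤ.+ (B ℤ.* (B ℤ.+ d) ℤ.- + 4 ℤ.* A ℤ.* C) ℤ.* t ℤ.- d ℤ.* (g ℤ.* + 1)
        ≡⟨ cong₂ (λ x y → d ℤ.* (+ 2 ℤ.* A) ℤ.* s ℤ.+ (B ℤ.* (B ℤ.+ d) ℤ.- x) ℤ.* t ℤ.- d ℤ.* (g ℤ.* y)) 4AC≡ (sym αs+βt≡1) ⟩
      d ℤ.* (+ 2 ℤ.* A) ℤ.* s ℤ.+ (B ℤ.* (B ℤ.+ d) ℤ.- (B ℤ.* B ℤ.- d ℤ.* d)) ℤ.* t ℤ.- d ℤ.* (g ℤ.* (α ℤ.* s ℤ.+ β ℤ.* t))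
        ≡⟨ lem₃ g A B α β s t d ⟩
      d ℤ.* ((+ 2 ℤ.* A ℤ.- α ℤ.* g) ℤ.* s ℤ.+ (B ℤ.+ d ℤ.- β ℤ.* g) ℤ.* t)
        ≡⟨ cong₂ (λ x y → d ℤ.* ((x ℤ.- α ℤ.* g) ℤ.* s ℤ.+ (y ℤ.- β ℤ.* g) ℤ.* t)) 2A≡ B+d≡ ⟩
      d ℤ.* ((α ℤ.* g ℤ.- α ℤ.* g) ℤ.* s ℤ.+ (β ℤ.* g ℤ.- β ℤ.* g) ℤ.* t)
        ≡⟨ lem₄ g α β s t d ⟩
      + 0 ∎))
      where
      open ≡-Reasoning
      lem₁ : ∀ g A B C α β s t d →
        g ℤ.* (+ 2 ℤ.* A ℤ.* s ℤ.* β ℤ.+ B ℤ.* (t ℤ.* β ℤ.- s ℤ.* α) ℤ.- + 2 ℤ.* C ℤ.* t ℤ.* α ℤ.- d) ≡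
        (+ 2 ℤ.* A ℤ.* (β ℤ.* g) ℤ.- B ℤ.* (α ℤ.* g)) ℤ.* s ℤ.+ (B ℤ.* (β ℤ.* g) ℤ.- + 2 ℤ.* C ℤ.* (α ℤ.* g)) ℤ.* t ℤ.- d ℤ.* (g ℤ.* + 1)
      lem₁ = ℤS.solve-∀
      lem₂ : ∀ g A B C d s t →
        (+ 2 ℤ.* A ℤ.* (B ℤ.+ d) ℤ.- B ℤ.* (+ 2 ℤ.* A)) ℤ.* s ℤ.+ (B ℤ.* (B ℤ.+ d) ℤ.- + 2 ℤ.* C ℤ.* (+ 2 ℤ.* A)) ℤ.* t ℤ.- d ℤ.* (g ℤ.* + 1) ≡
        d ℤ.* (+ 2 ℤ.* A) ℤ.* s ℤ.+ (B ℤ.* (B ℤ.+ d) ℤ.- + 4 ℤ.* A ℤ.* C) ℤ.* t ℤ.- d ℤ.* (g ℤ.* + 1)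
      lem₂ = ℤS.solve-∀
      lem₃ : ∀ g A B α β s t d →
        d ℤ.* (+ 2 ℤ.* A) ℤ.* s ℤ.+ (B ℤ.* (B ℤ.+ d) ℤ.- (B ℤ.* B ℤ.- d ℤ.* d)) ℤ.* t ℤ.- d ℤ.* (g ℤ.* (α ℤ.* s ℤ.+ β ℤ.* t)) ≡
        d ℤ.* ((+ 2 ℤ.* A ℤ.- α ℤ.* g) ℤ.* s ℤ.+ (B ℤ.+ d ℤ.- β ℤ.* g) ℤ.* t)
      lem₃ = ℤS.solve-∀
      lem₄ : ∀ g α β s t d → d ℤ.* ((α ℤ.* g ℤ.- α ℤ.* g) ℤ.* s ℤ.+ (β ℤ.* g ℤ.- β ℤ.* g) ℤ.* t) ≡ + 0
      lem₄ = ℤS.solve-∀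

  lead : ℤ
  lead = form A B C s t

  form-in-basis : ∀ x y → form A B C (x ℤ.* s ℤ.+ y ℤ.* β) (x ℤ.* t ℤ.- y ℤ.* α) ≡ x ℤ.* (lead ℤ.* x ℤ.+ y ℤ.* d)
  form-in-basis x y = trans (expand A B C s t α β x y) (trans
    (cong₂ (λ m i → x ℤ.* (lead ℤ.* x ℤ.+ y ℤ.* m) ℤ.+ y ℤ.* y ℤ.* i) polar isotropic) (lem (x ℤ.* (lead ℤ.* x ℤ.+ y ℤ.* d)) y))
    where
    expand : ∀ A B C s t α β x y →
      A ℤ.* (x ℤ.* s ℤ.+ y ℤ.* β) ℤ.* (x ℤ.* s ℤ.+ y ℤ.* β) ℤ.+ B ℤ.* (x ℤ.* s ℤ.+ y ℤ.* β) ℤ.* (x ℤ.* t ℤ.- y ℤ.* α) ℤ.+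
        C ℤ.* (x ℤ.* t ℤ.- y ℤ.* α) ℤ.* (x ℤ.* t ℤ.- y ℤ.* α) ≡
      x ℤ.* ((A ℤ.* s ℤ.* s ℤ.+ B ℤ.* s ℤ.* t ℤ.+ C ℤ.* t ℤ.* t) ℤ.* x ℤ.+
        y ℤ.* (+ 2 ℤ.* A ℤ.* s ℤ.* β ℤ.+ B ℤ.* (t ℤ.* β ℤ.- s ℤ.* α) ℤ.- + 2 ℤ.* C ℤ.* t ℤ.* α)) ℤ.+
        y ℤ.* y ℤ.* (A ℤ.* β ℤ.* β ℤ.- B ℤ.* β ℤ.* α ℤ.+ C ℤ.* α ℤ.* α)
    expand = ℤS.solve-∀
    lem : ∀ w y → w ℤ.+ y ℤ.* y ℤ.* + 0 ≡ w
    lem = ℤS.solve-∀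

  -- x and y are the coordinates of (t₁, t₂) in the new basis, by Cramer's rule and α s + β t = 1.
  form-coordinates : ∀ t₁ t₂ → let x = α ℤ.* t₁ ℤ.+ β ℤ.* t₂ ; y = t ℤ.* t₁ ℤ.- s ℤ.* t₂ in
                     form A B C t₁ t₂ ≡ x ℤ.* (lead ℤ.* x ℤ.+ y ℤ.* d)
  form-coordinates t₁ t₂ = trans (sym (cong₂ (form A B C) (back (lem₁ α β s t t₁ t₂)) (back (lem₂ α β s t t₁ t₂)))) (form-in-basis (α ℤ.* t₁ ℤ.+ β ℤ.* t₂) (t ℤ.* t₁ ℤ.- s ℤ.* t₂))
    where
    lem₁ : ∀ α β s t t₁ t₂ → (α ℤ.* t₁ ℤ.+ β ℤ.* t₂) ℤ.* s ℤ.+ (t ℤ.* t₁ ℤ.- s ℤ.* t₂) ℤ.* β ≡ (α ℤ.* s ℤ.+ β ℤ.* t) ℤ.* t₁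
    lem₁ = ℤS.solve-∀
    lem₂ : ∀ α β s t t₁ t₂ → (α ℤ.* t₁ ℤ.+ β ℤ.* t₂) ℤ.* t ℤ.- (t ℤ.* t₁ ℤ.- s ℤ.* t₂) ℤ.* α ≡ (α ℤ.* s ℤ.+ β ℤ.* t) ℤ.* t₂
    lem₂ = ℤS.solve-∀
    back : ∀ {u w} → u ≡ (α ℤ.* s ℤ.+ β ℤ.* t) ℤ.* w → u ≡ w
    back {w = w} e = trans e (trans (cong (ℤ._* w) αs+βt≡1) (ℤP.*-identityˡ w))

  form⇒rep : ∀ {n} → (∃₂ λ t₁ t₂ → form A B C t₁ t₂ ≡ n) → Rep lead ℤ.∣ d ∣ n
  form⇒rep (t₁ , t₂ , refl) =
    let x = α ℤ.* t₁ ℤ.+ β ℤ.* t₂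
        y = t ℤ.* t₁ ℤ.- s ℤ.* t₂
    in x , lead ℤ.* x ℤ.+ y ℤ.* d , sym (form-coordinates t₁ t₂) ,
       ∣-⇒mod (ℤ∣.∣-trans (ℤ∣.∣m∣∣m {d}) (ℤ∣.divides y (lem (lead ℤ.* x) (y ℤ.* d))))
    where
    lem : ∀ u w → u ℤ.+ w ℤ.- u ≡ w
    lem = ℤS.solve-∀

  rep⇒form : ∀ {n} → Rep lead ℤ.∣ d ∣ n → ∃₂ λ t₁ t₂ → form A B C t₁ t₂ ≡ n
  rep⇒form (x , z , refl , f) with ℤ∣.∣-trans (ℤ∣.m∣∣m∣ {d}) (mod⇒∣- f)
  ... | ℤ∣.divides y e = x ℤ.* s ℤ.+ y ℤ.* β , x ℤ.* t ℤ.- y ℤ.* α ,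
    trans (form-in-basis x y) (cong (x ℤ.*_) (trans (cong (ℤ._+_ (lead ℤ.* x)) (sym e)) (lem (lead ℤ.* x) z)))
    where
    lem : ∀ u w → u ℤ.+ (w ℤ.- u) ≡ w
    lem = ℤS.solve-∀

  -- A common divisor of `lead` and d divides every value of the form, hence A = f(1, 0), C = f(0,
  -- 1) and B = f(1, 1) - A - C.
  lead-coprime : Primitive A B C → Coprime ℤ.∣ lead ∣ ℤ.∣ d ∣
  lead-coprime prim {k} (k∣a , k∣d) = ∣1⇒≡1 (subst (k ∣_) prim
    (gcd-greatest (gcd-greatest (ℤ∣.∣⇒∣ᵤ {+ k} k∣A) (ℤ∣.∣⇒∣ᵤ {+ k} k∣B)) (ℤ∣.∣⇒∣ᵤ {+ k} k∣C)))
    where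
    k∣form : ∀ t₁ t₂ → + k ℤ∣.∣ form A B C t₁ t₂
    k∣form t₁ t₂ = subst (+ k ℤ∣.∣_) (sym (form-coordinates t₁ t₂))
      (ℤ∣.∣n⇒∣m*n (α ℤ.* t₁ ℤ.+ β ℤ.* t₂) (ℤ∣.∣m∣n⇒∣m+n (ℤ∣.∣m⇒∣m*n {+ k} {lead} (α ℤ.* t₁ ℤ.+ β ℤ.* t₂) (ℤ∣.∣ᵤ⇒∣ k∣a)) (ℤ∣.∣n⇒∣m*n {+ k} (t ℤ.* t₁ ℤ.- s ℤ.* t₂) {d} (ℤ∣.∣ᵤ⇒∣ k∣d))))
    at10 : ∀ A B C → A ℤ.* + 1 ℤ.* + 1 ℤ.+ B ℤ.* + 1 ℤ.* + 0 ℤ.+ C ℤ.* + 0 ℤ.* + 0 ≡ A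
    at10 = ℤS.solve-∀
    at01 : ∀ A B C → A ℤ.* + 0 ℤ.* + 0 ℤ.+ B ℤ.* + 0 ℤ.* + 1 ℤ.+ C ℤ.* + 1 ℤ.* + 1 ≡ C
    at01 = ℤS.solve-∀
    at11 : ∀ A B C → A ℤ.* + 1 ℤ.* + 1 ℤ.+ B ℤ.* + 1 ℤ.* + 1 ℤ.+ C ℤ.* + 1 ℤ.* + 1 ℤ.- (A ℤ.+ C) ≡ B
    at11 = ℤS.solve-∀
    k∣A = subst (+ k ℤ∣.∣_) (at10 A B C) (k∣form (+ 1) (+ 0))
    k∣C = subst (+ k ℤ∣.∣_) (at01 A B C) (k∣form (+ 0) (+ 1))
    k∣B = subst (+ k ℤ∣.∣_) (at11 A B C) (ℤ∣.∣m∣n⇒∣m-n (k∣form (+ 1) (+ 1)) (ℤ∣.∣m∣n⇒∣m+n k∣A k∣C))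

record ReducedForm (A B C : ℤ) (b : ℕ) : Set where
  field
    a       : ℤ
    coprime : Coprime ℤ.∣ a ∣ b
    to      : ∀ {n} → (∃₂ λ t₁ t₂ → form A B C t₁ t₂ ≡ n) → Rep a b n
    from    : ∀ {n} → Rep a b n → ∃₂ λ t₁ t₂ → form A B C t₁ t₂ ≡ n

reduce-with : ∀ A B C d → disc A B C ≡ d ℤ.* d → ¬ B ℤ.+ d ≡ + 0 → Primitive A B C → ReducedForm A B C ℤ.∣ d ∣
reduce-with A B C d d²≡ B+d≢0 prim = record { a = lead ; coprime = lead-coprime prim ; to = form⇒rep ; from = rep⇒form }
  where open Reduction A B C d d²≡ B+d≢0

-- Either square root of the discriminant may serve as d. B + b and B - b differ by 2 b, so one of
-- them is nonzero.
reduce-form : ∀ A B C b → Primitive A B C → 0 < b → disc A B C ≡ + b ℤ.* + b → ReducedForm A B C b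
reduce-form A B C b@(suc b-1) prim _ disc≡ with B ℤ.+ + b ℤP.≟ + 0
... | no B+b≢0  = reduce-with A B C (+ b) disc≡ B+b≢0 prim
... | yes B+b≡0 = reduce-with A B C (ℤ.- (+ b)) (trans disc≡ (neg-sq (+ b))) B-b≢0 prim
  where
  neg-sq : ∀ b → b ℤ.* b ≡ ℤ.- b ℤ.* ℤ.- b
  neg-sq = ℤS.solve-∀
  lem : ∀ B b → b ℤ.+ b ≡ B ℤ.+ b ℤ.- (B ℤ.+ ℤ.- b)
  lem = ℤS.solve-∀
  2b≢0 : ¬ + b ℤ.+ + b ≡ + 0
  2b≢0 ()
  B-b≢0 : ¬ B ℤ.+ ℤ.- (+ b) ≡ + 0
  B-b≢0 e = 2b≢0 (trans (lem B (+ b)) (cong₂ ℤ._-_ B+b≡0 e))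

-- Counting represented integers

abstract

  -- For n ≠ 0 both factors are bounded by the absolute value of n, so finitely many pairs with all
  -- sign choices need to be tried.
  rep? : ∀ a b n → ¬ n ≡ + 0 → Dec (Rep a b n)
  rep? a b n n≢0 = map′ sound complete
    (anyUpTo? (λ d → anyUpTo? (λ e → (at? (+ d) (+ e) ⊎-dec at? (+ d) (ℤ.- (+ e))) ⊎-dec (at? (ℤ.- (+ d)) (+ e) ⊎-dec at? (ℤ.- (+ d)) (ℤ.- (+ e)))) N) N)
    where
    N : ℕ
    N = suc ℤ.∣ n ∣
    At : ℤ → ℤ → Set
    At x z = (x ℤ.* z ≡ n) × z ≡ a ℤ.* x [mod b ]
    at? : ∀ x z → Dec (At x z)
    at? x z = (x ℤ.* z ℤP.≟ n) ×-dec mod? b z (a ℤ.* x)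
    Signs : ℕ → ℕ → Set
    Signs d e = (At (+ d) (+ e) ⊎ At (+ d) (ℤ.- (+ e))) ⊎ (At (ℤ.- (+ d)) (+ e) ⊎ At (ℤ.- (+ d)) (ℤ.- (+ e)))
    sound : (∃ λ d → d < N × ∃ λ e → e < N × Signs d e) → Rep a b n
    sound (d , _ , e , _ , inj₁ (inj₁ p)) = + d , + e , p
    sound (d , _ , e , _ , inj₁ (inj₂ p)) = + d , ℤ.- (+ e) , p
    sound (d , _ , e , _ , inj₂ (inj₁ p)) = ℤ.- (+ d) , + e , p
    sound (d , _ , e , _ , inj₂ (inj₂ p)) = ℤ.- (+ d) , ℤ.- (+ e) , p
    sign : ∀ x → x ≡ + ℤ.∣ x ∣ ⊎ x ≡ ℤ.- (+ ℤ.∣ x ∣)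
    sign (+ _)      = inj₁ refl
    sign (-[1+ _ ]) = inj₂ refl
    complete : Rep a b n → ∃ λ d → d < N × ∃ λ e → e < N × Signs d e
    complete (x , z , e , f) =
      ℤ.∣ x ∣ , s≤s (∣⇒≤ (divides ℤ.∣ z ∣ (trans abs≡ (*-comm ℤ.∣ x ∣ ℤ.∣ z ∣)))) ,
      ℤ.∣ z ∣ , s≤s (∣⇒≤ (divides ℤ.∣ x ∣ abs≡)) , signs (sign x) (sign z)
      where
      instance
        ∣n∣≢0 : NonZero ℤ.∣ n ∣
        ∣n∣≢0 = ≢-nonZero (n≢0 ∘ ℤP.∣i∣≡0⇒i≡0)
      abs≡ : ℤ.∣ n ∣ ≡ ℤ.∣ x ∣ * ℤ.∣ z ∣
      abs≡ = trans (cong ℤ.∣_∣ (sym e)) (ℤP.abs-* x z)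
      signs : x ≡ + ℤ.∣ x ∣ ⊎ x ≡ ℤ.- (+ ℤ.∣ x ∣) → z ≡ + ℤ.∣ z ∣ ⊎ z ≡ ℤ.- (+ ℤ.∣ z ∣) → Signs ℤ.∣ x ∣ ℤ.∣ z ∣
      signs (inj₁ p) (inj₁ q) = inj₁ (inj₁ (subst₂ At p q (e , f)))
      signs (inj₁ p) (inj₂ q) = inj₁ (inj₂ (subst₂ At p q (e , f)))
      signs (inj₂ p) (inj₁ q) = inj₂ (inj₁ (subst₂ At p q (e , f)))
      signs (inj₂ p) (inj₂ q) = inj₂ (inj₂ (subst₂ At p q (e , f)))

rep-neg : ∀ {a b n} → Rep a b n → Rep (ℤ.- a) b (ℤ.- n)
rep-neg {a} {b} (x , z , refl , f) = x , ℤ.- z , sym (ℤP.neg-distribʳ-* x z) ,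
  subst₂ (λ s t → s ≡ t [mod b ]) (ℤP.-1*i≡-i z) (lem a x) (mod-*ˡ (ℤ.- (+ 1)) f)
  where
  lem : ∀ a x → ℤ.- (+ 1) ℤ.* (a ℤ.* x) ≡ ℤ.- a ℤ.* x
  lem = ℤS.solve-∀

PosRep : ℤ → ℕ → ℕ → Set
PosRep a b k = ¬ k ≡ 0 × Rep a b (+ k)

abstract

  posRep? : ∀ a b → Decidable (PosRep a b)
  posRep? a b zero      = no λ (k≢0 , _) → k≢0 refl
  posRep? a b k@(suc _) = map′ (λ r → (λ ()) , r) proj₂ (rep? a b (+ k) (λ ()))

cnt-≟0 : ∀ n → cnt (_≟ 0) n ≤ 1
cnt-≟0 n = cnt-inj {𝓠 = λ _ → ⊤} (_≟ 0) (λ _ → yes tt) _≡_ n 1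
  (λ k _ k≡0 → 0 , s≤s z≤n , tt , k≡0) (λ _ _ k≡0 k′≡0 _ _ _ _ → trans k≡0 (sym k′≡0))

module _ (a : ℤ) (b : ℕ) .{{_ : NonZero b}} where

  private
    Q = b * b
    R = localCount a b
    instance
      Q≢0 : NonZero Q
      Q≢0 = m*n≢0 b b
    L? : Decidable (λ k → Loc a b (+ k))
    L? k = loc? a b (+ k)
    P? = posRep? a b

  -- In fractions: c / N < R / Q + 1 / d. The threshold absorbs the incomplete period and the shift
  -- from N to `suc N`, at most R (Q + 1) in all.
  cnt-rep-upper : ∀ d → ∃ λ N₀ → ∀ N → N₀ ≤ N → cnt P? (suc N) * Q * d < R * N * d + N * Q
  cnt-rep-upper d = suc (R * suc Q * d) , λ N N≥ → begin-strict
    cnt P? (suc N) * Q * d                          ≤⟨ *-monoˡ-≤ d (*-monoˡ-≤ Q (cnt-⊆ P? L? (suc N) (λ k _ (_ , r) → rep⇒loc {a} r))) ⟩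
    cnt L? (suc N) * Q * d                          ≤⟨ *-monoˡ-≤ d (*-monoˡ-≤ Q (cnt-mono L? (<⇒≤ (m<suc[m/n]*n (suc N) Q)))) ⟩
    cnt L? (suc (suc N / Q) * Q) * Q * d            ≡⟨ cong (λ t → t * Q * d) (cnt-periodic L? Q (loc-mod {a}) (suc (suc N / Q))) ⟩
    suc (suc N / Q) * R * Q * d                     ≡⟨ lem₁ (suc N / Q) R Q d ⟩
    R * (Q + suc N / Q * Q) * d                     ≤⟨ *-monoˡ-≤ d (*-monoʳ-≤ R (+-monoʳ-≤ Q (m/n*n≤m (suc N) Q))) ⟩
    R * (Q + suc N) * d                             ≡⟨ lem₂ R Q N d ⟩
    R * N * d + R * suc Q * d                       <⟨ +-monoʳ-< (R * N * d) (≤-trans N≥ (m≤m*n N Q)) ⟩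
    R * N * d + N * Q                               ∎
    where
    open ≤-Reasoning
    lem₁ : ∀ t R Q d → suc t * R * Q * d ≡ R * (Q + t * Q) * d
    lem₁ = ℕS.solve-∀
    lem₂ : ∀ R Q N d → R * (Q + suc N) * d ≡ R * N * d + R * suc Q * d
    lem₂ = ℕS.solve-∀

  cnt-rep-lower : ∀ d → ∃ λ N₀ → ∀ N → N₀ ≤ N → R * N * d < cnt P? (suc N) * Q * d + N * Q
  -- The factor 4 leaves room: the exceptions take about N / 4 of the allowed error N. The remaining
  -- `suc R * d`, due to the cut period (`R`) and to k = 0 (the extra 1), is kept below N / 2 by the
  -- threshold.
  cnt-rep-lower d with AlmostAll.exceptions (aa-loc⇒rep a b) (4 * d)
  ... | E , E? , good , N₁ , sparse = N₁ + suc (2 * (suc R * d)) , λ N N≥ → begin-strict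
    R * N * d                                                   ≤⟨ *-monoˡ-≤ d (*-monoʳ-≤ R (<⇒≤ (m<suc[m/n]*n N Q))) ⟩
    R * (suc (N / Q) * Q) * d                                   ≡⟨ lem₁ (N / Q) R Q d ⟩
    (N / Q * R) * Q * d + R * Q * d                             ≡⟨ cong (λ t → t * Q * d + R * Q * d) (sym (cnt-periodic L? Q (loc-mod {a}) (N / Q))) ⟩
    cnt L? (N / Q * Q) * Q * d + R * Q * d                      ≤⟨ +-monoˡ-≤ (R * Q * d) (*-monoˡ-≤ d (*-monoˡ-≤ Q (cnt-mono L? (m≤n⇒m≤1+n (m/n*n≤m N Q))))) ⟩
    cnt L? (suc N) * Q * d + R * Q * d                          ≤⟨ +-monoˡ-≤ (R * Q * d) (*-monoˡ-≤ d (*-monoˡ-≤ Q (covered N))) ⟩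
    (cnt P? (suc N) + (cnt E? (suc N) + 1)) * Q * d + R * Q * d ≡⟨ lem₂ (cnt P? (suc N)) (cnt E? (suc N)) Q d R ⟩
    cnt P? (suc N) * Q * d + (cnt E? (suc N) * d + suc R * d) * Q <⟨ +-monoʳ-< (cnt P? (suc N) * Q * d) (*-monoˡ-< Q (small N N≥)) ⟩
    cnt P? (suc N) * Q * d + N * Q                              ∎
    where
    open ≤-Reasoning
    lem₁ : ∀ t R Q d → R * (suc t * Q) * d ≡ t * R * Q * d + R * Q * d
    lem₁ = ℕS.solve-∀
    lem₂ : ∀ c e Q d R → (c + (e + 1)) * Q * d + R * Q * d ≡ c * Q * d + (e * d + suc R * d) * Q
    lem₂ = ℕS.solve-∀
    EZ? : Decidable (λ k → E k ⊎ k ≡ 0)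
    EZ? k = E? k ⊎-dec (k ≟ 0)
    covered : ∀ N → cnt L? (suc N) ≤ cnt P? (suc N) + (cnt E? (suc N) + 1)
    covered N = begin
      cnt L? (suc N)                                        ≤⟨ cnt-∪ L? P? EZ? (suc N) split ⟩
      cnt P? (suc N) + cnt EZ? (suc N)                      ≤⟨ +-monoʳ-≤ (cnt P? (suc N)) (cnt-∪ EZ? E? (_≟ 0) (suc N) (λ _ _ → id)) ⟩
      cnt P? (suc N) + (cnt E? (suc N) + cnt (_≟ 0) (suc N)) ≤⟨ +-monoʳ-≤ (cnt P? (suc N)) (+-monoʳ-≤ (cnt E? (suc N)) (cnt-≟0 (suc N))) ⟩
      cnt P? (suc N) + (cnt E? (suc N) + 1)                 ∎
      where
      split : ∀ k → k < suc N → Loc a b (+ k) → PosRep a b k ⊎ (E k ⊎ k ≡ 0)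
      split zero      _ _ = inj₂ (inj₂ refl)
      split k@(suc _) _ l with E? k
      ... | yes e = inj₂ (inj₁ e)
      ... | no ¬e = inj₁ ((λ ()) , good k (s≤s z≤n) ¬e l)
    small : ∀ N → N₁ + suc (2 * (suc R * d)) ≤ N → cnt E? (suc N) * d + suc R * d < N
    small N N≥ = *-cancelˡ-< 4 _ _ (begin-strict
      4 * (cnt E? (suc N) * d + suc R * d)              ≡⟨ lem₃ (cnt E? (suc N)) d (suc R) ⟩
      4 * d * cnt E? (suc N) + 2 * (2 * (suc R * d))    ≤⟨ +-monoˡ-≤ _ (sparse (suc N) (≤-trans (m≤m+n N₁ _) (m≤n⇒m≤1+n N≥))) ⟩
      suc N + 2 * (2 * (suc R * d))                     ≤⟨ +-monoˡ-≤ _ (s≤s (m≤m+n N N)) ⟩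
      suc (N + N) + 2 * (2 * (suc R * d))               <⟨ n<1+n _ ⟩
      suc (suc (N + N)) + 2 * (2 * (suc R * d))         ≡⟨ lem₄ N (2 * (suc R * d)) ⟩
      N + N + 2 * suc (2 * (suc R * d))                 ≤⟨ +-monoʳ-≤ (N + N) (*-monoʳ-≤ 2 (≤-trans (m≤n+m _ N₁) N≥)) ⟩
      N + N + 2 * N                                     ≡⟨ lem₅ N ⟩
      4 * N                                             ∎)
      where
      lem₃ : ∀ e d R → 4 * (e * d + R * d) ≡ 4 * d * e + 2 * (2 * (R * d))
      lem₃ = ℕS.solve-∀
      lem₄ : ∀ N x → suc (suc (N + N)) + 2 * x ≡ N + N + 2 * suc x
      lem₄ = ℕS.solve-∀
      lem₅ : ∀ N → N + N + 2 * N ≡ 4 * N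
      lem₅ = ℕS.solve-∀

cnt≡length : ∀ {P : ℕ → Set} (P? : Decidable P) n → length (filter P? (downFrom n)) ≡ cnt P? n
cnt≡length P? zero = refl
cnt≡length P? (suc n) with P? n
... | yes _ = cong suc (cnt≡length P? n)
... | no _  = cnt≡length P? n

module _ (S : ℤ → Set) {P N : ℕ → Set} (P? : Decidable P) (N? : Decidable N)
         (P⇒S : ∀ {k} → P k → ¬ k ≡ 0 × S (+ k)) (S⇒P : ∀ {k} → S (+ k) → P k)
         (N⇒S : ∀ {k} → N k → ¬ k ≡ 0 × S (ℤ.- (+ k))) (S⇒N : ∀ {k} → S (-[1+ k ]) → N (suc k)) where

  countIs-symmetric : ∀ n → CountIs S (ℤ.- (+ n)) (+ n) (cnt P? (suc n) + cnt N? (suc n))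
  countIs-symmetric n = ps ++ ns ,
    Unique.++⁺ (Unique.map⁺ ℤP.+-injective (Unique.filter⁺ P? (Unique.downFrom⁺ (suc n))))
               (Unique.map⁺ (ℤP.+-injective ∘ ℤP.neg-injective) (Unique.filter⁺ N? (Unique.downFrom⁺ (suc n)))) disjoint ,
    (λ x → mk⇔ (λ x∈ → to x (∈-++⁻ ps x∈)) (from x)) ,
    trans (length-++ ps) (cong₂ _+_ (trans (length-map +_ (filter P? (downFrom (suc n)))) (cnt≡length P? (suc n))) (trans (length-map (λ k → ℤ.- (+ k)) (filter N? (downFrom (suc n)))) (cnt≡length N? (suc n))))
    where
    ps = map +_ (filter P? (downFrom (suc n)))
    ns = map (λ k → ℤ.- (+ k)) (filter N? (downFrom (suc n)))
    ∈ps : ∀ {x} → x ∈ ps → ∃ λ k → k ≤ n × P k × x ≡ + k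
    ∈ps x∈ = let (k , k∈ , e) = ∈-map⁻ +_ x∈
                 (k∈′ , Pk) = ∈-filter⁻ P? k∈
             in k , s≤s⁻¹ (∈-downFrom⁻ k∈′) , Pk , e
    ∈ns : ∀ {x} → x ∈ ns → ∃ λ k → k ≤ n × N k × x ≡ ℤ.- (+ k)
    ∈ns x∈ = let (k , k∈ , e) = ∈-map⁻ (λ k → ℤ.- (+ k)) x∈
                 (k∈′ , Nk) = ∈-filter⁻ N? k∈
             in k , s≤s⁻¹ (∈-downFrom⁻ k∈′) , Nk , e
    +≢- : ∀ {k l} → ¬ l ≡ 0 → ¬ + k ≡ ℤ.- (+ l)
    +≢- {l = zero}  l≢0 _ = l≢0 refl
    +≢- {l = suc _} _ ()
    disjoint : ∀ {x} → ¬ (x ∈ ps × x ∈ ns)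
    disjoint (p , q) with ∈ps p | ∈ns q
    ... | k , _ , _ , refl | l , _ , Nl , e = +≢- (proj₁ (N⇒S Nl)) e
    to : ∀ x → x ∈ ps ⊎ x ∈ ns → ℤ.- (+ n) ℤ.≤ x × x ℤ.≤ + n × S x
    to x (inj₁ p) with ∈ps p
    ... | k , k≤n , Pk , refl = ℤP.neg-≤-pos , ℤ.+≤+ k≤n , proj₂ (P⇒S Pk)
    to x (inj₂ q) with ∈ns q
    ... | k , k≤n , Nk , refl = ℤP.neg-mono-≤ (ℤ.+≤+ k≤n) , ℤP.neg-≤-pos , proj₂ (N⇒S Nk)
    from : ∀ x → ℤ.- (+ n) ℤ.≤ x × x ℤ.≤ + n × S x → x ∈ ps ++ ns
    from (+ k) (_ , ℤ.+≤+ k≤n , s) = ∈-++⁺ˡ (∈-map⁺ +_ (∈-filter⁺ P? (∈-downFrom⁺ (s≤s k≤n)) (S⇒P s)))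
    from (-[1+ k ]) (l , _ , s) = ∈-++⁺ʳ ps (∈-map⁺ (λ k → ℤ.- (+ k)) (∈-filter⁺ N? (∈-downFrom⁺ (s≤s (ℤP.drop‿+≤+ (ℤP.neg-cancel-≤ {+ n} {+ suc k} l)))) (S⇒N s)))

-- From integer inequalities to rational limits

ε-fraction : ∀ ε → 0ℚ ℚ.< ε → ∃₂ λ n d → ε ℚ.* nat (suc d) ≡ nat (suc n)
ε-fraction ε@(ℚ.mkℚ (+ suc n) d _) _ = n , d , trans (cong (ℚ._* nat (suc d)) (sym (ℚP.↥p/↧p≡p ε))) (/-*-nat (suc n) (suc d))
ε-fraction (ℚ.mkℚ (+ 0) d _) (ℚ.*<* (ℤ.+<+ ()))
ε-fraction (ℚ.mkℚ -[1+ n ] d _) (ℚ.*<* ())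

∣-∣<-intro : ∀ {x y ε} → x ℚ.< y ℚ.+ ε → y ℚ.< x ℚ.+ ε → ℚ.∣ x ℚ.- y ∣ ℚ.< ε
∣-∣<-intro {x} {y} {ε} x< y< with ℚP.∣p∣≡p∨∣p∣≡-p (x ℚ.- y)
... | inj₁ e = subst₂ ℚ._<_ (sym e) (lem y ε) (ℚP.+-monoˡ-< (ℚ.- y) x<)
  where
  open +-*-Solver
  lem : ∀ y ε → y ℚ.+ ε ℚ.- y ≡ ε
  lem = solve 2 (λ y ε → y :+ ε :- y := ε) refl
... | inj₂ e = subst₂ ℚ._<_ (trans (lem′ x y) (sym e)) (lem x ε) (ℚP.+-monoˡ-< (ℚ.- x) y<)
  where
  open +-*-Solver
  lem : ∀ x ε → x ℚ.+ ε ℚ.- x ≡ ε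
  lem = solve 2 (λ y ε → y :+ ε :- y := ε) refl
  lem′ : ∀ x y → y ℚ.- x ≡ ℚ.- (x ℚ.- y)
  lem′ = solve 2 (λ x y → y :- x := :- (x :- y)) refl

nat-nonNeg : ∀ n → ℚ.NonNegative (nat n)
nat-nonNeg zero    = _
nat-nonNeg (suc n) = ℚ.nonNegative (ℚP.<⇒≤ (nat-mono-< {0} {suc n} (s≤s z≤n)))

*-nat-cancel-< : ∀ n {x y} → x ℚ.* nat n ℚ.< y ℚ.* nat n → x ℚ.< y
*-nat-cancel-< n = ℚP.*-cancelʳ-<-nonNeg (nat n) {{nat-nonNeg n}}

-- Divided by M Q d, the two inequalities bound the distance of c / M from R / Q by 1 / d, which is
-- at most ε = (n + 1) / d.
fraction-close : ∀ {c M Q R d n} .{{_ : NonZero M}} {q ε} → nat R ≡ nat Q ℚ.* q → ε ℚ.* nat d ≡ nat (suc n) →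
                 c * Q * d < R * M * d + M * Q → R * M * d < c * Q * d + M * Q →
                 ℚ.∣ (+ c ℚ./ M) ℚ.- q ∣ ℚ.< ε
fraction-close {c} {M} {Q} {R} {d} {n} {q} {ε} R≡ ε≡ upper lower = ∣-∣<-intro {x} {q} {ε}
  (*-nat-cancel-< (M * Q * d) {x} {q ℚ.+ ε} (subst₂ ℚ._<_ (sym x≡) (sym (trans (ℚP.*-distribʳ-+ (nat (M * Q * d)) q ε) (sums q (R * M * d) q≡)))
     (nat-mono-< (≤-trans upper (+-monoʳ-≤ (R * M * d) (m≤n*m (M * Q) (suc n)))))))
  (*-nat-cancel-< (M * Q * d) {q} {x ℚ.+ ε} (subst₂ ℚ._<_ (sym q≡) (sym (trans (ℚP.*-distribʳ-+ (nat (M * Q * d)) x ε) (sums x (c * Q * d) x≡)))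
     (nat-mono-< (≤-trans lower (+-monoʳ-≤ (c * Q * d) (m≤n*m (M * Q) (suc n)))))))
  where
  open +-*-Solver
  x = + c ℚ./ M
  nat³ : ∀ a b c → nat (a * b * c) ≡ nat a ℚ.* nat b ℚ.* nat c
  nat³ a b c = trans (nat-* (a * b) c) (cong (ℚ._* nat c) (nat-* a b))
  lem₁ : ∀ x M Q d → x ℚ.* (M ℚ.* Q ℚ.* d) ≡ (x ℚ.* M) ℚ.* Q ℚ.* d
  lem₁ = solve 4 (λ x M Q d → x :* (M :* Q :* d) := (x :* M) :* Q :* d) refl
  lem₂ : ∀ q M Q d → q ℚ.* (M ℚ.* Q ℚ.* d) ≡ (Q ℚ.* q) ℚ.* M ℚ.* d
  lem₂ = solve 4 (λ x M Q d → x :* (M :* Q :* d) := (Q :* x) :* M :* d) refl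
  lem₃ : ∀ ε M Q d → ε ℚ.* (M ℚ.* Q ℚ.* d) ≡ (ε ℚ.* d) ℚ.* (M ℚ.* Q)
  lem₃ = solve 4 (λ x M Q d → x :* (M :* Q :* d) := (x :* d) :* (M :* Q)) refl
  x≡ : x ℚ.* nat (M * Q * d) ≡ nat (c * Q * d)
  x≡ = trans (cong (x ℚ.*_) (nat³ M Q d)) (trans (lem₁ x (nat M) (nat Q) (nat d)) (trans (cong (λ t → t ℚ.* nat Q ℚ.* nat d) (/-*-nat c M)) (sym (nat³ c Q d))))
  q≡ : q ℚ.* nat (M * Q * d) ≡ nat (R * M * d)
  q≡ = trans (cong (q ℚ.*_) (nat³ M Q d)) (trans (lem₂ q (nat M) (nat Q) (nat d)) (trans (cong (λ t → t ℚ.* nat M ℚ.* nat d) (sym R≡)) (sym (nat³ R M d))))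
  ε′≡ : ε ℚ.* nat (M * Q * d) ≡ nat (suc n * (M * Q))
  ε′≡ = trans (cong (ε ℚ.*_) (nat³ M Q d)) (trans (lem₃ ε (nat M) (nat Q) (nat d)) (trans (cong₂ ℚ._*_ ε≡ (sym (nat-* M Q))) (sym (nat-* (suc n) (M * Q)))))
  sums : ∀ y k → y ℚ.* nat (M * Q * d) ≡ nat k → y ℚ.* nat (M * Q * d) ℚ.+ ε ℚ.* nat (M * Q * d) ≡ nat (k + suc n * (M * Q))
  sums y k e = trans (cong₂ ℚ._+_ e ε′≡) (sym (nat-+ k (suc n * (M * Q))))

module _ (a : ℤ) (b : ℕ) .{{_ : NonZero b}} (a⊥b : Coprime ℤ.∣ a ∣ b) (Δ : ℤ) (∣Δ∣≡b² : ℤ.∣ Δ ∣ ≡ b * b) where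

  -- The residue 0 is always a local value, so `localCount` is at least 1.
  densityFormula-positive : 0ℚ ℚ.< densityFormula Δ
  densityFormula-positive = *-nat-cancel-< (b * b) {0ℚ} {densityFormula Δ} (subst₂ ℚ._<_ (sym (ℚP.*-zeroˡ (nat (b * b))))
    (trans (localCount-density a b a⊥b Δ ∣Δ∣≡b²) (ℚP.*-comm (nat (b * b)) (densityFormula Δ)))
    (nat-mono-< {0} {localCount a b} (begin
      1                                   ≡⟨ sym (cnt-all (λ n → loc? a b (+ n)) 1 λ { _ (s≤s z≤n) → loc-0 a b }) ⟩
      cnt (λ n → loc? a b (+ n)) 1        ≤⟨ cnt-mono (λ n → loc? a b (+ n)) (*-mono-≤ (>-nonZero⁻¹ b) (>-nonZero⁻¹ b)) ⟩
      localCount a b                      ∎)))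
    where open ≤-Reasoning

  cnt-rep-limit : ∀ d → ∃ λ N₀ → ∀ N → N₀ ≤ N →
    let c = cnt (posRep? a b) (suc N) + cnt (posRep? (ℤ.- a) b) (suc N) ; R = localCount a b ; M = N + N ; Q = b * b in
    c * Q * d < R * M * d + M * Q × R * M * d < c * Q * d + M * Q
  cnt-rep-limit d =
    let (N₁ , up)  = cnt-rep-upper a b d
        (N₂ , up′) = cnt-rep-upper (ℤ.- a) b d
        (N₃ , lo)  = cnt-rep-lower a b d
        (N₄ , lo′) = cnt-rep-lower (ℤ.- a) b d
    in N₁ + N₂ + (N₃ + N₄) , λ N N≥ →
       let c₁ = cnt (posRep? a b) (suc N)
           c₂ = cnt (posRep? (ℤ.- a) b) (suc N)
           up″ = subst (λ r → c₂ * Q * d < r * N * d + N * Q) R′≡R (up′ N (≤-trans (m≤n+m N₂ N₁) (≤-trans (m≤m+n (N₁ + N₂) _) N≥)))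
           lo″ = subst (λ r → r * N * d < c₂ * Q * d + N * Q) R′≡R (lo′ N (≤-trans (m≤n+m N₄ N₃) (≤-trans (m≤n+m (N₃ + N₄) (N₁ + N₂)) N≥)))
       in subst₂ _<_ (lem₁ c₁ c₂ Q d) (lem₂ R N d Q) (+-mono-< (up N (≤-trans (m≤m+n N₁ N₂) (≤-trans (m≤m+n (N₁ + N₂) _) N≥))) up″) ,
          subst₂ _<_ (lem₃ R N d) (lem₄ c₁ c₂ Q d N) (+-mono-< (lo N (≤-trans (m≤m+n N₃ N₄) (≤-trans (m≤n+m (N₃ + N₄) (N₁ + N₂)) N≥))) lo″)
    where
    Q = b * b
    R = localCount a b
    -- Both counts are b² times the same formula, in which a does not occur; no bijection between
    -- the two sets is required.
    R′≡R : localCount (ℤ.- a) b ≡ R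
    R′≡R = nat-injective (trans (localCount-density (ℤ.- a) b (subst (λ t → Coprime t b) (sym (ℤP.∣-i∣≡∣i∣ a)) a⊥b) Δ ∣Δ∣≡b²)
                                (sym (localCount-density a b a⊥b Δ ∣Δ∣≡b²)))
    lem₁ : ∀ x y Q d → x * Q * d + y * Q * d ≡ (x + y) * Q * d
    lem₁ = ℕS.solve-∀
    lem₂ : ∀ R N d Q → R * N * d + N * Q + (R * N * d + N * Q) ≡ R * (N + N) * d + (N + N) * Q
    lem₂ = ℕS.solve-∀
    lem₃ : ∀ R N d → R * N * d + R * N * d ≡ R * (N + N) * d
    lem₃ = ℕS.solve-∀
    lem₄ : ∀ x y Q d N → x * Q * d + N * Q + (y * Q * d + N * Q) ≡ (x + y) * Q * d + (N + N) * Q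
    lem₄ = ℕS.solve-∀

-- Take x = 1 and z the residue of a increased by b, which is positive even when the residue is 0.
rep-positive : ∀ a b .{{_ : NonZero b}} → ∃ λ k → Rep a b (+ suc k)
rep-positive a b@(suc b-1) = a ℤDM.%ℕ b + b-1 , + 1 , + suc (a ℤDM.%ℕ b + b-1) , ℤP.*-identityˡ _ ,
  mod-trans (mod-by (+ 1) (trans (cong +_ (sym (+-suc (a ℤDM.%ℕ b) b-1))) (cong (ℤ._+_ (+ (a ℤDM.%ℕ b))) (sym (ℤP.*-identityˡ (+ b))))))
    (mod-trans (mod-sym (mod-rem b a)) (≡⇒mod (sym (ℤP.*-identityʳ a))))

module _ (A B C : ℤ) (prim : Primitive A B C) (b : ℕ) (0<b : 0 < b) (disc≡ : disc A B C ≡ + b ℤ.* + b) where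

  private
    Δ = disc A B C
    instance
      b≢0 : NonZero b
      b≢0 = >-nonZero 0<b
    open ReducedForm (reduce-form A B C b prim 0<b disc≡)

    ∣Δ∣≡b² : ℤ.∣ Δ ∣ ≡ b * b
    ∣Δ∣≡b² = trans (cong ℤ.∣_∣ disc≡) (ℤP.abs-* (+ b) (+ b))

    +≢0 : ∀ {k} → ¬ k ≡ 0 → ¬ + k ≡ + 0
    +≢0 k≢0 e = k≢0 (ℤP.+-injective e)

    pos⇒D : ∀ {k} → PosRep a b k → ¬ k ≡ 0 × D A B C (+ k)
    pos⇒D (k≢0 , r) = k≢0 , +≢0 k≢0 , from r

    D⇒pos : ∀ {k} → D A B C (+ k) → PosRep a b k
    D⇒pos (k≢0 , r) = (λ { refl → k≢0 refl }) , to r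

    neg⇒D : ∀ {k} → PosRep (ℤ.- a) b k → ¬ k ≡ 0 × D A B C (ℤ.- (+ k))
    neg⇒D {k} (k≢0 , r) = k≢0 , (λ e → +≢0 k≢0 (ℤP.neg-injective e)) , from (subst (λ t → Rep t b (ℤ.- (+ k))) (ℤP.neg-involutive a) (rep-neg {ℤ.- a} r))

    D⇒neg : ∀ {k} → D A B C (-[1+ k ]) → PosRep (ℤ.- a) b (suc k)
    D⇒neg (_ , r) = (λ ()) , rep-neg {a} (to r)

  disc-density-positive : 0ℚ ℚ.< densityFormula Δ
  disc-density-positive = densityFormula-positive a b coprime Δ ∣Δ∣≡b²

  not-positive : ¬ PositiveSet (D A B C)
  not-positive pos with rep-positive (ℤ.- a) b
  ... | k , r with pos -[1+ k ] (proj₂ (neg⇒D ((λ ()) , r)))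
  ...   | ()

  not-negative : ¬ NegativeSet (D A B C)
  not-negative neg with rep-positive a b
  ... | k , r with neg (+ suc k) (proj₂ (pos⇒D ((λ ()) , r)))
  ...   | ℤ.+≤+ ()

  limit : LimIndef (D A B C) (densityFormula Δ)
  limit ε 0<ε =
    let (n , d , ε≡) = ε-fraction ε 0<ε
        (N₀ , bounds) = cnt-rep-limit a b coprime Δ ∣Δ∣≡b² (suc d)
    in N₀ , λ m N₀≤m →
       let N = suc m
           c = cnt (posRep? a b) (suc N) + cnt (posRep? (ℤ.- a) b) (suc N)
           (upper , lower) = bounds N (m≤n⇒m≤1+n N₀≤m)
       in c ,
          countIs-symmetric (D A B C) (posRep? a b) (posRep? (ℤ.- a) b) pos⇒D D⇒pos neg⇒D D⇒neg N ,
          fraction-close {c} {M = N + N} {Q = b * b} {R = localCount a b} {d = suc d} {n = n} {q = densityFormula Δ} {ε = ε}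
            (localCount-density a b coprime Δ ∣Δ∣≡b²) ε≡ upper lower

theorem1p6 : (A B C : ℤ) → Primitive A B C → ¬ (disc A B C ≡ + 0) →
    (∃[ b ] (0 < b × disc A B C ≡ + b ℤ.* + b)) →
    0ℚ ℚ.< densityFormula (disc A B C)
    × HasDensity (D A B C) (densityFormula (disc A B C))
    × (∀ p → Prime p → 2 ∣ (v p ℤ.∣ disc A B C ∣))
    × (∀ p → Prime p → (factor (disc A B C) p ≡ 1ℚ) ⇔ (v p ℤ.∣ disc A B C ∣ ≡ 0))
theorem1p6 A B C prim _ (b , 0<b , disc≡) =
  disc-density-positive A B C prim b 0<b disc≡ ,
  inj₂ (inj₂ (not-positive A B C prim b 0<b disc≡ , not-negative A B C prim b 0<b disc≡ , limit A B C prim b 0<b disc≡)) ,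
  (λ p pp → subst (λ n → 2 ∣ v p n) (sym (trans (cong ℤ.∣_∣ disc≡) (ℤP.abs-* (+ b) (+ b)))) (v-even 0<b pp)) ,
  (λ p pp → factor≡1⇔v≡0 (disc A B C) pp)
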